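{- Let $G$ be a clean 2-dd all of whose alternating cycles have exactly 6 arcs, and suppose $G$ is odd, connected and not 2-splittable. Let $F$ be a subgraph of $G$ with exactly 2 alternating cycles and exactly $s$ saturated vertices. If $s>2$, then we can either collapse $F$ entirely or replace $F$ with a single alternating cycle, so as to obtain an odd 2-dd $G'$, all of whose alternating cycles have exactly 6 arcs, which is H-equivalent to $G$.
   Context: A 2-digraph is a finite digraph in which each vertex has (in-degree, out-degree) equal to $(0,2)$ (an entry vertex), $(2,0)$ (an exit vertex) or $(2,2)$ (a saturated vertex). A 2-dd is a 2-digraph all of whose vertices are saturated. Connected means that the underlying undirected graph is connected. An alternating cycle (AC) is a sequence of $2r$ distinct arcs $(e_0,\dots,e_{2r-1})$ such that $e_i$ and $e_{i+1}$ (indices mod $2r$) have a common end-vertex if $i$ is even and a common start-vertex if $i$ is odd; its forward arcs are the $e_i$ with $i$ even and its backward arcs those with $i$ odd. The arc set of a 2-digraph is uniquely partitioned into ACs. An AC is clean if no vertex is both the start-vertex of one of its arcs and the end-vertex of one of its arcs; a 2-digraph is clean if all its ACs are clean. A subgraph of a 2-dd $G$ means the 2-digraph induced by a non-empty set $K$ of ACs of $G$ (all arcs of these ACs and their end-points). Entry, exit and saturated vertices of a subgraph $F$ are with respect to degrees in $F$. The complement $\overline{F}$ is the subgraph induced by the remaining ACs; the entry vertices of $F$ are exactly the exit vertices of $\overline{F}$ and vice versa. A factor of a 2-digraph is a spanning subgraph which, for every AC, contains either all its forward arcs and none of its backward arcs, or vice versa; it is a disjoint union of directed cycles and directed paths from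 entry to exit vertices. A factor is open if it contains no cycle. The route of a factor is the bijection from entry vertices to exit vertices sending each entry vertex to the end of the path starting there; a route is open if it is the route of at least one open factor. A 2-dd is odd if every one of its factors has an odd number of cycles. It is Hamiltonian if it has a directed cycle through all vertices. Two 2-dds are H-equivalent if both are Hamiltonian or both are non-Hamiltonian. Splitting a saturated vertex $v$ means replacing it by two vertices $v^{in},v^{out}$, the two in-arcs of $v$ becoming in-arcs of $v^{in}$ and the two out-arcs becoming out-arcs of $v^{out}$. $G$ is 2-splittable if there is a set of 2 saturated vertices such that splitting both increases the number of connected components. Collapsing $F$ (when $F$ has a unique open route $r$): replace $G$ by the 2-dd formed from $\overline{F}$ by identifying each entry vertex $u$ of $F$ with the exit vertex $r(u)$ of $F$ (the arcs and saturated vertices of $F$ are deleted); this is the unique minor in the quotient of $G$ by $F$. Replacing $F$ by a 2-digraph $F'$ with the same number of exit vertices as $F$: form a 2-dd from the disjoint union of $\overline{F}$ and $F'$ by identifying the exit vertices of $\overline{F}$ with the entry vertices of $F'$ via some bijection and the exit vertices of $F'$ with the entry vertices of $\overline{F}$ via some bijection. -}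

module Defs where

open import Level using (0ℓ)
open import Data.Bool.Base using (if_then_else_)
open import Data.Nat.Base as ℕ using (ℕ; suc; NonZero; _*_; _%_)
open import Data.Nat.DivMod using (_mod_)
import Data.Nat.Properties as ℕₚ
open import Data.Fin.Base using (Fin; zero; suc; toℕ; splitAt; _↑ˡ_; _↑ʳ_)
open import Data.Fin.Properties using (_≟_; any?)
open import Data.Fin.Subset using (Subset; _∈_; _∉_; ∁; Nonempty)
open import Data.Fin.Subset.Properties using (_∈?_)
open import Data.List.Base using (List; length; filter; lookup; allFin)
open import Data.List.Membership.Propositional.Properties
  using (∈-filter⁺; ∈-filter⁻; ∈-allFin; ∈-lookup)
open import Data.List.Relation.Unary.Any using (index)
open import Data.List.Relation.Unary.Any.Properties using (lookup-index)
open import Data.Product using (Σ; ∃; ∃₂; _×_; _,_; proj₁; proj₂)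
open import Data.Sum using (_⊎_; inj₁; inj₂; [_,_]′)
open import Function.Base using (_∘_)
open import Function.Bundles using (_⇔_; _↔_; Inverse)
open import Function.Definitions using (Injective; Surjective; Bijective)
open import Relation.Binary.Core using (Rel)
open import Relation.Binary.Construct.Closure.Equivalence using (EqClosure)
open import Relation.Binary.Construct.Closure.ReflexiveTransitive using (Star)
open import Relation.Binary.PropositionalEquality using (_≡_; _≢_; sym)
open import Relation.Nullary using (¬_; does)
open import Relation.Nullary.Decidable using (_×-dec_; _⊎-dec_)
open import Relation.Unary using (Pred; Decidable)

#[_] : ∀ {n} {P : Pred (Fin n) 0ℓ} → Decidable P → ℕ
#[_] {n} P? = length (filter P? (allFin n))

-- "There are exactly k elements of X up to _≈_."
Exactly : ℕ → (X : Set) → Rel X 0ℓ → Set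
Exactly k X _≈_ = ∃ λ (f : Fin k → X) → Bijective _≡_ _≈_ f

-- i ↦ i + 1 modulo n
next : ∀ {n} → Fin n → Fin n
next {suc n} i = suc (toℕ i) mod suc n

-- Loops and parallel arcs are allowed, since identifying vertices can
-- create them.
record Digraph : Set where
  field
    #V #A   : ℕ
    src tgt : Fin #A → Fin #V

  V A : Set
  V = Fin #V
  A = Fin #A

  indeg outdeg : V → ℕ
  indeg  v = #[ (λ a → tgt a ≟ v) ]
  outdeg v = #[ (λ a → src a ≟ v) ]

  IsEntry IsExit IsSaturated : V → Set
  IsEntry     v = indeg v ≡ 0 × outdeg v ≡ 2
  IsExit      v = indeg v ≡ 2 × outdeg v ≡ 0
  IsSaturated v = indeg v ≡ 2 × outdeg v ≡ 2

  isExit? : Decidable IsExit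
  isExit? v = (indeg v ℕₚ.≟ 2) ×-dec (outdeg v ℕₚ.≟ 0)

  isSaturated? : Decidable IsSaturated
  isSaturated? v = (indeg v ℕₚ.≟ 2) ×-dec (outdeg v ℕₚ.≟ 2)

  Entry Exit : Set
  Entry = ∃ IsEntry
  Exit  = ∃ IsExit

  #exits #saturated : ℕ
  #exits     = #[ isExit? ]
  #saturated = #[ isSaturated? ]

  Adjacent : Rel V 0ℓ
  Adjacent u v = ∃ λ a → src a ≡ u × tgt a ≡ v

  SameComponent : Rel V 0ℓ
  SameComponent = EqClosure Adjacent

open Digraph

Is2Digraph : Digraph → Set
Is2Digraph G = ∀ v → IsEntry G v ⊎ IsExit G v ⊎ IsSaturated G v

Is2dd : Digraph → Set
Is2dd G = ∀ v → IsSaturated G v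

Connected : Digraph → Set
Connected G = ∀ u v → SameComponent G u v

-- The sequence (e₀, …, e₂ᵣ₋₁) is presented by its forward arcs
-- fwd i = e₂ᵢ and its backward arcs bwd i = e₂ᵢ₊₁.
record AltCycle (G : Digraph) : Set where
  field
    r           : ℕ
    r≢0         : NonZero r
    fwd bwd     : Fin r → A G
    fwd-inj     : Injective _≡_ _≡_ fwd
    bwd-inj     : Injective _≡_ _≡_ bwd
    fwd≢bwd     : ∀ i j → fwd i ≢ bwd j
    common-end   : ∀ i → tgt G (fwd i) ≡ tgt G (bwd i)
    common-start : ∀ i → src G (bwd i) ≡ src G (fwd (next i))

  #arcs : ℕ
  #arcs = 2 * r

  _∋_ : A G → Set
  _∋_ a = ∃ λ i → fwd i ≡ a ⊎ bwd i ≡ a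

open AltCycle using (#arcs; _∋_; fwd; bwd)

-- A cyclic sequence matters only through its set of arcs.
SameAltCycle : ∀ {G} → Rel (AltCycle G) 0ℓ
SameAltCycle C D = ∀ a → (C ∋ a) ⇔ (D ∋ a)

#AltCycles≡ : Digraph → ℕ → Set
#AltCycles≡ G k = Exactly k (AltCycle G) SameAltCycle

AllAltCyclesHave6Arcs : Digraph → Set
AllAltCyclesHave6Arcs G = ∀ (C : AltCycle G) → #arcs C ≡ 6

Clean : Digraph → Set
Clean G = ∀ (C : AltCycle G) {a b} → C ∋ a → C ∋ b → src G a ≢ tgt G b

record Cycle (G : Digraph) : Set where
  field
    len      : ℕ
    len≢0    : NonZero len
    arc      : Fin len → A G
    joined   : ∀ i → tgt G (arc i) ≡ src G (arc (next i))
    distinct : Injective _≡_ _≡_ (src G ∘ arc)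

open Cycle using (arc)

SameCycle : ∀ {G} → Rel (Cycle G) 0ℓ
SameCycle C D = ∀ a → (∃ λ i → arc C i ≡ a) ⇔ (∃ λ i → arc D i ≡ a)

Hamiltonian : Digraph → Set
Hamiltonian G = ∃ λ (C : Cycle G) → ∀ v → ∃ λ i → src G (arc C i) ≡ v

HEquivalent : Digraph → Digraph → Set
HEquivalent G H =
  (Hamiltonian G × Hamiltonian H) ⊎ (¬ Hamiltonian G × ¬ Hamiltonian H)

-- A factor is spanning, so it is determined by its set S of arcs.
IsFactor : (G : Digraph) → Subset (#A G) → Set
IsFactor G S = ∀ (C : AltCycle G) →
    ((∀ i → fwd C i ∈ S) × (∀ i → bwd C i ∉ S))
  ⊎ ((∀ i → fwd C i ∉ S) × (∀ i → bwd C i ∈ S))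

CycleIn : (G : Digraph) → Subset (#A G) → Set
CycleIn G S = Σ (Cycle G) λ C → ∀ i → arc C i ∈ S

#Cycles≡ : (G : Digraph) → Subset (#A G) → ℕ → Set
#Cycles≡ G S k = Exactly k (CycleIn G S) λ C D → SameCycle (proj₁ C) (proj₁ D)

Odd : Digraph → Set
Odd G = ∀ S → IsFactor G S → ∃ λ k → #Cycles≡ G S k × k % 2 ≡ 1

IsOpen : (G : Digraph) → Subset (#A G) → Set
IsOpen G S = ¬ CycleIn G S

Step : (G : Digraph) → Subset (#A G) → Rel (V G) 0ℓ
Step G S u v = ∃ λ a → a ∈ S × src G a ≡ u × tgt G a ≡ v

EntryExitBijection : Digraph → Set
EntryExitBijection G = Entry G ↔ Exit G

-- Within a factor out-degrees are at most 1, so the path from an entry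
-- vertex reaches exactly one exit vertex.
IsRouteOf : (G : Digraph) → Subset (#A G) → EntryExitBijection G → Set
IsRouteOf G S ρ = ∀ u → Star (Step G S) (proj₁ u) (proj₁ (Inverse.to ρ u))

IsOpenRoute : (G : Digraph) → EntryExitBijection G → Set
IsOpenRoute G ρ = ∃ λ S → IsFactor G S × IsOpen G S × IsRouteOf G S ρ

IsUniqueOpenRoute : (G : Digraph) → EntryExitBijection G → Set
IsUniqueOpenRoute G ρ =
    IsOpenRoute G ρ
  × (∀ ρ′ → IsOpenRoute G ρ′ →
       ∀ u → proj₁ (Inverse.to ρ′ u) ≡ proj₁ (Inverse.to ρ u))

-- The vertex zero is vᵒᵘᵗ and suc v is vⁱⁿ; any other w becomes suc w.
split : (G : Digraph) → V G → Digraph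
split G v = record
  { #V  = suc (#V G)
  ; #A  = #A G
  ; src = λ a → if does (src G a ≟ v) then zero else suc (src G a)
  ; tgt = suc ∘ tgt G
  }

#Components≡ : Digraph → ℕ → Set
#Components≡ G k = Exactly k (V G) (SameComponent G)

Is2Splittable : Digraph → Set
Is2Splittable G =
  ∃₂ λ u v → u ≢ v × IsSaturated G u × IsSaturated G v ×
    (∃₂ λ k l → #Components≡ G k
              × #Components≡ (split (split G u) (suc v)) l
              × k ℕ.< l)

module Induced (G : Digraph) (K : Subset (#A G)) where

  EndPoint : V G → Set
  EndPoint v = ∃ λ a → a ∈ K × (src G a ≡ v ⊎ tgt G a ≡ v)

  endPoint? : Decidable EndPoint
  endPoint? v = any? λ a → (a ∈? K) ×-dec ((src G a ≟ v) ⊎-dec (tgt G a ≟ v))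

  vertices : List (V G)
  vertices = filter endPoint? (allFin (#V G))

  arcs : List (A G)
  arcs = filter (_∈? K) (allFin (#A G))

  ιV : Fin (length vertices) → V G
  ιV = lookup vertices

  ιA : Fin (length arcs) → A G
  ιA = lookup arcs

  ιA∈K : ∀ a → ιA a ∈ K
  ιA∈K a = proj₂ (∈-filter⁻ (_∈? K) {xs = allFin _} (∈-lookup {xs = arcs} a))

  position : ∀ {v} → EndPoint v → Fin (length vertices)
  position {v} p = index (∈-filter⁺ endPoint? (∈-allFin v) p)

  induced : Digraph
  induced = record
    { #V  = length vertices
    ; #A  = length arcs
    ; src = λ a → position (ιA a , ιA∈K a , inj₁ _≡_.refl)
    ; tgt = λ a → position (ιA a , ιA∈K a , inj₂ _≡_.refl)
    }

  ι-src : ∀ a → ιV (src induced a) ≡ src G (ιA a)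
  ι-src a = sym (lookup-index (∈-filter⁺ endPoint? (∈-allFin _) _))

  ι-tgt : ∀ a → ιV (tgt induced a) ≡ tgt G (ιA a)
  ι-tgt a = sym (lookup-index (∈-filter⁺ endPoint? (∈-allFin _) _))

open Induced public using (induced; ιV; ιA)

-- A non-empty set of alternating cycles of G, given by the union K of
-- their arc sets; the corresponding subgraph is induced G K, and its
-- complement is induced G (∁ K).
record IsUnionOfAltCycles (G : Digraph) (K : Subset (#A G)) : Set where
  field
    nonempty : Nonempty K
    union    : ∀ {a} → a ∈ K →
               ∃ λ (C : AltCycle G) → C ∋ a × (∀ {b} → C ∋ b → b ∈ K)

-- H is, up to isomorphism, the digraph obtained from D by identifying
-- vertices related by _~_.
record IsIdentification (D : Digraph) (_~_ : Rel (V D) 0ℓ) (H : Digraph) : Set where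
  field
    onV      : V D → V H
    onA      : A D → A H
    src-comm : ∀ a → src H (onA a) ≡ onV (src D a)
    tgt-comm : ∀ a → tgt H (onA a) ≡ onV (tgt D a)
    onA-bij  : Bijective _≡_ _≡_ onA
    onV-surj : Surjective _≡_ _≡_ onV
    onV-ker  : ∀ u v → (onV u ≡ onV v) ⇔ EqClosure _~_ u v

infixr 5 _⊕_
_⊕_ : Digraph → Digraph → Digraph
D ⊕ E = record
  { #V  = #V D ℕ.+ #V E
  ; #A  = #A D ℕ.+ #A E
  ; src = [ (λ a → src D a ↑ˡ #V E) , (λ a → #V D ↑ʳ src E a) ]′ ∘ splitAt (#A D)
  ; tgt = [ (λ a → tgt D a ↑ˡ #V E) , (λ a → #V D ↑ʳ tgt E a) ]′ ∘ splitAt (#A D)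
  }

module _ (G : Digraph) (K : Subset (#A G)) where

  private
    F F̄ : Digraph
    F = induced G K
    F̄ = induced G (∁ K)

  -- An entry vertex w of F and the vertex ρ w both lie in F̄ as well
  -- when G is a 2-dd.
  CollapseRel : EntryExitBijection F → Rel (V F̄) 0ℓ
  CollapseRel ρ u v = ∃ λ (w : Entry F) →
      ιV G (∁ K) u ≡ ιV G K (proj₁ w)
    × ιV G (∁ K) v ≡ ιV G K (proj₁ (Inverse.to ρ w))

  IsCollapse : Digraph → Set
  IsCollapse G′ = ∃ λ ρ →
    IsUniqueOpenRoute F ρ × IsIdentification F̄ (CollapseRel ρ) G′

  ReplaceRel : (F′ : Digraph) → Exit F̄ ↔ Entry F′ → Exit F′ ↔ Entry F̄ →
               Rel (V (F̄ ⊕ F′)) 0ℓ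
  ReplaceRel F′ α β u v =
      (∃ λ (x : Exit F̄) → u ≡ proj₁ x ↑ˡ #V F′
                        × v ≡ #V F̄ ↑ʳ proj₁ (Inverse.to α x))
    ⊎ (∃ λ (x : Exit F′) → u ≡ #V F̄ ↑ʳ proj₁ x
                         × v ≡ proj₁ (Inverse.to β x) ↑ˡ #V F′)

  IsReplacement : (F′ G′ : Digraph) → Set
  IsReplacement F′ G′ =
      Is2Digraph F′
    × #exits F′ ≡ #exits F
    × (∃₂ λ α β → IsIdentification (F̄ ⊕ F′) (ReplaceRel F′ α β) G′)

{-
F is always replaced by a single hexagon F′. Since F′ has the exits of F, it only matters which
bijections from entries to exits, and which cycles inside, the factors of either digraph
produce. A factor of the new digraph G′ picks the forward or the backward arcs of F′; if each of
these two choices has the same paths and cycles (up to contraction of arcs) as some factor of F,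
then every factor of G′ has as many cycles as some factor of G, so oddness is inherited.

For Hamiltonicity, consider a factor of G that is a Hamiltonian cycle. Its part in F contains no
cycle, except possibly one through all of F. It suffices that this part behaves like one of the
three perfect matchings of the starts of F′ with its ends that arise from the forward arcs by a
rotation: two of them are factors of F′, and if the third, virtual one closes up to a single
cycle, then so does one of the other two, because among the three permutations σ, σρ, σρ² of
three points, with ρ a 3-cycle and σρ² a 3-cycle, σ or σρ is a 3-cycle as well.

That a suitable F′ exists whenever F has at least three saturated vertices depends only on which
ends of either hexagon of F are starts of the other, so it is verified by evaluating a decision
procedure on all finitely many ways of gluing two hexagons. Collapsing is never needed.
-}
module Submission where

open import Defs
open import Level using (0ℓ)
open import Data.Bool.Base using (true; false; if_then_else_)
open import Data.Empty using (⊥-elim)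
open import Data.Fin.Base using (Fin; zero; suc; toℕ; splitAt; join; _↑ˡ_; _↑ʳ_)
open import Data.Fin.Patterns
open import Data.Fin.Properties using (_≟_; any?; ∀-cons; pigeonhole; injective⇒≤; toℕ-injective; toℕ-fromℕ<; toℕ<n; splitAt-join; join-splitAt; splitAt-↑ˡ; splitAt-↑ʳ)
open import Data.Fin.Subset using (Subset; _∈_; _∉_; ∁)
open import Data.Fin.Subset.Properties using (_∈?_; anySubset?; x∈∁p⇒x∉p; x∉p⇒x∈∁p)
open import Data.List.Base as List using (List; []; _∷_; _++_; allFin)
open import Data.List.Membership.Propositional.Properties using (∈-filter⁺; ∈-filter⁻; ∈-allFin; ∈-lookup)
open import Data.List.Relation.Unary.All as All using (All)
open import Data.List.Relation.Unary.AllPairs using (_∷_)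
import Data.List.Relation.Unary.Any as Any
open import Data.List.Relation.Unary.Any.Properties using (lookup-index)
open import Data.List.Relation.Unary.Unique.Propositional using (Unique)
open import Data.List.Relation.Unary.Unique.Propositional.Properties using (filter⁺; allFin⁺)
open import Data.Maybe.Base as Maybe using (Maybe; just; nothing; _>>=_)
open import Data.Maybe.Properties using (≡-dec; just-injective)
open import Data.Nat.Base as ℕ using (ℕ; zero; suc; _+_; _*_; _∸_; _%_; _/_; _<_; _≤_; _>_; s≤s; z≤n; NonZero)
import Data.Nat.DivMod as ℕₚ
open import Data.Nat.Induction using (<-rec)
import Data.Nat.Properties as ℕₚ
open import Data.Product using (∃; ∃₂; _×_; _,_; proj₁; proj₂)
open import Data.Sum as Sum using (_⊎_; inj₁; inj₂; [_,_]′)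
open import Data.Unit.Base using (⊤; tt)
open import Data.Vec.Base as Vec using (Vec; []; _∷_; lookup; tabulate)
open import Data.Vec.Properties using (lookup-map; lookup∘tabulate; []=⇒lookup; lookup⇒[]=)
open import Function.Base using (_∘_; id; const; flip)
open import Function.Bundles using (mk⇔; Equivalence; _↔_; mk↔ₛ′; Inverse)
open import Function.Definitions using (Injective; Bijective; Surjective)
open import Relation.Binary.Core using (Rel)
open import Relation.Binary.Definitions using (tri<; tri≈; tri>)
import Relation.Binary.Construct.Closure.Equivalence as Eq
open Eq using (EqClosure)
open import Relation.Binary.Construct.Closure.ReflexiveTransitive as Star using (Star; ε; _◅_; _◅◅_)
open import Relation.Binary.Construct.Closure.Symmetric using (SymClosure; fwd; bwd)
open import Relation.Binary.PropositionalEquality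
open import Relation.Nullary using (¬_; Dec; yes; no; does)
open import Relation.Nullary.Decidable using (map′; dec-true; ¬?; _×-dec_; _⊎-dec_; _→-dec_)
open import Relation.Unary using (Pred; Decidable; Irrelevant)

-- The obstacle is to keep track of paths and cycles under surgery. In a 2-dd a factor is the graph
-- of a permutation of the vertices, so its cycles are the classes of the equivalence relation
-- generated by its arcs. Numbers of cycles, and being a single Hamiltonian cycle, can therefore be
-- compared through two vertex maps between `G` and `G′` that preserve these classes and are inverse
-- to each other up to them; no path is ever cut or spliced. Quotients of vertices are avoided as
-- well: the starts and ends of `F′` are chosen among those of `F`, so `G′` lives on a subset of the
-- vertices of `G`, and that it arises by identification is verified afterwards. With `s` glued
-- vertices, `F` has `6 - s` entries and as many exits. For `s = 3` these are all the starts and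
-- ends of `F′`; for larger `s` the hexagon `F′` also keeps `s - 3` glued vertices, and is then not
-- clean.

open Digraph
module AC = AltCycle
open AltCycle using (_∋_)
open Equivalence using (to; from)

-- Evaluates markedly faster than the function of the same name in Data.Fin.Properties.
all? : ∀ {n} {P : Fin n → Set} → (∀ i → Dec (P i)) → Dec (∀ i → P i)
all? {zero}  P? = yes λ ()
all? {suc n} P? = map′ (λ { (p , ps) → ∀-cons p ps }) (λ ps → ps zero , ps ∘ suc) (P? zero ×-dec all? (P? ∘ suc))

holds : {P : Set} (d : Dec P) → does d ≡ true → P
holds (yes p) refl = p

-- Counting in finite sets

unique-lookup-injective : {A : Set} {xs : List A} → Unique xs → Injective _≡_ _≡_ (List.lookup xs)
unique-lookup-injective (_ ∷ _) {zero}  {zero}  _  = refl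
unique-lookup-injective {xs = _ ∷ xs} (x∉ ∷ _) {zero}  {suc j} eq =
  ⊥-elim (All.lookup x∉ (∈-lookup {xs = xs} j) eq)
unique-lookup-injective {xs = _ ∷ xs} (x∉ ∷ _) {suc i} {zero}  eq =
  ⊥-elim (All.lookup x∉ (∈-lookup {xs = xs} i) (sym eq))
unique-lookup-injective (_ ∷ u) {suc i} {suc j} eq = cong suc (unique-lookup-injective u eq)

module _ {n} {P : Pred (Fin n) 0ℓ} (P? : Decidable P) where

  enum : Fin #[ P? ] → Fin n
  enum = List.lookup (List.filter P? (allFin n))

  enum-satisfies : ∀ i → P (enum i)
  enum-satisfies i = proj₂ (∈-filter⁻ P? {xs = allFin n} (∈-lookup {xs = List.filter P? (allFin n)} i))

  enum-injective : Injective _≡_ _≡_ enum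
  enum-injective = unique-lookup-injective (filter⁺ P? (allFin⁺ n))

  rank : ∀ {v} → P v → Fin #[ P? ]
  rank {v} p = Any.index (∈-filter⁺ P? (∈-allFin v) p)

  enum-rank : ∀ {v} (p : P v) → enum (rank p) ≡ v
  enum-rank p = sym (lookup-index (∈-filter⁺ P? (∈-allFin _) p))

#-mono : ∀ {m n} {P : Pred (Fin m) 0ℓ} {Q : Pred (Fin n) 0ℓ}
         (P? : Decidable P) (Q? : Decidable Q) (f : ∀ {x} → P x → ∃ Q) →
         (∀ {x y} (p : P x) (q : P y) → proj₁ (f p) ≡ proj₁ (f q) → x ≡ y) →
         #[ P? ] ≤ #[ Q? ]
#-mono P? Q? f inj = injective⇒≤ {f = λ i → rank Q? (proj₂ (f (enum-satisfies P? i)))} λ {i} {j} eq →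
  enum-injective P? (inj (enum-satisfies P? i) (enum-satisfies P? j)
    (trans (sym (enum-rank Q? _)) (trans (cong (enum Q?) eq) (enum-rank Q? _))))

module _ {n} {P : Pred (Fin n) 0ℓ} (P? : Decidable P) where

  #≡0⁺ : (∀ v → ¬ P v) → #[ P? ] ≡ 0
  #≡0⁺ none = empty #[ P? ] λ i → none _ (enum-satisfies P? i)
    where
    empty : ∀ k → ¬ Fin k → k ≡ 0
    empty zero    _ = refl
    empty (suc k) e = ⊥-elim (e zero)

  #≡2⁻ : #[ P? ] ≡ 2 → ∃₂ λ a b → a ≢ b × P a × P b × (∀ c → P c → c ≡ a ⊎ c ≡ b)
  #≡2⁻ eq with two eq
    where
    two : ∀ {k} → k ≡ 2 → ∃₂ λ (i j : Fin k) → i ≢ j × (∀ l → l ≡ i ⊎ l ≡ j)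
    two refl = 0F , 1F , (λ ()) , λ { 0F → inj₁ refl ; 1F → inj₂ refl }
  ... | i , j , i≢j , only =
    enum P? i , enum P? j , i≢j ∘ enum-injective P? , enum-satisfies P? i , enum-satisfies P? j ,
    λ c p → [ (λ e → inj₁ (trans (sym (enum-rank P? p)) (cong (enum P?) e)))
            , (λ e → inj₂ (trans (sym (enum-rank P? p)) (cong (enum P?) e))) ]′ (only (rank P? p))

  #≡2⁺ : ∀ {a b} → a ≢ b → P a → P b → (∀ c → P c → c ≡ a ⊎ c ≡ b) → #[ P? ] ≡ 2
  #≡2⁺ {a} {b} a≢b pa pb only = ℕₚ.≤-antisym
    (injective⇒≤ {f = λ i → which (only _ (enum-satisfies P? i))} λ {i} {j} eq →
      enum-injective P? (which-injective (only _ (enum-satisfies P? i)) (only _ (enum-satisfies P? j)) eq))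
    (injective⇒≤ {f = back} λ {i} {j} → back-injective i j)
    where
    which : ∀ {c} → c ≡ a ⊎ c ≡ b → Fin 2
    which (inj₁ _) = 0F
    which (inj₂ _) = 1F
    which-injective : ∀ {c d} (p : c ≡ a ⊎ c ≡ b) (q : d ≡ a ⊎ d ≡ b) → which p ≡ which q → c ≡ d
    which-injective (inj₁ p) (inj₁ q) _ = trans p (sym q)
    which-injective (inj₂ p) (inj₂ q) _ = trans p (sym q)
    back : Fin 2 → Fin #[ P? ]
    back 0F = rank P? pa
    back 1F = rank P? pb
    a≢b′ : rank P? pa ≢ rank P? pb
    a≢b′ eq = a≢b (trans (sym (enum-rank P? pa)) (trans (cong (enum P?) eq) (enum-rank P? pb)))
    back-injective : ∀ i j → back i ≡ back j → i ≡ j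
    back-injective 0F 0F _  = refl
    back-injective 1F 1F _  = refl
    back-injective 0F 1F eq = ⊥-elim (a≢b′ eq)
    back-injective 1F 0F eq = ⊥-elim (a≢b′ (sym eq))

subset : ∀ {n} {P : Pred (Fin n) 0ℓ} → Decidable P → Subset n
subset P? = tabulate (does ∘ P?)

module _ {n} {P : Pred (Fin n) 0ℓ} (P? : Decidable P) where

  subset⁺ : ∀ {x} → P x → x ∈ subset P?
  subset⁺ {x} p = lookup⇒[]= x _ (trans (lookup∘tabulate (does ∘ P?) x) (dec-true (P? x) p))

  subset⁻ : ∀ {x} → x ∈ subset P? → P x
  subset⁻ {x} x∈ with P? x | trans (sym (lookup∘tabulate (does ∘ P?) x)) ([]=⇒lookup x∈)
  ... | yes p | _ = p
  ... | no _  | ()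

-- All numbers of cycles are moved by this lemma: from cycles of a factor to classes of vertices,
-- from `G` to `G′`, and back to cycles.
Exactly-map : ∀ {k} {X Y : Set} {_≈_ : Rel X 0ℓ} {_≋_ : Rel Y 0ℓ} (f : X → Y) →
              (∀ {x x′} → f x ≋ f x′ → x ≈ x′) →
              (∀ {x y} → x ≈ y → f x ≋ f y) →
              (∀ {x y z} → x ≋ y → y ≋ z → x ≋ z) →
              (∀ y → ∃ λ x → f x ≋ y) →
              Exactly k X _≈_ → Exactly k Y _≋_
Exactly-map f reflects preserves ≋-trans onto (g , g-inj , g-surj) =
  f ∘ g , g-inj ∘ reflects , λ y →
    let x , fx≋y = onto y
        i , gi≈x = g-surj x
    in i , λ z≡i → ≋-trans (preserves (gi≈x z≡i)) fx≋y

-- Cyclic successor and orbits of permutations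

iterate : {A : Set} → (A → A) → ℕ → A → A
iterate f zero    x = x
iterate f (suc k) x = f (iterate f k x)

iterate-+ : {A : Set} (f : A → A) (m : ℕ) {n : ℕ} {x : A} →
            iterate f (m + n) x ≡ iterate f m (iterate f n x)
iterate-+ f zero    = refl
iterate-+ f (suc m) = cong f (iterate-+ f m)

iterate-suc : {A : Set} (f : A → A) (m : ℕ) {x : A} → iterate f m (f x) ≡ f (iterate f m x)
iterate-suc f zero    = refl
iterate-suc f (suc m) = cong f (iterate-suc f m)

toℕ-next : ∀ {n} (i : Fin (suc n)) → toℕ (next i) ≡ suc (toℕ i) % suc n
toℕ-next i = toℕ-fromℕ< _

suc-% : ∀ m n → suc (m % suc n) % suc n ≡ suc m % suc n
suc-% m n = sym (trans
  (cong (λ l → suc l % suc n) (ℕₚ.m≡m%n+[m/n]*n m (suc n)))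
  (ℕₚ.[m+kn]%n≡m%n (suc (m % suc n)) (m / suc n) (suc n)))

toℕ-iterate-next : ∀ {n} k (i : Fin (suc n)) → toℕ (iterate next k i) ≡ (k + toℕ i) % suc n
toℕ-iterate-next         zero    i = sym (ℕₚ.m<n⇒m%n≡m (toℕ<n i))
toℕ-iterate-next {n} (suc k) i = trans (toℕ-next (iterate next k i))
  (trans (cong (λ m → suc m % suc n) (toℕ-iterate-next k i)) (suc-% (k + toℕ i) n))

iterate-next-id : ∀ {n} (i : Fin (suc n)) → iterate next (suc n) i ≡ i
iterate-next-id {n} i = toℕ-injective (trans (toℕ-iterate-next (suc n) i)
  (trans (cong (_% suc n) (ℕₚ.+-comm (suc n) (toℕ i)))
  (trans (ℕₚ.[m+n]%n≡m%n (toℕ i) (suc n)) (ℕₚ.m<n⇒m%n≡m (toℕ<n i)))))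

next-surjective : ∀ {n} (j : Fin n) → ∃ λ i → next i ≡ j
next-surjective {suc n} j = iterate next n j , iterate-next-id j

next-injective : ∀ {n} {i j : Fin n} → next i ≡ next j → i ≡ j
next-injective {suc n} {i} {j} eq = trans (sym (back i)) (trans (cong (iterate next n) eq) (back j))
  where
  back : ∀ k → iterate next n (next k) ≡ k
  back k = trans (iterate-suc next n) (iterate-next-id k)

next-induction : ∀ {n} (P : Fin n → Set) → (∀ i → P i → P (next i)) → ∀ {i} → P i → ∀ j → P j
-- It takes `j - i` steps modulo the length to get from `i` to `j`; adding the length before
-- subtracting `i` keeps the number natural.
next-induction {suc n} P step {i} p j = subst P at-j (run (toℕ j + (suc n ∸ toℕ i)))
  where
  run : ∀ k → P (iterate next k i)
  run zero    = p
  run (suc k) = step _ (run k)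
  at-j : iterate next (toℕ j + (suc n ∸ toℕ i)) i ≡ j
  at-j = toℕ-injective (begin
    toℕ (iterate next (toℕ j + (suc n ∸ toℕ i)) i) ≡⟨ toℕ-iterate-next (toℕ j + (suc n ∸ toℕ i)) i ⟩
    (toℕ j + (suc n ∸ toℕ i) + toℕ i) % suc n     ≡⟨ cong (_% suc n) (ℕₚ.+-assoc (toℕ j) _ _) ⟩
    (toℕ j + (suc n ∸ toℕ i + toℕ i)) % suc n     ≡⟨ cong (λ m → (toℕ j + m) % suc n) (ℕₚ.m∸n+n≡m (ℕₚ.<⇒≤ (toℕ<n i))) ⟩
    (toℕ j + suc n) % suc n                       ≡⟨ ℕₚ.[m+n]%n≡m%n (toℕ j) (suc n) ⟩
    toℕ j % suc n                                 ≡⟨ ℕₚ.m<n⇒m%n≡m (toℕ<n j) ⟩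
    toℕ j                                         ∎)
    where open ≡-Reasoning

least : {P : ℕ → Set} → (∀ k → Dec (P k)) → ∀ n → P n → ∃ λ m → P m × (∀ k → k < m → ¬ P k)
least {P} P? = <-rec (λ n → P n → ∃ λ m → P m × (∀ k → k < m → ¬ P k)) λ n rec p →
  search n p (λ k<n → rec k<n)
  where
  search : ∀ n → P n → (∀ {k} → k < n → P k → ∃ λ m → P m × (∀ k → k < m → ¬ P k)) →
           ∃ λ m → P m × (∀ k → k < m → ¬ P k)
  search n p rec with ℕₚ.anyUpTo? P? n
  ... | yes (k , k<n , pk) = rec k<n pk
  ... | no none            = n , p , λ k k<n pk → none (k , k<n , pk)

module Orbit {N} (f : Fin N → Fin N) (f-injective : ∀ {x y} → f x ≡ f y → x ≡ y) (v : Fin N) where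

  iterate-injective : ∀ k {x y} → iterate f k x ≡ iterate f k y → x ≡ y
  iterate-injective zero    eq = eq
  iterate-injective (suc k) eq = iterate-injective k (f-injective eq)

  cancel : ∀ {i j} → i < j → iterate f i v ≡ iterate f j v → iterate f (suc (j ∸ suc i)) v ≡ v
  cancel {i} {j} i<j eq = iterate-injective i (trans (sym (iterate-+ f i))
    (trans (cong (λ k → iterate f k v) (trans (ℕₚ.+-suc i (j ∸ suc i)) (ℕₚ.m+[n∸m]≡n i<j))) (sym eq)))

  abstract
    returns : ∃ λ p → iterate f (suc p) v ≡ v
    returns with pigeonhole (ℕₚ.n<1+n N) (λ i → iterate f (toℕ i) v)
    ... | i , j , i<j , eq = toℕ j ∸ suc (toℕ i) , cancel i<j eq

    minimal : ∃ λ p → iterate f (suc p) v ≡ v × (∀ k → k < p → iterate f (suc k) v ≢ v)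
    minimal = least (λ p → iterate f (suc p) v ≟ v) (proj₁ returns) (proj₂ returns)

  -- One less than the length of the orbit of v.
  period : ℕ
  period = proj₁ minimal

  returns-after : iterate f (suc period) v ≡ v
  returns-after = proj₁ (proj₂ minimal)

  point : Fin (suc period) → Fin N
  point i = iterate f (toℕ i) v

  private
    distinct : ∀ i j → toℕ i < toℕ j → point i ≢ point j
    distinct i j i<j eq = proj₂ (proj₂ minimal) _
      (ℕₚ.<-≤-trans (ℕₚ.∸-monoʳ-< {toℕ j} {suc (toℕ i)} {0} (s≤s z≤n) i<j) (ℕₚ.≤-pred (toℕ<n j)))
      (cancel i<j eq)

  point-injective : ∀ {i j} → point i ≡ point j → i ≡ j
  point-injective {i} {j} eq with ℕₚ.<-cmp (toℕ i) (toℕ j)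
  ... | tri< i<j _ _ = ⊥-elim (distinct i j i<j eq)
  ... | tri≈ _ i≡j _ = toℕ-injective i≡j
  ... | tri> _ _ j<i = ⊥-elim (distinct j i j<i (sym eq))

  iterate-% : ∀ m → iterate f (m % suc period) v ≡ iterate f m v
  iterate-% m = sym (trans (cong (λ k → iterate f k v) (ℕₚ.m≡m%n+[m/n]*n m (suc period)))
    (trans (iterate-+ f (m % suc period)) (cong (iterate f (m % suc period)) (laps (m / suc period)))))
    where
    laps : ∀ k → iterate f (k * suc period) v ≡ v
    laps zero    = refl
    laps (suc k) = trans (iterate-+ f (suc period)) (trans (cong (iterate f (suc period)) (laps k)) returns-after)

  point-next : ∀ i → point (next i) ≡ f (point i)
  point-next i = trans (cong (λ k → iterate f k v) (toℕ-next i)) (iterate-% (suc (toℕ i)))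

-- Arcs with a common end or start, and closed sets of arcs

module Mate {n m} (g : Fin n → Fin m) (two : ∀ v → #[ (λ a → g a ≟ v) ] ≡ 2) where

  abstract
    find : ∀ a → ∃ λ b → b ≢ a × g b ≡ g a × (∀ c → g c ≡ g a → c ≢ a → c ≡ b)
    find a with #≡2⁻ (λ b → g b ≟ g a) (two (g a))
    ... | x , y , x≢y , gx , gy , only with only a refl
    ...   | inj₁ refl = y , x≢y ∘ sym , gy , λ c gc c≢ → [ ⊥-elim ∘ c≢ , id ]′ (only c gc)
    ...   | inj₂ refl = x , x≢y , gx , λ c gc c≢ → [ id , ⊥-elim ∘ c≢ ]′ (only c gc)

  -- With `tgt` or `src` for `g`, this is the involution that swaps the two arcs at a vertex.
  -- Alternating cycles apply the two involutions in turn.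
  mate : Fin n → Fin n
  mate a = proj₁ (find a)

  mate-≢ : ∀ a → mate a ≢ a
  mate-≢ a = proj₁ (proj₂ (find a))

  mate-≡ : ∀ a → g (mate a) ≡ g a
  mate-≡ a = proj₁ (proj₂ (proj₂ (find a)))

  mate-unique : ∀ {a c} → g c ≡ g a → c ≢ a → c ≡ mate a
  mate-unique {a} {c} = proj₂ (proj₂ (proj₂ (find a))) c

  mate-involutive : ∀ a → mate (mate a) ≡ a
  mate-involutive a = sym (mate-unique (sym (mate-≡ a)) (mate-≢ a ∘ sym))

  mate-injective : ∀ {a b} → mate a ≡ mate b → a ≡ b
  mate-injective {a} {b} eq = trans (sym (mate-involutive a)) (trans (cong mate eq) (mate-involutive b))

  preimage : ∀ v → ∃ λ a → g a ≡ v
  preimage v with #≡2⁻ (λ b → g b ≟ v) (two v)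
  ... | x , _ , _ , gx , _ = x , gx

first : ∀ {n} → NonZero n → Fin n
first {suc n} _ = zero

-- In a 2-dd the closed sets are the unions of alternating cycles; this form spares all reference to
-- cyclic sequences.
Closed : (G : Digraph) → (A G → Set) → Set
Closed G Q = ∀ {a b} → tgt G a ≡ tgt G b ⊎ src G a ≡ src G b → Q a → Q b

closed-along : ∀ {G} {Q : A G → Set} → Closed G Q → (C : AltCycle G) →
               ∀ {a} → C ∋ a → Q a → ∀ {b} → C ∋ b → Q b
closed-along {G} {Q} closed C C∋a qa = along
  where
  start : ∀ {a} → C ∋ a → Q a → ∃ λ i → Q (AC.fwd C i)
  start (i , inj₁ refl) q = i , q
  start (i , inj₂ refl) q = i , closed (inj₁ (sym (AC.common-end C i))) q
  all-fwd : ∀ i → Q (AC.fwd C i)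
  all-fwd = next-induction _ (λ i q → closed (inj₂ (AC.common-start C i)) (closed (inj₁ (AC.common-end C i)) q))
                           (proj₂ (start C∋a qa))
  along : ∀ {b} → C ∋ b → Q b
  along (i , inj₁ refl) = all-fwd i
  along (i , inj₂ refl) = closed (inj₁ (AC.common-end C i)) (all-fwd i)

module _ {G : Digraph} where

  arcAt : (C : AltCycle G) → Fin (AC.r C + AC.r C) → A G
  arcAt C = [ AC.fwd C , AC.bwd C ]′ ∘ splitAt (AC.r C)

  arcAt-∋ : ∀ (C : AltCycle G) i → C ∋ arcAt C i
  arcAt-∋ C i with splitAt (AC.r C) i
  ... | inj₁ j = j , inj₁ refl
  ... | inj₂ j = j , inj₂ refl

  indexOf : ∀ (C : AltCycle G) {a} → C ∋ a → Fin (AC.r C + AC.r C)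
  indexOf C (i , inj₁ _) = i ↑ˡ AC.r C
  indexOf C (i , inj₂ _) = AC.r C ↑ʳ i

  arcAt-indexOf : ∀ (C : AltCycle G) {a} (p : C ∋ a) → arcAt C (indexOf C p) ≡ a
  arcAt-indexOf C (i , inj₁ refl) = cong [ AC.fwd C , AC.bwd C ]′ (splitAt-join (AC.r C) (AC.r C) (inj₁ i))
  arcAt-indexOf C (i , inj₂ refl) = cong [ AC.fwd C , AC.bwd C ]′ (splitAt-join (AC.r C) (AC.r C) (inj₂ i))

  arcAt-injective : ∀ C {i j} → arcAt C i ≡ arcAt C j → i ≡ j
  arcAt-injective C {i} {j} eq = trans (sym (join-splitAt (AC.r C) (AC.r C) i))
    (trans (cong (join (AC.r C) (AC.r C)) (lemma (splitAt (AC.r C) i) (splitAt (AC.r C) j) eq))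
           (join-splitAt (AC.r C) (AC.r C) j))
    where
    lemma : ∀ p q → [ AC.fwd C , AC.bwd C ]′ p ≡ [ AC.fwd C , AC.bwd C ]′ q → p ≡ q
    lemma (inj₁ i) (inj₁ j) e = cong inj₁ (AC.fwd-inj C e)
    lemma (inj₁ i) (inj₂ j) e = ⊥-elim (AC.fwd≢bwd C i j e)
    lemma (inj₂ i) (inj₁ j) e = ⊥-elim (AC.fwd≢bwd C j i (sym e))
    lemma (inj₂ i) (inj₂ j) e = cong inj₂ (AC.bwd-inj C e)

  #arcs-mono : (C D : AltCycle G) → (∀ {a} → C ∋ a → D ∋ a) → AC.#arcs C ≤ AC.#arcs D
  #arcs-mono C D C⊆D = subst₂ _≤_ (double (AC.r C)) (double (AC.r D))
    (injective⇒≤ {f = λ i → indexOf D (C⊆D (arcAt-∋ C i))} λ {i} {j} eq →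
      arcAt-injective C (trans (sym (arcAt-indexOf D (C⊆D (arcAt-∋ C i)))) (trans (cong (arcAt D) eq) (arcAt-indexOf D (C⊆D (arcAt-∋ C j))))))
    where
    double : ∀ n → n + n ≡ 2 * n
    double n = cong (n +_) (sym (ℕₚ.+-identityʳ n))

-- The local form of `IsFactor`, equivalent to it in a 2-dd: exactly one of the two arcs at each
-- start and at each end is chosen. Unlike a condition on all alternating cycles, it is plainly
-- decidable.
Alternating : (G : Digraph) → Subset (#A G) → Set
Alternating G S = ∀ {a b} → a ≢ b → tgt G a ≡ tgt G b ⊎ src G a ≡ src G b →
                  (a ∈ S → b ∉ S) × (a ∉ S → b ∈ S)

alternating? : ∀ G S → Dec (Alternating G S)
alternating? G S = map′ (λ f {a} {b} → f a b) (λ f a b → f)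
  (all? λ a → all? λ b → ¬? (a ≟ b) →-dec
    ((tgt G a ≟ tgt G b) ⊎-dec (src G a ≟ src G b)) →-dec
    ((a ∈? S →-dec ¬? (b ∈? S)) ×-dec (¬? (a ∈? S) →-dec b ∈? S)))

alternating⇒factor : ∀ {G S} → Alternating G S → IsFactor G S
alternating⇒factor {G} {S} alt C with AC.fwd C (first (AC.r≢0 C)) ∈? S
... | yes f₀∈ = inj₁ (all-in , λ i → proj₁ (alt (AC.fwd≢bwd C i i) (inj₁ (AC.common-end C i))) (all-in i))
  where
  all-in : ∀ i → AC.fwd C i ∈ S
  all-in = next-induction (λ i → AC.fwd C i ∈ S) (λ i f∈ →
    proj₂ (alt (AC.fwd≢bwd C (next i) i ∘ sym) (inj₂ (AC.common-start C i)))
      (proj₁ (alt (AC.fwd≢bwd C i i) (inj₁ (AC.common-end C i))) f∈)) f₀∈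
... | no  f₀∉ = inj₂ (all-out , λ i → proj₂ (alt (AC.fwd≢bwd C i i) (inj₁ (AC.common-end C i))) (all-out i))
  where
  all-out : ∀ i → AC.fwd C i ∉ S
  all-out = next-induction (λ i → AC.fwd C i ∉ S) (λ i f∉ →
    proj₁ (alt (AC.fwd≢bwd C (next i) i ∘ sym) (inj₂ (AC.common-start C i)))
      (proj₂ (alt (AC.fwd≢bwd C i i) (inj₁ (AC.common-end C i))) f∉)) f₀∉

-- Alternating cycles, factors and Hamiltonicity in a 2-dd

module TwoDD (G : Digraph) (dd : Is2dd G) where

  module Tgt = Mate (tgt G) (proj₁ ∘ dd)
  module Src = Mate (src G) (proj₂ ∘ dd)

  private
    -- Two steps along an alternating cycle: from a forward arc, over the backward arc with the same
    -- end, to the next forward arc.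
    φ : A G → A G
    φ = Src.mate ∘ Tgt.mate

    φ-injective : ∀ {a b} → φ a ≡ φ b → a ≡ b
    φ-injective = Tgt.mate-injective ∘ Src.mate-injective

    -- This keeps forward and backward arcs apart. In the dihedral group generated by the two mates,
    -- an equality here would give a fixed point of a reflection, and every reflection is conjugate
    -- to one of the mates, which have none. The recursion conjugates until `k` is 0 or 1.
    iterate-φ≢mate : ∀ k {a} → iterate φ k a ≢ Tgt.mate a
    iterate-φ≢mate zero          eq = Tgt.mate-≢ _ (sym eq)
    iterate-φ≢mate (suc zero)    eq = Src.mate-≢ _ eq
    iterate-φ≢mate (suc (suc k)) {a} eq = iterate-φ≢mate k {φ a} (begin
      iterate φ k (φ a)                     ≡⟨ iterate-suc φ k ⟩
      iterate φ (suc k) a                   ≡⟨ Tgt.mate-involutive _ ⟨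
      Tgt.mate (Tgt.mate (iterate φ (suc k) a)) ≡⟨ cong Tgt.mate (Src.mate-involutive _) ⟨
      Tgt.mate (Src.mate (φ (iterate φ (suc k) a))) ≡⟨ cong (Tgt.mate ∘ Src.mate) eq ⟩
      Tgt.mate (φ a)                        ∎)
      where open ≡-Reasoning

    iterate-φ≢mate-iterate : ∀ i j {a} → iterate φ i a ≢ Tgt.mate (iterate φ j a)
    iterate-φ≢mate-iterate i j {a} eq with ℕₚ.≤-total i j
    ... | inj₂ j≤i = iterate-φ≢mate (i ℕ.∸ j) (trans (split-off j≤i) eq)
      where
      split-off : ∀ {i j} → j ≤ i → iterate φ (i ℕ.∸ j) (iterate φ j a) ≡ iterate φ i a
      split-off {i} {j} j≤i = trans (sym (iterate-+ φ (i ℕ.∸ j))) (cong (λ k → iterate φ k a) (ℕₚ.m∸n+n≡m j≤i))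
    ... | inj₁ i≤j = iterate-φ≢mate (j ℕ.∸ i) (trans (split-off i≤j) (trans (sym (Tgt.mate-involutive _)) (cong Tgt.mate (sym eq))))
      where
      split-off : ∀ {i j} → j ≤ i → iterate φ (i ℕ.∸ j) (iterate φ j a) ≡ iterate φ i a
      split-off {i} {j} j≤i = trans (sym (iterate-+ φ (i ℕ.∸ j))) (cong (λ k → iterate φ k a) (ℕₚ.m∸n+n≡m j≤i))

  altCycleThrough : ∀ a → ∃ λ (C : AltCycle G) → C ∋ a
  altCycleThrough a = record
    { r = suc period
    ; r≢0 = _
    ; fwd = point
    ; bwd = Tgt.mate ∘ point
    ; fwd-inj = point-injective
    ; bwd-inj = point-injective ∘ Tgt.mate-injective
    ; fwd≢bwd = λ i j → iterate-φ≢mate-iterate (toℕ i) (toℕ j)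
    ; common-end = λ i → sym (Tgt.mate-≡ (point i))
    ; common-start = λ i → trans (sym (Src.mate-≡ _)) (cong (src G) (sym (point-next i)))
    } , zero , inj₁ refl
    where open Orbit φ φ-injective a

  module _ (C : AltCycle G) {b : A G} where

    fwd-tgt : ∀ i → AC.fwd C i ≢ b → tgt G (AC.fwd C i) ≡ tgt G b → AC.bwd C i ≡ b
    fwd-tgt i ≢b same = trans (Tgt.mate-unique (sym (AC.common-end C i)) (AC.fwd≢bwd C i i ∘ sym))
                              (sym (Tgt.mate-unique (sym same) (≢b ∘ sym)))

    bwd-tgt : ∀ i → AC.bwd C i ≢ b → tgt G (AC.bwd C i) ≡ tgt G b → AC.fwd C i ≡ b
    bwd-tgt i ≢b same = trans (Tgt.mate-unique (AC.common-end C i) (AC.fwd≢bwd C i i))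
                              (sym (Tgt.mate-unique (sym same) (≢b ∘ sym)))

    bwd-src : ∀ i → AC.bwd C i ≢ b → src G (AC.bwd C i) ≡ src G b → AC.fwd C (next i) ≡ b
    bwd-src i ≢b same = trans (Src.mate-unique (sym (AC.common-start C i)) (AC.fwd≢bwd C (next i) i))
                              (sym (Src.mate-unique (sym same) (≢b ∘ sym)))

    fwd-src : ∀ i → AC.fwd C (next i) ≢ b → src G (AC.fwd C (next i)) ≡ src G b → AC.bwd C i ≡ b
    fwd-src i ≢b same = trans (Src.mate-unique (AC.common-start C i) (AC.fwd≢bwd C (next i) i ∘ sym))
                              (sym (Src.mate-unique (sym same) (≢b ∘ sym)))

  altCycle-closed : ∀ (C : AltCycle G) → Closed G (C ∋_)
  altCycle-closed C {a} {b} same C∋a with a ≟ b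
  ... | yes refl = C∋a
  ... | no a≢b with same | C∋a
  ...   | inj₁ t | i , inj₁ refl = i , inj₂ (fwd-tgt C i a≢b t)
  ...   | inj₁ t | i , inj₂ refl = i , inj₁ (bwd-tgt C i a≢b t)
  ...   | inj₂ s | i , inj₂ refl = next i , inj₁ (bwd-src C i a≢b s)
  ...   | inj₂ s | i , inj₁ refl with next-surjective i
  ...     | j , refl = j , inj₂ (fwd-src C j a≢b s)

  -- The uniqueness of the partition of the arcs into alternating cycles: the arcs of `D` form a
  -- closed set, and `C` cannot leave a closed set that it meets.
  altCycle-meet : ∀ (C D : AltCycle G) {a} → C ∋ a → D ∋ a → ∀ {b} → C ∋ b → D ∋ b
  altCycle-meet C D C∋a D∋a = closed-along {G} (altCycle-closed D) C C∋a D∋a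

  -- An arbitrary alternating cycle has the same arcs as the given hexagon through one of them,
  -- hence the same length.
  allHexagons : (∀ a → ∃ λ (C : AltCycle G) → C ∋ a × AC.#arcs C ≡ 6) → AllAltCyclesHave6Arcs G
  allHexagons hex C with hex (AC.fwd C (first (AC.r≢0 C)))
  ... | D , D∋ , six = trans (ℕₚ.≤-antisym
          (#arcs-mono C D (altCycle-meet C D (_ , inj₁ refl) D∋))
          (#arcs-mono D C (altCycle-meet D C D∋ (_ , inj₁ refl)))) six

  factor⇒alternating : ∀ {S} → IsFactor G S → Alternating G S
  factor⇒alternating {S} factor {a} {b} a≢b same with altCycleThrough a
  ... | C , C∋a = opposite C∋a a≢b same
    where
    Flips : A G → A G → Set
    Flips a b = (a ∈ S → b ∉ S) × (a ∉ S → b ∈ S)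
    flips : ∀ i j → Flips (AC.fwd C i) (AC.bwd C j) × Flips (AC.bwd C j) (AC.fwd C i)
    flips i j with factor C
    ... | inj₁ (f∈ , b∉) = ((λ _ → b∉ j) , λ f∉ → ⊥-elim (f∉ (f∈ i))) , ((λ b∈ → ⊥-elim (b∉ j b∈)) , λ _ → f∈ i)
    ... | inj₂ (f∉ , b∈) = ((λ f∈ → ⊥-elim (f∉ i f∈)) , λ _ → b∈ j) , ((λ _ → f∉ i) , λ b∉ → ⊥-elim (b∉ (b∈ j)))
    opposite : ∀ {a b} → C ∋ a → a ≢ b → tgt G a ≡ tgt G b ⊎ src G a ≡ src G b → Flips a b
    opposite (i , inj₁ refl) a≢b (inj₁ t) = subst (Flips _) (fwd-tgt C i a≢b t) (proj₁ (flips i i))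
    opposite (i , inj₂ refl) a≢b (inj₁ t) = subst (Flips _) (bwd-tgt C i a≢b t) (proj₂ (flips i i))
    opposite (i , inj₂ refl) a≢b (inj₂ s) = subst (Flips _) (bwd-src C i a≢b s) (proj₂ (flips (next i) i))
    opposite (i , inj₁ refl) a≢b (inj₂ s) with next-surjective i
    ... | j , refl = subst (Flips _) (fwd-src C j a≢b s) (proj₁ (flips (next j) j))

  module Factor {S : Subset (#A G)} (alt : Alternating G S) where

    src-unique : ∀ {a b} → a ∈ S → b ∈ S → src G a ≡ src G b → a ≡ b
    src-unique {a} {b} a∈ b∈ eq with a ≟ b
    ... | yes a≡b = a≡b
    ... | no  a≢b = ⊥-elim (proj₁ (alt a≢b (inj₂ eq)) a∈ b∈)

    tgt-unique : ∀ {a b} → a ∈ S → b ∈ S → tgt G a ≡ tgt G b → a ≡ b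
    tgt-unique {a} {b} a∈ b∈ eq with a ≟ b
    ... | yes a≡b = a≡b
    ... | no  a≢b = ⊥-elim (proj₁ (alt a≢b (inj₁ eq)) a∈ b∈)

    abstract
      leaving : ∀ v → ∃ λ a → a ∈ S × src G a ≡ v
      leaving v with Src.preimage v
      ... | a , refl with a ∈? S
      ...   | yes a∈ = a , a∈ , refl
      ...   | no  a∉ = Src.mate a , proj₂ (alt (Src.mate-≢ a ∘ sym) (inj₂ (sym (Src.mate-≡ a)))) a∉ , Src.mate-≡ a

    out : V G → A G
    out v = proj₁ (leaving v)

    out∈ : ∀ v → out v ∈ S
    out∈ v = proj₁ (proj₂ (leaving v))

    src-out : ∀ v → src G (out v) ≡ v
    src-out v = proj₂ (proj₂ (leaving v))

    out-src : ∀ {a} → a ∈ S → out (src G a) ≡ a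
    out-src a∈ = src-unique (out∈ _) a∈ (src-out _)

    succ : V G → V G
    succ = tgt G ∘ out

    succ-injective : ∀ {u v} → succ u ≡ succ v → u ≡ v
    succ-injective {u} {v} eq = trans (sym (src-out u)) (trans (cong (src G) (tgt-unique (out∈ u) (out∈ v) eq)) (src-out v))

    step : ∀ v → Step G S v (succ v)
    step v = out v , out∈ v , src-out v , refl

    step⇒succ : ∀ {u v} → Step G S u v → succ u ≡ v
    step⇒succ (a , a∈ , refl , refl) = cong (tgt G) (out-src a∈)

    infix 4 _~_
    -- Since `succ` is a permutation, the classes are the vertex sets of the cycles of the factor.
    _~_ : Rel (V G) 0ℓ
    _~_ = EqClosure (Step G S)

    On : CycleIn G S → V G → Set
    On (C , _) v = ∃ λ i → src G (Cycle.arc C i) ≡ v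

    succ-src : ∀ (C : CycleIn G S) i → succ (src G (Cycle.arc (proj₁ C) i)) ≡ src G (Cycle.arc (proj₁ C) (next i))
    succ-src (C , C∈) i = trans (cong (tgt G) (out-src (C∈ i))) (Cycle.joined C i)

    on-succ : ∀ C {v} → On C v → On C (succ v)
    on-succ C (i , refl) = next i , sym (succ-src C i)

    on-pred : ∀ C {v} → On C (succ v) → On C v
    on-pred C (i , eq) with next-surjective i
    ... | j , refl = j , succ-injective (trans (succ-src C j) eq)

    on-~ : ∀ C {u v} → u ~ v → On C u → On C v
    on-~ C ε                 on = on
    on-~ C (fwd s ◅ path) on = on-~ C path (subst (On C) (step⇒succ s) (on-succ C on))
    on-~ C (bwd s ◅ path) on = on-~ C path (on-pred C (subst (On C) (sym (step⇒succ s)) on))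

    base : CycleIn G S → V G
    base (C , _) = src G (Cycle.arc C (first (Cycle.len≢0 C)))

    base-~ : ∀ C {v} → On C v → base C ~ v
    base-~ C (i , refl) = next-induction (λ i → base C ~ src G (Cycle.arc (proj₁ C) i))
      (λ i p → p ◅◅ Eq.return (subst (Step G S _) (succ-src C i) (step _))) ε i

    sameCycle⁺ : ∀ C D → base C ~ base D → SameCycle (proj₁ C) (proj₁ D)
    sameCycle⁺ C D p a = mk⇔ (include C D (Eq.symmetric _ p)) (include D C p)
      where
      include : ∀ C D → base D ~ base C → (∃ λ i → Cycle.arc (proj₁ C) i ≡ a) → ∃ λ i → Cycle.arc (proj₁ D) i ≡ a
      include C D q (i , refl) with on-~ D (q ◅◅ base-~ C (i , refl)) (_ , refl)
      ... | j , eq = j , src-unique (proj₂ D j) (proj₂ C i) eq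

    sameCycle⁻ : ∀ C D → SameCycle (proj₁ C) (proj₁ D) → base C ~ base D
    sameCycle⁻ C D same with to (same _) (first (Cycle.len≢0 (proj₁ C)) , refl)
    ... | i , eq = Eq.symmetric _ (base-~ D (i , cong (src G) eq))

    private module O = Orbit succ succ-injective

    cycleThrough : V G → CycleIn G S
    cycleThrough v = record
      { len = suc (O.period v)
      ; len≢0 = _
      ; arc = out ∘ O.point v
      ; joined = λ i → sym (trans (src-out _) (O.point-next v i))
      ; distinct = λ {i} {j} eq → O.point-injective v (trans (sym (src-out _)) (trans eq (src-out _)))
      } , λ i → out∈ (O.point v i)

    base-cycleThrough : ∀ v → base (cycleThrough v) ≡ v
    base-cycleThrough v = src-out v

    on-cycleThrough : ∀ {u v} → u ~ v → On (cycleThrough u) v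
    on-cycleThrough {u} p = on-~ (cycleThrough u) p (zero , src-out u)

    _~?_ : ∀ u v → Dec (u ~ v)
    u ~? v = map′ (λ on → subst (_~ v) (base-cycleThrough u) (base-~ (cycleThrough u) on)) on-cycleThrough
                  (any? λ i → src G (Cycle.arc (proj₁ (cycleThrough u)) i) ≟ v)

    -- On a cycle a backward step can be replaced by going round forwards.
    ~⇒Star : ∀ {u v} → u ~ v → Star (Step G S) u v
    ~⇒Star {u} p with on-cycleThrough p
    ... | i , refl = subst (Star _ u) (sym (src-out _)) (walk (toℕ i))
      where
      walk : ∀ k → Star (Step G S) u (iterate succ k u)
      walk zero    = ε
      walk (suc k) = walk k ◅◅ step _ ◅ ε

    #Cycles⇒Exactly : ∀ {k} → #Cycles≡ G S k → Exactly k (V G) _~_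
    #Cycles⇒Exactly = Exactly-map {_≋_ = _~_} base (λ {C} {D} → sameCycle⁺ C D) (λ {C} {D} → sameCycle⁻ C D) _◅◅_
      λ v → cycleThrough v , subst (base (cycleThrough v) ~_) (base-cycleThrough v) ε

    Exactly⇒#Cycles : ∀ {k} → Exactly k (V G) _~_ → #Cycles≡ G S k
    Exactly⇒#Cycles = Exactly-map {_≋_ = λ C D → SameCycle (proj₁ C) (proj₁ D)} cycleThrough
      (λ {u} {v} same → subst₂ _~_ (base-cycleThrough u) (base-cycleThrough v) (sameCycle⁻ (cycleThrough u) (cycleThrough v) same))
      (λ {u} {v} p → sameCycle⁺ (cycleThrough u) (cycleThrough v) (subst₂ _~_ (sym (base-cycleThrough u)) (sym (base-cycleThrough v)) p))
      (λ p q a → mk⇔ (to (q a) ∘ to (p a)) (from (p a) ∘ from (q a)))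
      λ C → base C , sameCycle⁺ (cycleThrough (base C)) C (subst (_~ base C) (sym (base-cycleThrough (base C))) ε)

  -- A Hamiltonian cycle seen as a factor with a single class. Only finitely many arc sets are to be
  -- tested, so Hamiltonicity becomes decidable, and `HEquivalent` can be proved by cases.
  IsHamiltonianFactor : Subset (#A G) → Set
  IsHamiltonianFactor S = Alternating G S × (∀ u v → EqClosure (Step G S) u v)

  hamiltonian⇒factor : Hamiltonian G → ∃ IsHamiltonianFactor
  hamiltonian⇒factor (C , all) = S , alternating , connected
    where
    open Cycle C
    ∈C? : ∀ a → Dec (∃ λ i → arc i ≡ a)
    ∈C? a = any? λ i → arc i ≟ a
    S : Subset (#A G)
    S = subset ∈C?
    alternating : Alternating G S
    alternating {a} {b} a≢b (inj₂ same) = both-in , other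
      where
      both-in : a ∈ S → b ∉ S
      both-in a∈ b∈ with subset⁻ ∈C? a∈ | subset⁻ ∈C? b∈
      ... | i , refl | j , refl = a≢b (cong arc (distinct same))
      other : a ∉ S → b ∈ S
      other a∉ with all (src G a)
      ... | i , eq = subset⁺ ∈C? (i , trans
              (Src.mate-unique eq (λ arc≡a → a∉ (subset⁺ ∈C? (i , arc≡a))))
              (sym (Src.mate-unique (sym same) (a≢b ∘ sym))))
    alternating {a} {b} a≢b (inj₁ same) = both-in , other
      where
      both-in : a ∈ S → b ∉ S
      both-in a∈ b∈ with subset⁻ ∈C? a∈ | subset⁻ ∈C? b∈
      ... | i , refl | j , refl =
        a≢b (cong arc (next-injective (distinct (trans (sym (joined i)) (trans same (joined j))))))
      other : a ∉ S → b ∈ S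
      other a∉ with all (tgt G a)
      ... | i , eq with next-surjective i
      ...   | j , refl = subset⁺ ∈C? (j , trans
              (Tgt.mate-unique (trans (joined j) eq) (λ arc≡a → a∉ (subset⁺ ∈C? (j , arc≡a))))
              (sym (Tgt.mate-unique (sym same) (a≢b ∘ sym))))
    open Factor alternating
    connected : ∀ u v → EqClosure (Step G S) u v
    connected u v = Eq.symmetric _ (base-~ C′ (all u)) ◅◅ base-~ C′ (all v)
      where
      C′ : CycleIn G S
      C′ = C , λ i → subset⁺ ∈C? (i , refl)

  factor⇒hamiltonian : V G → ∃ IsHamiltonianFactor → Hamiltonian G
  factor⇒hamiltonian v (S , alt , connected) =
    proj₁ (cycleThrough v) , λ u → on-cycleThrough (connected v u)
    where open Factor alt

  hamiltonian? : V G → Dec (Hamiltonian G)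
  hamiltonian? v = map′ (factor⇒hamiltonian v) hamiltonian⇒factor (anySubset? hamiltonianFactor?)
    where
    hamiltonianFactor? : ∀ S → Dec (IsHamiltonianFactor S)
    hamiltonianFactor? S with alternating? G S
    ... | no ¬alt = no (¬alt ∘ proj₁)
    ... | yes alt = map′ (alt ,_) proj₂ (all? λ u → all? λ v → Factor._~?_ alt u v)

-- Finite partial permutations and their roots

Partial : ℕ → ℕ → Set
Partial m n = Vec (Maybe (Fin n)) m

_≟ₘ_ : ∀ {n} (a b : Maybe (Fin n)) → Dec (a ≡ b)
_≟ₘ_ = ≡-dec _≟_

-- The natural number is fuel. On `m` points, `m` steps of an injective map either stop at a sink or
-- go all the way round a cycle, and then `least` is a canonical name of that cycle.
walk : ∀ {m} → Partial m m → ℕ → Fin m → Fin m → Fin m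
walk f zero    u least = least
walk f (suc k) u least with lookup f u
... | nothing = u
... | just v  = walk f k v (if toℕ v ℕ.≤ᵇ toℕ least then v else least)

-- For injective f, the last point of the path through u, or the least point of the cycle through u.
root : ∀ {m} → Partial m m → Fin m → Fin m
root {m} f u = walk f m u u

roots : ∀ {m} → Partial m m → Vec (Fin m) m
roots f = tabulate (root f)

Leads : ∀ {m} → Partial m m → Rel (Fin m) 0ℓ
Leads f u v = lookup f u ≡ just v

-- This half needs no injectivity. That points joined by an arrow have equal roots is not proved in
-- general, but checked by evaluation for each map in question.
root-reached : ∀ {m} (f : Partial m m) u → Star (Leads f) u (root f u)
root-reached {m} f u = along m ε ε
  where
  along : ∀ k {v least} → Star (Leads f) u v → Star (Leads f) u least → Star (Leads f) u (walk f k v least)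
  along zero    v least = least
  along (suc k) {v} {l} p q with lookup f v in eq
  ... | nothing = p
  ... | just w with toℕ w ℕ.≤ᵇ toℕ l
  ...   | true  = along k (p ◅◅ eq ◅ ε) (p ◅◅ eq ◅ ε)
  ...   | false = along k (p ◅◅ eq ◅ ε) q

root-sink : ∀ {m} (f : Partial m m) u → lookup f u ≡ nothing → root f u ≡ u
root-sink {suc m} f u eq with lookup f u
root-sink {suc m} f u refl | nothing = refl

-- The finite problem: two glued hexagons and the candidates for `F′`

-- The arcs of F = induced G K form two hexagons. Their starts, and likewise their ends, are
-- numbered 0, 1, 2 in the first and 3, 4, 5 in the second hexagon: the forward arc z runs from
-- start z to end z, and the backward arc z from start rot z to end z.
rot : Fin 6 → Fin 6
rot 0F = 1F
rot 1F = 2F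
rot 2F = 0F
rot 3F = 4F
rot 4F = 5F
rot 5F = 3F

rot³ : ∀ z → rot (rot (rot z)) ≡ z
rot³ 0F = refl
rot³ 1F = refl
rot³ 2F = refl
rot³ 3F = refl
rot³ 4F = refl
rot³ 5F = refl

sideOf : Fin 3 ⊎ Fin 3 → Fin 2
sideOf (inj₁ _) = 0F
sideOf (inj₂ _) = 1F

side : Fin 6 → Fin 2
side u = sideOf (splitAt 3 u)

-- For a rotation r of order three, the ends reached by the forward arcs (0), by the backward
-- arcs (1), and by the missing third perfect matching of starts with ends (2).
turn : {A : Set} → (A → A) → Fin 3 → A → A
turn r 0F a = a
turn r 1F a = r (r a)
turn r 2F a = r a

-- A factor of F picks the forward (0) or the backward (1) arcs of either hexagon.
Choice : Set
Choice = Fin 2 × Fin 2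

arm : Choice → Fin 6 → Fin 2
arm (i , j) u = [ const i , const j ]′ (splitAt 3 u)

head : Choice → Fin 6 → Fin 6
head c u = turn rot (arm c u ↑ˡ 1) u

-- Restricts the search for representatives in `F` of the starts of `F′`. A start that is an entry
-- has to represent itself; for any other start it is enough to try roots, because `Matches` sees
-- only the root of a representative.
Fits : Vec (Fin 6) 6 → Maybe (Fin 6) → Fin 6 → Set
Fits R (just v) u = u ≡ v
Fits R nothing  u = lookup R u ≡ u

fits? : ∀ R p u → Dec (Fits R p u)
fits? R (just v) u = u ≟ v
fits? R nothing  u = lookup R u ≟ u

-- lookup h z ≡ just u means that the end z of one hexagon is the start u of the other.
module Gluing (h : Partial 6 6) where

  flow : Choice → Partial 6 6
  flow c = tabulate λ u → lookup h (head c u)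

  IsSource : Fin 6 → Set
  IsSource u = ∀ z → lookup h z ≢ just u

  isSource? : ∀ u → Dec (IsSource u)
  isSource? u = all? λ z → ¬? (lookup h z ≟ₘ just u)

  glued? : ∀ z → Dec (lookup h z ≢ nothing)
  glued? z = ¬? (lookup h z ≟ₘ nothing)

  -- The bound 3 is the hypothesis `s > 2`: glued ends are the saturated vertices of `F`.
  Admissible : Set
  Admissible =
      (∀ z z′ → lookup h z ≡ lookup h z′ → lookup h z ≢ nothing → z ≡ z′)
    × 3 ℕ.≤ #[ glued? ]

  admissible? : Dec Admissible
  admissible? =
    (all? λ z → all? λ z′ →
      (lookup h z ≟ₘ lookup h z′) →-dec (glued? z →-dec (z ≟ z′)))
    ×-dec (3 ℕₚ.≤? #[ glued? ])

  -- A candidate for F′: the hexagon with forward arcs x i → y i and backward arcs x (i + 1) → y i,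
  -- on the starts x and ends y kept from F.
  module Candidate (x y : Vec (Fin 6) 3) where

    -- Entries and exits of `F` have to survive, and a glued vertex has to be kept in both its
    -- roles, as an end and as a start, or in neither. This is what makes all degrees in `G′` equal
    -- to 2.
    Embeds : Set
    Embeds =
        (∀ i j → lookup x i ≡ lookup x j → i ≡ j)
      × (∀ i j → lookup y i ≡ lookup y j → i ≡ j)
      × (∀ u → IsSource u → ∃ λ i → lookup x i ≡ u)
      × (∀ z → lookup h z ≡ nothing → ∃ λ i → lookup y i ≡ z)
      × (∀ z i → lookup h z ≡ just (lookup x i) → ∃ λ j → lookup y j ≡ z)
      × (∀ i u → lookup h (lookup y i) ≡ just u → ∃ λ j → lookup x j ≡ u)

    embeds? : Dec Embeds
    embeds? =
      (all? λ i → all? λ j → (lookup x i ≟ lookup x j) →-dec (i ≟ j))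
      ×-dec (all? λ i → all? λ j → (lookup y i ≟ lookup y j) →-dec (i ≟ j))
      ×-dec (all? λ u → isSource? u →-dec any? λ i → lookup x i ≟ u)
      ×-dec (all? λ z → (lookup h z ≟ₘ nothing) →-dec any? λ i → lookup y i ≟ z)
      ×-dec (all? λ z → all? λ i → (lookup h z ≟ₘ just (lookup x i)) →-dec any? λ j → lookup y j ≟ z)
      ×-dec (all? λ i → all? λ u → (lookup h (lookup y i) ≟ₘ just u) →-dec any? λ j → lookup x j ≟ u)

    place : Fin 6 → Maybe (Fin 3)
    place u with any? (λ i → lookup x i ≟ u)
    ... | yes (i , _) = just i
    ... | no _        = nothing

    exits : Vec (Vec (Fin 6) 3) 3
    exits = tabulate λ k → tabulate λ i → lookup y (turn next k i)

    flow′ : Vec (Fin 6) 3 → Partial 3 3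
    flow′ E = Vec.map (λ z → lookup h z >>= place) E

    pins : Vec (Maybe (Fin 6)) 3
    pins = Vec.map (λ u → if does (isSource? u) then just u else nothing) x

    -- The paths and cycles of the factor c of F, with roots R, correspond to those of a matching
    -- of x with E, with roots R′, in such a way that entries and exits are preserved; the point t i
    -- of F lies on the path or cycle that corresponds to the one of x i.
    module _ (c : Choice) (R : Vec (Fin 6) 6)
             (E : Vec (Fin 6) 3) (f : Partial 3 3) (R′ : Vec (Fin 3) 3) where

      -- `T i` names the path or cycle of `F` assigned to the start `x i`. If the matching continues
      -- to another start of `F′`, the name must not change; if it stops, the path of `F` must stop
      -- at the same end, the head of its last point.
      Follows : Vec (Fin 6) 3 → Fin 3 → Maybe (Fin 3) → Set
      Follows T i (just j) = lookup T i ≡ lookup T j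
      Follows T i nothing  = head c (lookup T i) ≡ lookup E i

      follows? : ∀ T i m → Dec (Follows T i m)
      follows? T i (just j) = lookup T i ≟ lookup T j
      follows? T i nothing  = head c (lookup T i) ≟ lookup E i

      -- By the second clause no path or cycle of `F` is lost; by the third, distinct ones of the
      -- matching are not assigned to the same one of `F`.
      Matches : Vec (Fin 6) 3 → Set
      Matches T =
          (∀ i → Follows T i (lookup f i))
        × (∀ u → ∃ λ i → lookup T i ≡ lookup R u)
        × (∀ i j → lookup T i ≡ lookup T j → lookup R′ i ≡ lookup R′ j)

      matches? : ∀ T → Dec (Matches T)
      matches? T =
        (all? λ i → follows? T i (lookup f i))
        ×-dec (all? λ u → any? λ i → lookup T i ≟ lookup R u)
        ×-dec (all? λ i → all? λ j → (lookup T i ≟ lookup T j) →-dec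
                                     (lookup R′ i ≟ lookup R′ j))

      Equivalent : Vec (Maybe (Fin 6)) 3 → Set
      Equivalent (p₀ ∷ p₁ ∷ p₂ ∷ []) =
        ∃ λ t₀ → Fits R p₀ t₀ × ∃ λ t₁ → Fits R p₁ t₁ × ∃ λ t₂ → Fits R p₂ t₂ ×
        Matches (lookup R t₀ ∷ lookup R t₁ ∷ lookup R t₂ ∷ [])

      equivalent? : ∀ p → Dec (Equivalent p)
      equivalent? (p₀ ∷ p₁ ∷ p₂ ∷ []) =
        any? λ t₀ → fits? R p₀ t₀ ×-dec any? λ t₁ → fits? R p₁ t₁ ×-dec any? λ t₂ → fits? R p₂ t₂ ×-dec
        matches? (lookup R t₀ ∷ lookup R t₁ ∷ lookup R t₂ ∷ [])

  -- A factor of F with a cycle that misses some start.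
  Stuck : Partial 6 6 → Vec (Fin 6) 6 → Set
  Stuck f R = ∃ λ z → (∀ u → lookup R u ≡ lookup R z → lookup f u ≢ nothing)
                    × ∃ λ w → lookup R w ≢ lookup R z

  stuck? : ∀ f R → Dec (Stuck f R)
  stuck? f R = any? λ z →
    (all? λ u → (lookup R u ≟ lookup R z) →-dec ¬? (lookup f u ≟ₘ nothing))
    ×-dec any? λ w → ¬? (lookup R w ≟ lookup R z)

  Agree : Vec (Fin 6) 6 → Maybe (Fin 6) → Fin 6 → Set
  Agree R nothing  u = ⊤
  Agree R (just v) u = lookup R u ≡ lookup R v

  agree? : ∀ R m u → Dec (Agree R m u)
  agree? R nothing  u = yes tt
  agree? R (just v) u = lookup R u ≟ lookup R v

  Table : Set → Set
  Table A = Vec (Vec A 2) 2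

  entry : {A : Set} → Table A → Choice → A
  entry T (i , j) = lookup (lookup T i) j

  -- The tables are parameters, although they are determined by h, x and y, because the
  -- evaluation of the decision procedure then computes each of them only once.
  module Search (Fs : Table (Partial 6 6)) (Rs : Table (Vec (Fin 6) 6)) where

    RootsAgree : Set
    RootsAgree = ∀ i j u → Agree (entry Rs (i , j)) (lookup (entry Fs (i , j)) u) u

    rootsAgree? : Dec RootsAgree
    rootsAgree? = all? λ i → all? λ j → all? λ u → agree? (entry Rs (i , j)) (lookup (entry Fs (i , j)) u) u

    module _ (x y : Vec (Fin 6) 3) where

      open Candidate x y

      module _ (p : Vec (Maybe (Fin 6)) 3) (Es : Vec (Vec (Fin 6) 3) 3) (fs : Vec (Partial 3 3) 3) (Rs′ : Vec (Vec (Fin 3) 3) 3) where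

        infix 4 _≃_ _≃?_

        _≃_ : Choice → Fin 3 → Set
        c ≃ k = Equivalent c (entry Rs c) (lookup Es k) (lookup fs k) (lookup Rs′ k) p

        _≃?_ : ∀ c k → Dec (c ≃ k)
        c ≃? k = equivalent? c (entry Rs c) (lookup Es k) (lookup fs k) (lookup Rs′ k) p

        CertifiedFrom : Set
        CertifiedFrom =
            Embeds
          × (∀ (k : Fin 2) → ∃ λ i → ∃ λ j → (i , j) ≃ (k ↑ˡ 1))
          × (∀ i j → Stuck (entry Fs (i , j)) (entry Rs (i , j)) ⊎ ∃ λ k → (i , j) ≃ k)

        certifiedFrom? : Dec CertifiedFrom
        certifiedFrom? =
          embeds?
          ×-dec (all? λ (k : Fin 2) → any? λ i → any? λ j → (i , j) ≃? (k ↑ˡ 1))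
          ×-dec (all? λ i → all? λ j → stuck? (entry Fs (i , j)) (entry Rs (i , j)) ⊎-dec any? λ k → (i , j) ≃? k)

      Certified : Vec (Vec (Fin 6) 3) 3 → Set
      Certified Es = CertifiedFrom pins Es (Vec.map flow′ Es) (Vec.map (roots ∘ flow′) Es)

      certified? : ∀ Es → Dec (Certified Es)
      certified? Es = certifiedFrom? pins Es (Vec.map flow′ Es) (Vec.map (roots ∘ flow′) Es)

  triple : List (Fin 6) → Vec (Fin 6) 3
  triple (a ∷ b ∷ c ∷ _) = a ∷ b ∷ c ∷ []
  -- A dummy that is never certified, since `Embeds` requires distinct entries.
  triple _               = 0F ∷ 0F ∷ 0F ∷ []

  -- For admissible `h` at most three starts are sources, so putting these first ensures that all of
  -- them are taken. The sinks and the ends glued to the starts taken are then three in number as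
  -- well.
  starts ends : Vec (Fin 6) 3
  starts = triple (List.filter isSource? (allFin 6) ++ List.filter (¬? ∘ isSource?) (allFin 6))
  ends = triple (List.filter (λ z → (lookup h z ≟ₘ nothing) ⊎-dec any? λ i → lookup h z ≟ₘ just (lookup starts i)) (allFin 6))

  permute : Vec (Fin 3) 3 → Vec (Fin 6) 3 → Vec (Fin 6) 3
  permute p v = Vec.map (lookup v) p

  -- Up to rotation these are half of the matchings of starts with ends; they suffice.
  xs : Vec (Vec (Fin 6) 3) 2
  xs = Vec.map (λ p → permute p starts) ((0F ∷ 1F ∷ 2F ∷ []) ∷ (0F ∷ 2F ∷ 1F ∷ []) ∷ [])
  ys : Vec (Vec (Fin 6) 3) 3
  ys = Vec.map (λ p → permute p ends) ((0F ∷ 1F ∷ 2F ∷ []) ∷ (0F ∷ 2F ∷ 1F ∷ []) ∷ (1F ∷ 0F ∷ 2F ∷ []) ∷ [])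

  module _ (Fs : Table (Partial 6 6)) (Rs : Table (Vec (Fin 6) 6)) where

    open Search Fs Rs

    SolvableFrom : Set
    SolvableFrom = RootsAgree × ∃ λ q → ∃ λ p →
      Certified (lookup xs p) (lookup ys q) (Candidate.exits (lookup xs p) (lookup ys q))

    solvableFrom? : Dec SolvableFrom
    solvableFrom? = rootsAgree? ×-dec any? λ q → any? λ p →
      certified? (lookup xs p) (lookup ys q) (Candidate.exits (lookup xs p) (lookup ys q))

  rootTable : Table (Partial 6 6) → Table (Vec (Fin 6) 6)
  rootTable = Vec.map (Vec.map roots)

  flows : Table (Partial 6 6)
  flows = tabulate λ i → tabulate λ j → flow (i , j)

  Solvable : Set
  Solvable = SolvableFrom flows (rootTable flows)

  solvable? : Dec Solvable
  solvable? = decide flows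
    where
    decide : ∀ Fs → Dec (SolvableFrom Fs (rootTable Fs))
    decide Fs = solvableFrom? Fs (rootTable Fs)

-- By cleanness an end of one hexagon can only be a start of the other. Each of the six ends thus
-- has four possibilities, `0F` standing for an exit of `F`.
crossA crossB : Fin 4 → Maybe (Fin 6)
crossA 0F      = nothing
crossA (suc i) = just (3 ↑ʳ i)
crossB 0F      = nothing
crossB (suc i) = just (i ↑ˡ 3)

glue : Fin 4 → Fin 4 → Fin 4 → Fin 4 → Fin 4 → Fin 4 → Partial 6 6
glue a b c d e f = crossA a ∷ crossA b ∷ crossA c ∷ crossB d ∷ crossB e ∷ crossB f ∷ []

-- The `4^6` gluings are evaluated in 16 batches, one for each pair of values at the first two ends.
solve? : ∀ a b → Dec (∀ c d e f → Gluing.Admissible (glue a b c d e f) → Gluing.Solvable (glue a b c d e f))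
solve? a b = all? λ c → all? λ d → all? λ e → all? λ f →
  Gluing.admissible? (glue a b c d e f) →-dec Gluing.solvable? (glue a b c d e f)

-- What a solved gluing provides

module _ (h : Partial 6 6) where

  open Gluing h

  -- `t` leads from a start of `F′` to a start of `F` on the corresponding path or cycle, and `r`
  -- leads back. They are extended below to the vertex maps `θ` and `q` between `G′` and `G`.
  record Simulation (x y : Vec (Fin 6) 3) (c : Choice) (k : Fin 3) : Set where
    open Candidate x y
    R : Fin 6 → Fin 6
    R = root (flow c)
    exit : Fin 3 → Fin 6
    exit i = lookup y (turn next k i)
    R′ : Fin 3 → Fin 3
    R′ = root (flow′ (tabulate exit))
    field
      t            : Fin 3 → Fin 6
      r            : Fin 6 → Fin 3
      pinned       : ∀ i → IsSource (lookup x i) → t i ≡ lookup x i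
      follows-just : ∀ i j → (lookup h (exit i) >>= place) ≡ just j → R (t i) ≡ R (t j)
      follows-none : ∀ i → (lookup h (exit i) >>= place) ≡ nothing → head c (R (t i)) ≡ exit i
      covers       : ∀ u → R (t (r u)) ≡ R u
      separated    : ∀ i j → R (t i) ≡ R (t j) → R′ i ≡ R′ j

  record Solution : Set where
    field
      x y        : Vec (Fin 6) 3
      embeds     : Candidate.Embeds x y
      rootsAgree : ∀ c {u v} → lookup (flow c) u ≡ just v → root (flow c) u ≡ root (flow c) v
      realised   : ∀ (k : Fin 2) → ∃ λ c → Simulation x y c (k ↑ˡ 1)
      classified : ∀ c → (∃ λ z → (∀ u → root (flow c) u ≡ root (flow c) z → lookup (flow c) u ≢ nothing)
                                × ∃ λ w → root (flow c) w ≢ root (flow c) z)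
                       ⊎ (∃ λ k → Simulation x y c k)

  private
    Fs : Table (Partial 6 6)
    Fs = flows

    Rs : Table (Vec (Fin 6) 6)
    Rs = rootTable Fs

    entry-Fs : ∀ c → entry Fs c ≡ flow c
    entry-Fs (i , j) = trans (cong (λ v → lookup v j) (lookup∘tabulate (λ i → tabulate λ j → flow (i , j)) i))
                             (lookup∘tabulate (λ j → flow (i , j)) j)

    entry-Rs : ∀ c u → lookup (entry Rs c) u ≡ root (flow c) u
    entry-Rs c@(i , j) u = trans (cong (λ v → lookup v u) (trans (cong (λ v → lookup v j) (lookup-map i (Vec.map roots) Fs))
                                                         (lookup-map j roots (lookup Fs i))))
      (trans (lookup∘tabulate (root (entry Fs c)) u) (cong (λ f → root f u) (entry-Fs c)))

    module _ (x y : Vec (Fin 6) 3) where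

      open Candidate x y

      unpack : ∀ c k → Equivalent c (entry Rs c) (lookup exits k) (lookup (Vec.map flow′ exits) k)
                                  (lookup (Vec.map (roots ∘ flow′) exits) k) pins → Simulation x y c k
      unpack c k eqv = unpins x refl eqv
        where
        E : Vec (Fin 6) 3
        E = lookup exits k
        E≡ : E ≡ tabulate (λ i → lookup y (turn next k i))
        E≡ = lookup∘tabulate (λ k → tabulate λ i → lookup y (turn next k i)) k
        f : Partial 3 3
        f = lookup (Vec.map flow′ exits) k
        f≡ : f ≡ flow′ (tabulate λ i → lookup y (turn next k i))
        f≡ = trans (lookup-map k flow′ exits) (cong flow′ E≡)
        f-at : ∀ i → lookup f i ≡ (lookup h (lookup y (turn next k i)) >>= place)
        f-at i = trans (cong (λ f → lookup f i) f≡) (trans (lookup-map i (λ z → lookup h z >>= place) (tabulate λ i → lookup y (turn next k i)))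
                   (cong (λ z → lookup h z >>= place) (lookup∘tabulate (λ i → lookup y (turn next k i)) i)))
        E-at : ∀ i → lookup E i ≡ lookup y (turn next k i)
        E-at i = trans (cong (λ v → lookup v i) E≡) (lookup∘tabulate (λ i → lookup y (turn next k i)) i)
        R′ : Vec (Fin 3) 3
        R′ = lookup (Vec.map (roots ∘ flow′) exits) k
        R′-at : ∀ i → lookup R′ i ≡ root (flow′ (tabulate λ i → lookup y (turn next k i))) i
        R′-at i = trans (cong (λ v → lookup v i) (lookup-map k (roots ∘ flow′) exits))
                 (trans (lookup∘tabulate (root (flow′ E)) i) (cong (λ E → root (flow′ E) i) E≡))
        pin : Fin 6 → Maybe (Fin 6)
        pin u = if does (isSource? u) then just u else nothing
        fits : ∀ u v → Fits (entry Rs c) (pin u) v → IsSource u → v ≡ u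
        fits u v p src = subst (λ b → Fits (entry Rs c) (if b then just u else nothing) v) (dec-true (isSource? u) src) p
        build : (t : Vec (Fin 6) 3) → (∀ i → IsSource (lookup x i) → lookup t i ≡ lookup x i) →
                Matches c (entry Rs c) E f R′ (Vec.map (lookup (entry Rs c)) t) → Simulation x y c k
        build t pinned (follows , cover , separated) = record
          { t = lookup t
          ; r = λ u → proj₁ (cover u)
          ; pinned = pinned
          ; follows-just = λ i j e → trans (sym (T-at i)) (trans (follow-just i j (lookup f i) (follows i) (trans (f-at i) e)) (T-at j))
          ; follows-none = λ i e → trans (cong (head c) (sym (T-at i))) (trans (follow-none i (lookup f i) (follows i) (trans (f-at i) e)) (E-at i))
          ; covers = λ u → trans (sym (T-at (proj₁ (cover u)))) (trans (proj₂ (cover u)) (entry-Rs c u))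
          ; separated = λ i j e → trans (sym (R′-at i)) (trans (separated i j (trans (T-at i) (trans e (sym (T-at j))))) (R′-at j))
          }
          where
          T : Vec (Fin 6) 3
          T = Vec.map (lookup (entry Rs c)) t
          T-at : ∀ i → lookup T i ≡ root (flow c) (lookup t i)
          T-at i = trans (lookup-map i (lookup (entry Rs c)) t) (entry-Rs c (lookup t i))
          follow-just : ∀ i j m → Follows c (entry Rs c) E f R′ T i m → m ≡ just j → lookup T i ≡ lookup T j
          follow-just i j .(just j) p refl = p
          follow-none : ∀ i m → Follows c (entry Rs c) E f R′ T i m → m ≡ nothing → head c (lookup T i) ≡ lookup E i
          follow-none i .nothing p refl = p
        -- `Equivalent` reduces only on an explicit triple, so a copy of `x` is taken apart.
        unpins : ∀ x′ → x′ ≡ x → Equivalent c (entry Rs c) E f R′ (Vec.map pin x′) → Simulation x y c k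
        unpins (x₀ ∷ x₁ ∷ x₂ ∷ []) refl (t₀ , p₀ , t₁ , p₁ , t₂ , p₂ , m) = build (t₀ ∷ t₁ ∷ t₂ ∷ [])
          (λ { 0F → fits x₀ t₀ p₀ ; 1F → fits x₁ t₁ p₁ ; 2F → fits x₂ t₂ p₂ }) m

  solution : Solvable → Solution
  solution (agree , q , p , embeds , realised , classified) = record
    { x = x ; y = y ; embeds = embeds
    ; rootsAgree = λ { c@(i , j) {u} {v} e → trans (sym (entry-Rs c u))
        (trans (agreeing c u v _ (agree i j u) (trans (cong (λ f → lookup f u) (entry-Fs c)) e)) (entry-Rs c v)) }
    ; realised = λ k → let i , j , e = realised k in (i , j) , unpack x y (i , j) (k ↑ˡ 1) e
    ; classified = λ { c@(i , j) → Sum.map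
        (λ { (z , closed , w , w≢z) → z , (λ u e eq → closed u (trans (entry-Rs c u) (trans e (sym (entry-Rs c z))))
                                                   (trans (cong (λ f → lookup f u) (entry-Fs c)) eq))
                                        , w , λ e → w≢z (trans (entry-Rs c w) (trans e (sym (entry-Rs c z)))) })
        (λ { (k , e) → k , unpack x y c k e }) (classified i j) }
    }
    where
    x y : Vec (Fin 6) 3
    x = lookup xs p
    y = lookup ys q
    agreeing : ∀ c u v m → Agree (entry Rs c) m u → m ≡ just v → lookup (entry Rs c) u ≡ lookup (entry Rs c) v
    agreeing c u v .(just v) a refl = a

abstract
  solved : ∀ a b → does (solve? a b) ≡ true
  solved 0F 0F = refl
  solved 0F 1F = refl
  solved 0F 2F = refl
  solved 0F 3F = refl
  solved 1F 0F = refl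
  solved 1F 1F = refl
  solved 1F 2F = refl
  solved 1F 3F = refl
  solved 2F 0F = refl
  solved 2F 1F = refl
  solved 2F 2F = refl
  solved 2F 3F = refl
  solved 3F 0F = refl
  solved 3F 1F = refl
  solved 3F 2F = refl
  solved 3F 3F = refl

solutionOf : ∀ a b c d e f → Gluing.Admissible (glue a b c d e f) → Solution (glue a b c d e f)
solutionOf a b c d e f adm = solution (glue a b c d e f) (holds (solve? a b) (solved a b) c d e f adm)

-- Alternating cycles of induced subgraphs, and the labelling of `F`

module _ {G : Digraph} {K : Subset (#A G)} where

  open Induced G K using (ιA∈K; ι-src; ι-tgt; endPoint?)

  ιA-injective : ∀ {a b} → ιA G K a ≡ ιA G K b → a ≡ b
  ιA-injective = enum-injective (_∈? K)

  ιV-injective : ∀ {u v} → ιV G K u ≡ ιV G K v → u ≡ v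
  ιV-injective = enum-injective endPoint?

  arcIn : ∀ {a} → a ∈ K → A (induced G K)
  arcIn = rank (_∈? K)

  ιA-arcIn : ∀ {a} (p : a ∈ K) → ιA G K (arcIn p) ≡ a
  ιA-arcIn = enum-rank (_∈? K)

  lift : AltCycle (induced G K) → AltCycle G
  lift C = record
    { r = AC.r C
    ; r≢0 = AC.r≢0 C
    ; fwd = ιA G K ∘ AC.fwd C
    ; bwd = ιA G K ∘ AC.bwd C
    ; fwd-inj = AC.fwd-inj C ∘ ιA-injective
    ; bwd-inj = AC.bwd-inj C ∘ ιA-injective
    ; fwd≢bwd = λ i j → AC.fwd≢bwd C i j ∘ ιA-injective
    ; common-end = λ i → trans (sym (ι-tgt _)) (trans (cong (ιV G K) (AC.common-end C i)) (ι-tgt _))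
    ; common-start = λ i → trans (sym (ι-src _)) (trans (cong (ιV G K) (AC.common-start C i)) (ι-src _))
    }

  lift-∋⁺ : ∀ (C : AltCycle (induced G K)) {a} → C ∋ a → lift C ∋ ιA G K a
  lift-∋⁺ C (i , p) = i , Sum.map (cong (ιA G K)) (cong (ιA G K)) p

  lift-∋⁻ : ∀ (C : AltCycle (induced G K)) {a} → lift C ∋ ιA G K a → C ∋ a
  lift-∋⁻ C (i , p) = i , Sum.map ιA-injective ιA-injective p

  lift-⊆ : ∀ (C : AltCycle (induced G K)) {a} → lift C ∋ a → a ∈ K
  lift-⊆ C (i , inj₁ refl) = ιA∈K _
  lift-⊆ C (i , inj₂ refl) = ιA∈K _

  module Restrict (C : AltCycle G) (C⊆K : ∀ {a} → C ∋ a → a ∈ K) where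

    private
      f b : Fin (AC.r C) → A (induced G K)
      f i = arcIn (C⊆K (i , inj₁ refl))
      b i = arcIn (C⊆K (i , inj₂ refl))
      ιf : ∀ i → ιA G K (f i) ≡ AC.fwd C i
      ιf i = ιA-arcIn (C⊆K (i , inj₁ refl))
      ιb : ∀ i → ιA G K (b i) ≡ AC.bwd C i
      ιb i = ιA-arcIn (C⊆K (i , inj₂ refl))

    restrict : AltCycle (induced G K)
    restrict = record
      { r = AC.r C
      ; r≢0 = AC.r≢0 C
      ; fwd = f
      ; bwd = b
      ; fwd-inj = λ {i} {j} eq → AC.fwd-inj C (trans (sym (ιf i)) (trans (cong (ιA G K) eq) (ιf j)))
      ; bwd-inj = λ {i} {j} eq → AC.bwd-inj C (trans (sym (ιb i)) (trans (cong (ιA G K) eq) (ιb j)))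
      ; fwd≢bwd = λ i j eq → AC.fwd≢bwd C i j (trans (sym (ιf i)) (trans (cong (ιA G K) eq) (ιb j)))
      ; common-end = λ i → ιV-injective (trans (ι-tgt (f i)) (trans (cong (tgt G) (ιf i))
          (trans (AC.common-end C i) (trans (cong (tgt G) (sym (ιb i))) (sym (ι-tgt (b i)))))))
      ; common-start = λ i → ιV-injective (trans (ι-src (b i)) (trans (cong (src G) (ιb i))
          (trans (AC.common-start C i) (trans (cong (src G) (sym (ιf (next i)))) (sym (ι-src (f (next i))))))))
      }

    restrict-∋ : ∀ {a} → C ∋ ιA G K a → restrict ∋ a
    restrict-∋ (i , inj₁ p) = i , inj₁ (ιA-injective (trans (ιf i) p))
    restrict-∋ (i , inj₂ p) = i , inj₂ (ιA-injective (trans (ιb i) p))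

    restrict-∋⁻ : ∀ {a} → restrict ∋ a → C ∋ ιA G K a
    restrict-∋⁻ (i , inj₁ p) = i , inj₁ (trans (sym (ιf i)) (cong (ιA G K) p))
    restrict-∋⁻ (i , inj₂ p) = i , inj₂ (trans (sym (ιb i)) (cong (ιA G K) p))

record Hexagon (G : Digraph) (C : AltCycle G) : Set where
  field
    f b    : Fin 3 → A G
    f-inj  : Injective _≡_ _≡_ f
    b-inj  : Injective _≡_ _≡_ b
    f≢b    : ∀ i j → f i ≢ b j
    ends   : ∀ i → tgt G (f i) ≡ tgt G (b i)
    starts : ∀ i → src G (b i) ≡ src G (f (next i))
    C∋f    : ∀ i → C ∋ f i
    C∋b    : ∀ i → C ∋ b i
    C∋⁻    : ∀ {a} → C ∋ a → ∃ λ i → f i ≡ a ⊎ b i ≡ a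

hexagon : ∀ {G} (C : AltCycle G) → AC.r C ≡ 3 → Hexagon G C
hexagon record { fwd = f ; bwd = b ; fwd-inj = fi ; bwd-inj = bi ; fwd≢bwd = fb ; common-end = e ; common-start = s } refl = record
  { f = f ; b = b ; f-inj = fi ; b-inj = bi ; f≢b = fb ; ends = e ; starts = s
  ; C∋f = λ i → i , inj₁ refl ; C∋b = λ i → i , inj₂ refl ; C∋⁻ = id }

-- In `clean` forward arcs suffice: every start and every end of `F` belongs to one of them.
record Labelling (G : Digraph) (K : Subset (#A G)) : Set where
  field
    fw bw  : Fin 6 → A G
    fw∈    : ∀ z → fw z ∈ K
    bw∈    : ∀ z → bw z ∈ K
    cover  : ∀ {a} → a ∈ K → ∃ λ z → fw z ≡ a ⊎ bw z ≡ a
    fw-inj : Injective _≡_ _≡_ fw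
    bw-inj : Injective _≡_ _≡_ bw
    fw≢bw  : ∀ y z → fw y ≢ bw z
    ends   : ∀ z → tgt G (fw z) ≡ tgt G (bw z)
    starts : ∀ z → src G (bw z) ≡ src G (fw (rot z))
    clean  : ∀ u z → side u ≡ side z → src G (fw u) ≢ tgt G (fw z)

module _ {G : Digraph} (dd : Is2dd G) (clean : Clean G) (six : AllAltCyclesHave6Arcs G)
         {K : Subset (#A G)} (K-union : IsUnionOfAltCycles G K) where

  open TwoDD G dd

  union-closed : Closed G (_∈ K)
  union-closed {a} {b} same a∈K with IsUnionOfAltCycles.union K-union a∈K
  ... | C , C∋a , C⊆K = C⊆K (altCycle-closed C same C∋a)

  r≡3 : ∀ C → AC.r C ≡ 3
  r≡3 C = ℕₚ.*-cancelˡ-≡ (AC.r C) 3 2 (six C)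

  labelling : #AltCycles≡ (induced G K) 2 → Labelling G K
  labelling (g , g-inj , g-surj) = record
    { fw = [ X.f , Y.f ]′ ∘ splitAt 3
    ; bw = [ X.b , Y.b ]′ ∘ splitAt 3
    ; fw∈ = λ z → fw∈ (splitAt 3 z)
    ; bw∈ = λ z → bw∈ (splitAt 3 z)
    ; cover = cover
    ; fw-inj = λ {y} {z} eq → split-inj (fw-inj (splitAt 3 y) (splitAt 3 z) eq)
    ; bw-inj = λ {y} {z} eq → split-inj (bw-inj (splitAt 3 y) (splitAt 3 z) eq)
    ; fw≢bw = λ y z → fw≢bw (splitAt 3 y) (splitAt 3 z)
    ; ends = λ z → ends (splitAt 3 z)
    ; starts = starts
    ; clean = λ u z same → clean′ (splitAt 3 u) (splitAt 3 z) same
    }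
    where
    C₀ C₁ : AltCycle G
    C₀ = lift (g 0F)
    C₁ = lift (g 1F)
    X : Hexagon G C₀
    X = hexagon C₀ (r≡3 C₀)
    Y : Hexagon G C₁
    Y = hexagon C₁ (r≡3 C₁)
    module X = Hexagon X
    module Y = Hexagon Y
    -- A common arc would make the two cycles equal, although they are enumerated without
    -- repetition.
    disjoint : ∀ {a} → C₀ ∋ a → C₁ ∋ a → ∀ {Z : Set} → Z
    disjoint {a} p q with g-inj {0F} {1F} (λ b → mk⇔
      (λ r → lift-∋⁻ (g 1F) (altCycle-meet C₀ C₁ p q (lift-∋⁺ (g 0F) r)))
      (λ r → lift-∋⁻ (g 0F) (altCycle-meet C₁ C₀ q p (lift-∋⁺ (g 1F) r))))
    ... | ()
    fw bw : Fin 3 ⊎ Fin 3 → A G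
    fw = [ X.f , Y.f ]′
    bw = [ X.b , Y.b ]′
    split-inj : ∀ {y z : Fin 6} → splitAt 3 y ≡ splitAt 3 z → y ≡ z
    split-inj {y} {z} eq = trans (sym (join-splitAt 3 3 y)) (trans (cong (join 3 3) eq) (join-splitAt 3 3 z))
    fw∈ : ∀ z → fw z ∈ K
    fw∈ (inj₁ i) = lift-⊆ (g 0F) (X.C∋f i)
    fw∈ (inj₂ i) = lift-⊆ (g 1F) (Y.C∋f i)
    bw∈ : ∀ z → bw z ∈ K
    bw∈ (inj₁ i) = lift-⊆ (g 0F) (X.C∋b i)
    bw∈ (inj₂ i) = lift-⊆ (g 1F) (Y.C∋b i)
    fw-inj : ∀ y z → fw y ≡ fw z → y ≡ z
    fw-inj (inj₁ i) (inj₁ j) eq = cong inj₁ (X.f-inj eq)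
    fw-inj (inj₂ i) (inj₂ j) eq = cong inj₂ (Y.f-inj eq)
    fw-inj (inj₁ i) (inj₂ j) eq = disjoint (X.C∋f i) (subst (C₁ ∋_) (sym eq) (Y.C∋f j))
    fw-inj (inj₂ i) (inj₁ j) eq = disjoint (X.C∋f j) (subst (C₁ ∋_) eq (Y.C∋f i))
    bw-inj : ∀ y z → bw y ≡ bw z → y ≡ z
    bw-inj (inj₁ i) (inj₁ j) eq = cong inj₁ (X.b-inj eq)
    bw-inj (inj₂ i) (inj₂ j) eq = cong inj₂ (Y.b-inj eq)
    bw-inj (inj₁ i) (inj₂ j) eq = disjoint (X.C∋b i) (subst (C₁ ∋_) (sym eq) (Y.C∋b j))
    bw-inj (inj₂ i) (inj₁ j) eq = disjoint (X.C∋b j) (subst (C₁ ∋_) eq (Y.C∋b i))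
    fw≢bw : ∀ y z → fw y ≢ bw z
    fw≢bw (inj₁ i) (inj₁ j) eq = X.f≢b i j eq
    fw≢bw (inj₂ i) (inj₂ j) eq = Y.f≢b i j eq
    fw≢bw (inj₁ i) (inj₂ j) eq = disjoint (X.C∋f i) (subst (C₁ ∋_) (sym eq) (Y.C∋b j))
    fw≢bw (inj₂ i) (inj₁ j) eq = disjoint (X.C∋b j) (subst (C₁ ∋_) eq (Y.C∋f i))
    ends : ∀ z → tgt G (fw z) ≡ tgt G (bw z)
    ends (inj₁ i) = X.ends i
    ends (inj₂ i) = Y.ends i
    starts : ∀ z → src G (bw (splitAt 3 z)) ≡ src G (fw (splitAt 3 (rot z)))
    starts 0F = X.starts 0F
    starts 1F = X.starts 1F
    starts 2F = X.starts 2F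
    starts 3F = Y.starts 0F
    starts 4F = Y.starts 1F
    starts 5F = Y.starts 2F
    clean′ : ∀ u z → sideOf u ≡ sideOf z → src G (fw u) ≢ tgt G (fw z)
    clean′ (inj₁ i) (inj₁ j) _ = clean C₀ (X.C∋f i) (X.C∋f j)
    clean′ (inj₂ i) (inj₂ j) _ = clean C₁ (Y.C∋f i) (Y.C∋f j)
    cover : ∀ {a} → a ∈ K → ∃ λ z → fw (splitAt 3 z) ≡ a ⊎ bw (splitAt 3 z) ≡ a
    cover {a} a∈K with IsUnionOfAltCycles.union K-union a∈K
    ... | C , C∋a , C⊆K with g-surj (Restrict.restrict C C⊆K)
    ...   | i , same = locate i (subst (lift (g i) ∋_) (ιA-arcIn {G} {K} a∈K)
            (lift-∋⁺ (g i) (from (same refl (arcIn {G} {K} a∈K)) (Restrict.restrict-∋ C C⊆K (subst (C ∋_) (sym (ιA-arcIn {G} {K} a∈K)) C∋a)))))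
      where
      locate : ∀ i → lift (g i) ∋ a → ∃ λ z → fw (splitAt 3 z) ≡ a ⊎ bw (splitAt 3 z) ≡ a
      locate 0F p with X.C∋⁻ p
      ... | j , q = join 3 3 (inj₁ j) , subst (λ s → fw s ≡ a ⊎ bw s ≡ a) (sym (splitAt-join 3 3 (inj₁ j))) q
      locate 1F p with Y.C∋⁻ p
      ... | j , q = join 3 3 (inj₂ j) , subst (λ s → fw s ≡ a ⊎ bw s ≡ a) (sym (splitAt-join 3 3 (inj₂ j))) q

-- Degrees in an induced subgraph

∁-closed : ∀ {G} {K : Subset (#A G)} → Closed G (_∈ K) → Closed G (_∈ ∁ K)
∁-closed closed same a∈∁ = x∉p⇒x∈∁p λ b∈ →
  x∈∁p⇒x∉p a∈∁ (closed ([ inj₁ ∘ sym , inj₂ ∘ sym ]′ same) b∈)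

module Degrees (G : Digraph) (dd : Is2dd G) (K : Subset (#A G)) (closed : Closed G (_∈ K)) where

  open TwoDD G dd
  open Induced G K using (ιA∈K; ι-src; ι-tgt; endPoint?; EndPoint)

  private
    F : Digraph
    F = induced G K

  -- As `K` is closed, it contains both or none of the in-arcs of a vertex, and likewise of the
  -- out-arcs. One arc therefore decides whether a degree in `F` is 2 or 0.
  In Out : V G → Set
  In  w = ∃ λ a → a ∈ K × tgt G a ≡ w
  Out w = ∃ λ a → a ∈ K × src G a ≡ w

  in? : ∀ w → Dec (In w)
  in? w = any? λ a → (a ∈? K) ×-dec (tgt G a ≟ w)

  out? : ∀ w → Dec (Out w)
  out? w = any? λ a → (a ∈? K) ×-dec (src G a ≟ w)

  vertexIn : ∀ {w} → In w ⊎ Out w → ∃ λ v → ιV G K v ≡ w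
  vertexIn (inj₁ (a , a∈ , t)) = rank endPoint? (a , a∈ , inj₂ t) , enum-rank endPoint? (a , a∈ , inj₂ t)
  vertexIn (inj₂ (a , a∈ , s)) = rank endPoint? (a , a∈ , inj₁ s) , enum-rank endPoint? (a , a∈ , inj₁ s)

  inOrOut : ∀ v → In (ιV G K v) ⊎ Out (ιV G K v)
  inOrOut v with enum-satisfies endPoint? v
  ... | a , a∈ , inj₁ s = inj₂ (a , a∈ , s)
  ... | a , a∈ , inj₂ t = inj₁ (a , a∈ , t)

  private
    module End (g : A G → V G) (gF : A F → V F) (ι-g : ∀ a → ιV G K (gF a) ≡ g (ιA G K a))
               (two : ∀ v → #[ (λ a → g a ≟ v) ] ≡ 2)
               (g-closed : ∀ {a b} → g a ≡ g b → a ∈ K → b ∈ K) where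

      open Mate g two

      some⇒2 : ∀ v → (∃ λ a → a ∈ K × g a ≡ ιV G K v) → #[ (λ a → gF a ≟ v) ] ≡ 2
      some⇒2 v (a , a∈ , ga) = #≡2⁺ (λ a → gF a ≟ v) {arcIn {G} {K} a∈} {arcIn {G} {K} b∈}
        (λ eq → mate-≢ a (trans (sym (ιA-arcIn {G} {K} b∈)) (trans (cong (ιA G K) (sym eq)) (ιA-arcIn {G} {K} a∈))))
        (at a∈ ga) (at b∈ (trans (mate-≡ a) ga)) only
        where
        b∈ : mate a ∈ K
        b∈ = g-closed (sym (mate-≡ a)) a∈
        at : ∀ {a} (a∈ : a ∈ K) → g a ≡ ιV G K v → gF (arcIn {G} {K} a∈) ≡ v
        at a∈ ga = ιV-injective {G} {K} (trans (ι-g _) (trans (cong g (ιA-arcIn {G} {K} a∈)) ga))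
        only : ∀ c → gF c ≡ v → c ≡ arcIn {G} {K} a∈ ⊎ c ≡ arcIn {G} {K} b∈
        only c gc with ιA G K c ≟ a
        ... | yes c≡a = inj₁ (ιA-injective {G} {K} (trans c≡a (sym (ιA-arcIn {G} {K} a∈))))
        ... | no  c≢a = inj₂ (ιA-injective {G} {K} (trans
                (mate-unique (trans (sym (ι-g c)) (trans (cong (ιV G K) gc) (sym ga))) c≢a) (sym (ιA-arcIn {G} {K} b∈))))

      none⇒0 : ∀ v → ¬ (∃ λ a → a ∈ K × g a ≡ ιV G K v) → #[ (λ a → gF a ≟ v) ] ≡ 0
      none⇒0 v none = #≡0⁺ (λ a → gF a ≟ v) λ a ga →
        none (ιA G K a , ιA∈K a , trans (sym (ι-g a)) (cong (ιV G K) ga))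

      2⇒some : ∀ v → #[ (λ a → gF a ≟ v) ] ≡ 2 → ∃ λ a → a ∈ K × g a ≡ ιV G K v
      2⇒some v eq with #≡2⁻ (λ a → gF a ≟ v) eq
      ... | a , _ , _ , ga , _ = ιA G K a , ιA∈K a , trans (sym (ι-g a)) (cong (ιV G K) ga)

      0⇒none : ∀ v → #[ (λ a → gF a ≟ v) ] ≡ 0 → ¬ (∃ λ a → a ∈ K × g a ≡ ιV G K v)
      0⇒none v eq some with trans (sym eq) (some⇒2 v some)
      ... | ()

    module Ends   = End (tgt G) (tgt F) ι-tgt (proj₁ ∘ dd) (closed ∘ inj₁)
    module Starts = End (src G) (src F) ι-src (proj₂ ∘ dd) (closed ∘ inj₂)

  isEntry⁺ : ∀ v → ¬ In (ιV G K v) → Out (ιV G K v) → IsEntry F v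
  isEntry⁺ v ¬i o = Ends.none⇒0 v ¬i , Starts.some⇒2 v o

  isExit⁺ : ∀ v → In (ιV G K v) → ¬ Out (ιV G K v) → IsExit F v
  isExit⁺ v i ¬o = Ends.some⇒2 v i , Starts.none⇒0 v ¬o

  isEntry⁻ : ∀ v → IsEntry F v → ¬ In (ιV G K v) × Out (ιV G K v)
  isEntry⁻ v (i , o) = Ends.0⇒none v i , Starts.2⇒some v o

  isExit⁻ : ∀ v → IsExit F v → In (ιV G K v) × ¬ Out (ιV G K v)
  isExit⁻ v (i , o) = Ends.2⇒some v i , Starts.0⇒none v o

  isSaturated⁻ : ∀ v → IsSaturated F v → In (ιV G K v) × Out (ιV G K v)
  isSaturated⁻ v (i , o) = Ends.2⇒some v i , Starts.2⇒some v o

  is2Digraph : Is2Digraph F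
  is2Digraph v with in? (ιV G K v) | out? (ιV G K v)
  ... | yes i | yes o = inj₂ (inj₂ (Ends.some⇒2 v i , Starts.some⇒2 v o))
  ... | yes i | no ¬o = inj₂ (inj₁ (isExit⁺ v i ¬o))
  ... | no ¬i | yes o = inj₁ (isEntry⁺ v ¬i o)
  ... | no ¬i | no ¬o = ⊥-elim ([ ¬i , ¬o ]′ (inOrOut v))

isEntry-irrelevant : ∀ G → Irrelevant (IsEntry G)
isEntry-irrelevant G (p , q) (p′ , q′) = cong₂ _,_ (ℕₚ.≡-irrelevant p p′) (ℕₚ.≡-irrelevant q q′)

isExit-irrelevant : ∀ G → Irrelevant (IsExit G)
isExit-irrelevant G (p , q) (p′ , q′) = cong₂ _,_ (ℕₚ.≡-irrelevant p p′) (ℕₚ.≡-irrelevant q q′)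

-- The exits of `F` and the entries and exits of `F′` and of the complement can all be seen as
-- vertices of `G`, which serves as `W`. They are matched by being the same vertex there.
module Matching {A B W : Set} {P : A → Set} {Q : B → Set}
                (P-irrelevant : Irrelevant P) (Q-irrelevant : Irrelevant Q)
                (ι : A → W) (κ : B → W)
                (ι-injective : ∀ {x y} → ι x ≡ ι y → x ≡ y)
                (κ-injective : ∀ {x y} → κ x ≡ κ y → x ≡ y)
                (f : ∀ a → P a → ∃ λ b → Q b × κ b ≡ ι a)
                (g : ∀ b → Q b → ∃ λ a → P a × ι a ≡ κ b) where

  private
    Σ-≡ : ∀ {X : Set} {R : X → Set} → Irrelevant R → {s t : ∃ R} → proj₁ s ≡ proj₁ t → s ≡ t
    Σ-≡ irr {_ , r} {_ , r′} refl = cong (_ ,_) (irr r r′)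

    forth : ∃ P → ∃ Q
    forth (a , p) = proj₁ (f a p) , proj₁ (proj₂ (f a p))

    back : ∃ Q → ∃ P
    back (b , q) = proj₁ (g b q) , proj₁ (proj₂ (g b q))

  κ-forth : ∀ s → κ (proj₁ (forth s)) ≡ ι (proj₁ s)
  κ-forth (a , p) = proj₂ (proj₂ (f a p))

  ι-back : ∀ t → ι (proj₁ (back t)) ≡ κ (proj₁ t)
  ι-back (b , q) = proj₂ (proj₂ (g b q))

  matching : ∃ P ↔ ∃ Q
  matching = mk↔ₛ′ forth back
    (λ t → Σ-≡ Q-irrelevant (κ-injective (trans (κ-forth (back t)) (ι-back t))))
    (λ s → Σ-≡ P-irrelevant (ι-injective (trans (ι-back (forth s)) (κ-forth s))))

-- Starts, ends, gluing table and choices in the labelled subgraph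

module Labels {G : Digraph} (dd : Is2dd G) {K : Subset (#A G)} (closed : Closed G (_∈ K)) (L : Labelling G K) where

  open TwoDD G dd
  open Labelling L public

  st en : Fin 6 → V G
  st z = src G (fw z)
  en z = tgt G (fw z)

  src-bw : ∀ u → src G (bw (rot (rot u))) ≡ st u
  src-bw u = trans (starts (rot (rot u))) (cong st (rot³ u))

  src-st⁻ : ∀ {a} u → src G a ≡ st u → a ≡ fw u ⊎ a ≡ bw (rot (rot u))
  src-st⁻ {a} u eq with a ≟ fw u
  ... | yes a≡ = inj₁ a≡
  ... | no  a≢ = inj₂ (trans (Src.mate-unique eq a≢) (sym (Src.mate-unique (src-bw u) (fw≢bw _ _ ∘ sym))))

  tgt-en⁻ : ∀ {a} z → tgt G a ≡ en z → a ≡ fw z ⊎ a ≡ bw z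
  tgt-en⁻ {a} z eq with a ≟ fw z
  ... | yes a≡ = inj₁ a≡
  ... | no  a≢ = inj₂ (trans (Tgt.mate-unique eq a≢) (sym (Tgt.mate-unique (sym (ends z)) (fw≢bw _ _ ∘ sym))))

  st-injective : ∀ {u v} → st u ≡ st v → u ≡ v
  st-injective {u} {v} eq with src-st⁻ v eq
  ... | inj₁ e = fw-inj e
  ... | inj₂ e = ⊥-elim (fw≢bw _ _ e)

  en-injective : ∀ {u v} → en u ≡ en v → u ≡ v
  en-injective {u} {v} eq with tgt-en⁻ v eq
  ... | inj₁ e = fw-inj e
  ... | inj₂ e = ⊥-elim (fw≢bw _ _ e)

  src∈ : ∀ {a} → a ∈ K → ∃ λ u → st u ≡ src G a
  src∈ a∈ with cover a∈
  ... | z , inj₁ refl = z , refl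
  ... | z , inj₂ refl = rot z , sym (starts z)

  tgt∈ : ∀ {a} → a ∈ K → ∃ λ z → en z ≡ tgt G a
  tgt∈ a∈ with cover a∈
  ... | z , inj₁ refl = z , refl
  ... | z , inj₂ refl = z , ends z

  src∉ : ∀ {a} u → a ∉ K → st u ≢ src G a
  src∉ u a∉ eq = a∉ (closed (inj₂ eq) (fw∈ u))

  tgt∉ : ∀ {a} z → a ∉ K → en z ≢ tgt G a
  tgt∉ z a∉ eq = a∉ (closed (inj₁ eq) (fw∈ z))

  Glued : Fin 6 → Maybe (Fin 6) → Set
  Glued z nothing  = ∀ u → st u ≢ en z
  Glued z (just u) = st u ≡ en z

  private
    other : ∀ z (f : Fin 3 → Fin 6) → (∀ u → side u ≢ side z → ∃ λ i → f i ≡ u) →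
            ∃ λ (i : Maybe (Fin 3)) → Glued z (Maybe.map f i)
    other z f onto with any? (λ i → st (f i) ≟ en z)
    ... | yes (i , eq) = just i , eq
    ... | no none = nothing , λ u eq → none′ u eq
      where
      none′ : ∀ u → st u ≢ en z
      none′ u eq with side u ≟ side z
      ... | yes same = clean u z same eq
      ... | no  diff with onto u diff
      ...   | i , refl = none (i , eq)

    ontoB : ∀ u → side u ≢ 0F → ∃ λ i → 3 ↑ʳ i ≡ u
    ontoB 0F ne = ⊥-elim (ne refl)
    ontoB 1F ne = ⊥-elim (ne refl)
    ontoB 2F ne = ⊥-elim (ne refl)
    ontoB 3F ne = 0F , refl
    ontoB 4F ne = 1F , refl
    ontoB 5F ne = 2F , refl

    ontoA : ∀ u → side u ≢ 1F → ∃ λ (i : Fin 3) → i ↑ˡ 3 ≡ u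
    ontoA 0F ne = 0F , refl
    ontoA 1F ne = 1F , refl
    ontoA 2F ne = 2F , refl
    ontoA 3F ne = ⊥-elim (ne refl)
    ontoA 4F ne = ⊥-elim (ne refl)
    ontoA 5F ne = ⊥-elim (ne refl)

    toA : ∀ z → side z ≡ 0F → ∃ λ k → Glued z (crossA k)
    toA z s with other z (3 ↑ʳ_) (λ u → ontoB u ∘ subst (side u ≢_) s)
    ... | nothing , g = 0F , g
    ... | just i  , g = suc i , g

    toB : ∀ z → side z ≡ 1F → ∃ λ k → Glued z (crossB k)
    toB z s with other z (λ i → i ↑ˡ 3) (λ u → ontoA u ∘ subst (side u ≢_) s)
    ... | nothing , g = 0F , g
    ... | just i  , g = suc i , g

  glueing : ∃ λ a → ∃ λ b → ∃ λ c → ∃ λ d → ∃ λ e → ∃ λ f → ∀ z → Glued z (lookup (glue a b c d e f) z)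
  glueing with toA 0F refl | toA 1F refl | toA 2F refl | toB 3F refl | toB 4F refl | toB 5F refl
  ... | a , p | b , q | c , r | d , s | e , t | f , w = a , b , c , d , e , f , λ
    { 0F → p ; 1F → q ; 2F → r ; 3F → s ; 4F → t ; 5F → w }

  open Degrees G dd K closed using (isSaturated⁻)

  -- A saturated vertex of `F` is an end and a start at once, hence a glued end; so there are at
  -- least as many glued ends as saturated vertices.
  admissible : ∀ {h} → (∀ z → Glued z (lookup h z)) → 3 ℕ.≤ #saturated (induced G K) → Gluing.Admissible h
  admissible {h} glued enough = injective , ℕₚ.≤-trans enough
    (#-mono (isSaturated? (induced G K)) (Gluing.glued? h) (λ {v} sat → proj₁ (label v sat) , proj₁ (proj₂ (label v sat)))
      λ {v} {w} p q eq → ιV-injective {G} {K} (trans (sym (proj₂ (proj₂ (label v p)))) (trans (cong en eq) (proj₂ (proj₂ (label w q))))))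
    where
    injective : ∀ z z′ → lookup h z ≡ lookup h z′ → lookup h z ≢ nothing → z ≡ z′
    injective z z′ eq ne = same (lookup h z) (lookup h z′) (glued z) (glued z′) eq ne
      where
      same : ∀ m n → Glued z m → Glued z′ n → m ≡ n → m ≢ nothing → z ≡ z′
      same nothing  _         _ _  _    ne = ⊥-elim (ne refl)
      same (just u) (just .u) g g′ refl ne = en-injective (trans (sym g) g′)
    label : ∀ v → IsSaturated (induced G K) v → ∃ λ z → lookup h z ≢ nothing × en z ≡ ιV G K v
    label v sat =
      let (a , a∈ , ta) , (b , b∈ , sb) = isSaturated⁻ v sat
          z , ez = tgt∈ a∈
          u , su = src∈ b∈
      in z , (λ eq → subst (Glued z) eq (glued z) u (trans su (trans sb (sym (trans ez ta))))) , trans ez ta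

  Chosen : Choice → A G → Set
  Chosen c a = ∃ λ z → (fw z ≡ a × arm c z ≡ 0F) ⊎ (bw z ≡ a × arm c z ≡ 1F)

  Follows : Choice → Subset (#A G) → Set
  Follows c S = ∀ {a} → a ∈ K → (a ∈ S → Chosen c a) × (Chosen c a → a ∈ S)

  arm-rot : ∀ c z → arm c (rot z) ≡ arm c z
  arm-rot c 0F = refl
  arm-rot c 1F = refl
  arm-rot c 2F = refl
  arm-rot c 3F = refl
  arm-rot c 4F = refl
  arm-rot c 5F = refl

  chosen-fw⁻ : ∀ c z → Chosen c (fw z) → arm c z ≡ 0F
  chosen-fw⁻ c z (u , inj₁ (e , a)) = subst (λ u → arm c u ≡ 0F) (fw-inj e) a
  chosen-fw⁻ c z (u , inj₂ (e , a)) = ⊥-elim (fw≢bw _ _ (sym e))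

  chosen-bw⁻ : ∀ c z → Chosen c (bw z) → arm c z ≡ 1F
  chosen-bw⁻ c z (u , inj₂ (e , a)) = subst (λ u → arm c u ≡ 1F) (bw-inj e) a
  chosen-bw⁻ c z (u , inj₁ (e , a)) = ⊥-elim (fw≢bw _ _ e)

  chosen? : ∀ c a → Dec (Chosen c a)
  chosen? c a = any? λ z → ((fw z ≟ a) ×-dec (arm c z ≟ 0F)) ⊎-dec ((bw z ≟ a) ×-dec (arm c z ≟ 1F))

  chosenArc : ∀ c u → ∃ λ a → a ∈ K × Chosen c a × src G a ≡ st u × tgt G a ≡ en (head c u)
  chosenArc c u with arm c u in eq
  ... | 0F = fw u , fw∈ u , (u , inj₁ (refl , eq)) , refl , refl
  ... | 1F = bw (rot (rot u)) , bw∈ _ , (rot (rot u) , inj₂ (refl , trans (arm-rot c (rot u)) (trans (arm-rot c u) eq)))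
           , src-bw u , sym (ends _)

  chosen⁻ : ∀ c {a} → Chosen c a → ∃ λ u → src G a ≡ st u × tgt G a ≡ en (head c u)
  chosen⁻ c (z , inj₁ (refl , eq)) = z , refl , cong (λ i → en (turn rot (i ↑ˡ 1) z)) (sym eq)
  chosen⁻ c (z , inj₂ (refl , eq)) = rot z , starts z , trans (sym (ends z))
    (trans (cong en (sym (rot³ z))) (cong (λ i → en (turn rot (i ↑ˡ 1) (rot z))) (sym (trans (arm-rot c z) eq))))

  -- One forward arc of each hexagon determines the choice, because alternation carries membership
  -- from `fw z` over `bw z` to `fw (rot z)`.
  follows : ∀ {S} → Alternating G S → ∃ λ c → Follows c S
  follows {S} alt = c , λ {a} a∈K → into a∈K , from-chosen
    where
    up : ∀ z → fw z ∈ S → fw (rot z) ∈ S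
    up z f∈ = proj₂ (alt (fw≢bw (rot z) z ∘ sym) (inj₂ (starts z))) (proj₁ (alt (fw≢bw z z) (inj₁ (ends z))) f∈)
    first-of : ∀ z → Dec (fw z ∈ S) → Fin 2
    first-of z (yes _) = 0F
    first-of z (no _)  = 1F
    c : Choice
    c = first-of 0F (fw 0F ∈? S) , first-of 3F (fw 3F ∈? S)
    down : ∀ z → fw z ∉ S → fw (rot z) ∉ S
    down z f∉ = proj₁ (alt (fw≢bw (rot z) z ∘ sym) (inj₂ (starts z))) (proj₂ (alt (fw≢bw z z) (inj₁ (ends z))) f∉)
    Good : Fin 6 → Fin 2 → Set
    Good z 0F = fw z ∈ S
    Good z 1F = fw z ∉ S
    rotate : ∀ z i → Good z i → Good (rot z) i
    rotate z 0F = up z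
    rotate z 1F = down z
    begin-with : ∀ z (d : Dec (fw z ∈ S)) → Good z (first-of z d)
    begin-with z (yes f∈) = f∈
    begin-with z (no f∉)  = f∉
    good : ∀ z → Good z (arm c z)
    good 0F = begin-with 0F (fw 0F ∈? S)
    good 1F = rotate 0F _ (good 0F)
    good 2F = rotate 1F _ (rotate 0F _ (good 0F))
    good 3F = begin-with 3F (fw 3F ∈? S)
    good 4F = rotate 3F _ (good 3F)
    good 5F = rotate 4F _ (rotate 3F _ (good 3F))
    fw∈S : ∀ z → arm c z ≡ 0F → fw z ∈ S
    fw∈S z eq = subst (Good z) eq (good z)
    fw∉S : ∀ z → arm c z ≡ 1F → fw z ∉ S
    fw∉S z eq = subst (Good z) eq (good z)
    from-chosen : ∀ {a} → Chosen c a → a ∈ S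
    from-chosen (z , inj₁ (refl , eq)) = fw∈S z eq
    from-chosen (z , inj₂ (refl , eq)) = proj₂ (alt (fw≢bw z z) (inj₁ (ends z))) (fw∉S z eq)
    into : ∀ {a} → a ∈ K → a ∈ S → Chosen c a
    into a∈K a∈S with cover a∈K
    ... | z , inj₁ refl with arm c z in eq
    ...   | 0F = z , inj₁ (refl , eq)
    ...   | 1F = ⊥-elim (fw∉S z eq a∈S)
    into a∈K a∈S | z , inj₂ refl with arm c z in eq
    ...   | 0F = ⊥-elim (proj₁ (alt (fw≢bw z z) (inj₁ (ends z))) (fw∈S z eq) a∈S)
    ...   | 1F = z , inj₂ (refl , eq)

-- Construction of `G′`

module Replace {G : Digraph} (dd : Is2dd G) {K : Subset (#A G)} (closed : Closed G (_∈ K)) (L : Labelling G K)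
               (six : AllAltCyclesHave6Arcs G)
               {h : Partial 6 6} (glued : ∀ z → Labels.Glued dd closed L z (lookup h z))
               {x y : Vec (Fin 6) 3} (embeds : Gluing.Candidate.Embeds h x y) where

  open TwoDD G dd
  open Labels dd closed L
  open Gluing h using (IsSource; isSource?)

  X Y : Fin 3 → Fin 6
  X = lookup x
  Y = lookup y

  X-injective : ∀ {i j} → X i ≡ X j → i ≡ j
  X-injective {i} {j} = proj₁ embeds i j

  Y-injective : ∀ {i j} → Y i ≡ Y j → i ≡ j
  Y-injective {i} {j} = proj₁ (proj₂ embeds) i j

  source-X : ∀ u → IsSource u → ∃ λ i → X i ≡ u
  source-X = proj₁ (proj₂ (proj₂ embeds))

  sink-Y : ∀ z → lookup h z ≡ nothing → ∃ λ i → Y i ≡ z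
  sink-Y = proj₁ (proj₂ (proj₂ (proj₂ embeds)))

  glued-X⇒Y : ∀ z i → lookup h z ≡ just (X i) → ∃ λ j → Y j ≡ z
  glued-X⇒Y = proj₁ (proj₂ (proj₂ (proj₂ (proj₂ embeds))))

  glued-Y⇒X : ∀ i u → lookup h (Y i) ≡ just u → ∃ λ j → X j ≡ u
  glued-Y⇒X = proj₂ (proj₂ (proj₂ (proj₂ (proj₂ embeds))))

  glued-just : ∀ {z u} → lookup h z ≡ just u → st u ≡ en z
  glued-just {z} eq = subst (Glued z) eq (glued z)

  glued-nothing : ∀ {z} → lookup h z ≡ nothing → ∀ u → st u ≢ en z
  glued-nothing {z} eq = subst (Glued z) eq (glued z)

  glued-st : ∀ {z u} → st u ≡ en z → lookup h z ≡ just u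
  glued-st {z} {u} eq with lookup h z in eqh
  ... | nothing = ⊥-elim (glued-nothing eqh u eq)
  ... | just v  = cong just (st-injective (trans (glued-just eqh) (sym eq)))

  ≢en⇒source : ∀ {u} → (∀ z → en z ≢ st u) → IsSource u
  ≢en⇒source ne z eq = ne z (sym (glued-just eq))

  -- An end outside `Y` is glued by `sink-Y`, and by `glued-X⇒Y` the start it is glued to lies
  -- outside `X`. Such a vertex loses all its arcs; every other vertex of `G` is a vertex of `G′`.
  Removed Kept : V G → Set
  Removed v = ∃ λ z → en z ≡ v × (∀ i → Y i ≢ z)
  Kept v = ¬ Removed v

  kept? : ∀ v → Dec (Kept v)
  kept? v = ¬? (any? λ z → (en z ≟ v) ×-dec all? λ i → ¬? (Y i ≟ z))

  kept-en : ∀ i → Kept (en (Y i))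
  kept-en i (z , eq , ne) = ne i (sym (en-injective eq))

  kept-st : ∀ i → Kept (st (X i))
  kept-st i (z , eq , ne) with glued-X⇒Y z i (glued-st (sym eq))
  ... | j , Yj = ne j Yj

  kept-old-tgt : ∀ {a} → a ∉ K → Kept (tgt G a)
  kept-old-tgt a∉ (z , eq , _) = tgt∉ z a∉ eq

  kept-old-src : ∀ {a} → a ∉ K → Kept (src G a)
  kept-old-src a∉ (z , eq , ne) with lookup h z in eqh
  ... | nothing = let i , Yi = sink-Y z eqh in ne i Yi
  ... | just u  = src∉ u a∉ (trans (glued-just eqh) eq)

  Y-kept : ∀ {z} → Kept (en z) → ∃ λ i → Y i ≡ z
  Y-kept {z} kept with any? (λ i → Y i ≟ z)
  ... | yes p = p
  ... | no  n = ⊥-elim (kept (z , refl , λ i eq → n (i , eq)))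

  X-kept : ∀ {u} → Kept (st u) → ∃ λ i → X i ≡ u
  X-kept {u} kept with any? (λ z → en z ≟ st u)
  ... | no none = source-X u (≢en⇒source λ z eq → none (z , eq))
  ... | yes (z , eq) with Y-kept {z} (subst Kept (sym eq) kept)
  ...   | i , refl = glued-Y⇒X i u (glued-st (sym eq))

  n̄ : ℕ
  n̄ = #[ (_∈? ∁ K) ]

  Arc : Set
  Arc = Fin n̄ ⊎ (Fin 3 ⊎ Fin 3)

  view : Fin (n̄ + 6) → Arc
  view = Sum.map₂ (splitAt 3) ∘ splitAt n̄

  mk : Arc → Fin (n̄ + 6)
  mk (inj₁ c) = c ↑ˡ 6
  mk (inj₂ s) = n̄ ↑ʳ join 3 3 s

  view-mk : ∀ s → view (mk s) ≡ s
  view-mk (inj₁ c) = cong (Sum.map₂ (splitAt 3)) (splitAt-↑ˡ n̄ c 6)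
  view-mk (inj₂ s) = trans (cong (Sum.map₂ (splitAt 3)) (splitAt-↑ʳ n̄ 6 (join 3 3 s))) (cong inj₂ (splitAt-join 3 3 s))

  mk-view : ∀ a → mk (view a) ≡ a
  mk-view a = trans (lemma (splitAt n̄ a)) (join-splitAt n̄ 6 a)
    where
    lemma : ∀ s → mk (Sum.map₂ (splitAt 3) s) ≡ join n̄ 6 s
    lemma (inj₁ c) = refl
    lemma (inj₂ j) = cong (n̄ ↑ʳ_) (join-splitAt 3 3 j)

  mk-injective : ∀ {s t} → mk s ≡ mk t → s ≡ t
  mk-injective {s} {t} eq = trans (sym (view-mk s)) (trans (cong view eq) (view-mk t))

  pattern oldArc c = inj₁ c
  pattern fwdArc i = inj₂ (inj₁ i)
  pattern bwdArc i = inj₂ (inj₂ i)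

  old : Fin n̄ → A G
  old = ιA G (∁ K)

  old∉ : ∀ c → old c ∉ K
  old∉ c = x∈∁p⇒x∉p (Induced.ιA∈K G (∁ K) c)

  index : ∀ {a} → a ∉ K → Fin n̄
  index a∉ = arcIn {G} {∁ K} (x∉p⇒x∈∁p a∉)

  old-index : ∀ {a} (a∉ : a ∉ K) → old (index a∉) ≡ a
  old-index a∉ = ιA-arcIn {G} {∁ K} (x∉p⇒x∈∁p a∉)

  old-injective : ∀ {c d} → old c ≡ old d → c ≡ d
  old-injective = ιA-injective {G} {∁ K}

  from→ to→ : Arc → V G
  from→ (oldArc c) = src G (old c)
  from→ (fwdArc i) = st (X i)
  from→ (bwdArc i) = st (X (next i))
  to→ (oldArc c) = tgt G (old c)
  to→ (fwdArc i) = en (Y i)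
  to→ (bwdArc i) = en (Y i)

  from→-kept : ∀ s → Kept (from→ s)
  from→-kept (oldArc c) = kept-old-src (old∉ c)
  from→-kept (fwdArc i) = kept-st i
  from→-kept (bwdArc i) = kept-st (next i)

  to→-kept : ∀ s → Kept (to→ s)
  to→-kept (oldArc c) = kept-old-tgt (old∉ c)
  to→-kept (fwdArc i) = kept-en i
  to→-kept (bwdArc i) = kept-en i

  G′ : Digraph
  G′ = record
    { #V = #[ kept? ]
    ; #A = n̄ + 6
    ; src = λ a → rank kept? (from→-kept (view a))
    ; tgt = λ a → rank kept? (to→-kept (view a))
    }

  ι′ : V G′ → V G
  ι′ = enum kept?

  ι′-injective : ∀ {u v} → ι′ u ≡ ι′ v → u ≡ v
  ι′-injective = enum-injective kept?

  ι′-src : ∀ a → ι′ (src G′ a) ≡ from→ (view a)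
  ι′-src a = enum-rank kept? (from→-kept (view a))

  ι′-tgt : ∀ a → ι′ (tgt G′ a) ≡ to→ (view a)
  ι′-tgt a = enum-rank kept? (to→-kept (view a))

  ι′-src-mk : ∀ s → ι′ (src G′ (mk s)) ≡ from→ s
  ι′-src-mk s = trans (ι′-src (mk s)) (cong from→ (view-mk s))

  ι′-tgt-mk : ∀ s → ι′ (tgt G′ (mk s)) ≡ to→ s
  ι′-tgt-mk s = trans (ι′-tgt (mk s)) (cong to→ (view-mk s))

  private
    Two : (Arc → V G) → V G → Set
    Two f w = ∃₂ λ s t → s ≢ t × f s ≡ w × f t ≡ w × (∀ r → f r ≡ w → r ≡ s ⊎ r ≡ t)

    count : (f : Arc → V G) (g : A G′ → V G′) → (∀ a → ι′ (g a) ≡ f (view a)) →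
            ∀ v → Two f (ι′ v) → #[ (λ a → g a ≟ v) ] ≡ 2
    count f g ι′-g v (s , t , s≢t , fs , ft , only) = #≡2⁺ (λ a → g a ≟ v) (s≢t ∘ mk-injective) (at s fs) (at t ft)
      λ a ga → Sum.map (back a) (back a) (only (view a) (trans (sym (ι′-g a)) (cong ι′ ga)))
      where
      at : ∀ s → f s ≡ ι′ v → g (mk s) ≡ v
      at s fs = ι′-injective (trans (ι′-g (mk s)) (trans (cong f (view-mk s)) fs))
      back : ∀ a {s} → view a ≡ s → a ≡ mk s
      back a eq = trans (sym (mk-view a)) (cong mk eq)

    oldTwo : (f : Arc → V G) (g : A G → V G) (two : ∀ v → #[ (λ a → g a ≟ v) ] ≡ 2) →
             (∀ c → f (oldArc c) ≡ g (old c)) → ∀ w → (∀ a → g a ≡ w → a ∉ K) → (∀ s → f (inj₂ s) ≢ w) → Two f w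
    oldTwo f g two f-old w all∉ new≢ with #≡2⁻ (λ a → g a ≟ w) (two w)
    ... | a , b , a≢b , ga , gb , only = oldArc (index a∉) , oldArc (index b∉)
        , (λ { eq → a≢b (trans (sym (old-index a∉)) (trans (cong old (inj₁-inj eq)) (old-index b∉))) })
        , trans (f-old _) (trans (cong g (old-index a∉)) ga)
        , trans (f-old _) (trans (cong g (old-index b∉)) gb)
        , λ { (oldArc c) e → Sum.map (λ q → cong inj₁ (old-injective (trans q (sym (old-index a∉)))))
                                     (λ q → cong inj₁ (old-injective (trans q (sym (old-index b∉)))))
                                     (only (old c) (trans (sym (f-old c)) e))
            ; (inj₂ s) e → ⊥-elim (new≢ s e) }
      where
      a∉ : a ∉ K
      a∉ = all∉ a ga
      b∉ : b ∉ K
      b∉ = all∉ b gb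
      inj₁-inj : ∀ {c d : Fin n̄} {B : Set} → inj₁ {B = B} c ≡ inj₁ d → c ≡ d
      inj₁-inj refl = refl

    inNew : ∀ {w} i → en (Y i) ≡ w → Two to→ w
    inNew {w} i e = fwdArc i , bwdArc i , (λ ()) , e , e , only
      where
      only : ∀ r → to→ r ≡ w → r ≡ fwdArc i ⊎ r ≡ bwdArc i
      only (oldArc c) t = ⊥-elim (tgt∉ (Y i) (old∉ c) (trans e (sym t)))
      only (fwdArc j) t = inj₁ (cong (λ j → fwdArc j) (Y-injective (en-injective (trans t (sym e)))))
      only (bwdArc j) t = inj₂ (cong (λ j → bwdArc j) (Y-injective (en-injective (trans t (sym e)))))

    inTwo : ∀ {w} → Kept w → Dec (∃ λ z → en z ≡ w) → Two to→ w
    inTwo {w} kept (no none) = oldTwo to→ (tgt G) (proj₁ ∘ dd) (λ _ → refl) w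
      (λ a ta a∈ → let z , e = tgt∈ a∈ in none (z , trans e ta))
      λ { (inj₁ i) e → none (Y i , e) ; (inj₂ i) e → none (Y i , e) }
    inTwo kept (yes (z , refl)) = let i , Yi = Y-kept {z} kept in inNew i (cong en Yi)

    outNew : ∀ {w} i → st (X (next i)) ≡ w → Two from→ w
    outNew {w} i e = fwdArc (next i) , bwdArc i , (λ ()) , e , e , only
      where
      only : ∀ r → from→ r ≡ w → r ≡ fwdArc (next i) ⊎ r ≡ bwdArc i
      only (oldArc c) s = ⊥-elim (src∉ (X (next i)) (old∉ c) (trans e (sym s)))
      only (fwdArc j) s = inj₁ (cong (λ j → fwdArc j) (X-injective (st-injective (trans s (sym e)))))
      only (bwdArc j) s = inj₂ (cong (λ j → bwdArc j) (next-injective (X-injective (st-injective (trans s (sym e))))))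

    outTwo : ∀ {w} → Kept w → Dec (∃ λ u → st u ≡ w) → Two from→ w
    outTwo {w} kept (no none) = oldTwo from→ (src G) (proj₂ ∘ dd) (λ _ → refl) w
      (λ a sa a∈ → let u , e = src∈ a∈ in none (u , trans e sa))
      λ { (inj₁ i) e → none (X i , e) ; (inj₂ i) e → none (X (next i) , e) }
    outTwo kept (yes (u , refl)) =
      let i , Xi = X-kept {u} kept
          j , ji = next-surjective i
      in outNew j (cong st (trans (cong X ji) Xi))

  -- The two in-arcs of a kept vertex either both lie outside `K` and survive, or both lie in `K`
  -- and give way to one forward and one backward new arc. The same holds for its out-arcs.
  dd′ : Is2dd G′
  dd′ v = count to→ (tgt G′) ι′-tgt v (inTwo (enum-satisfies kept? v) (any? λ z → en z ≟ ι′ v))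
        , count from→ (src G′) ι′-src v (outTwo (enum-satisfies kept? v) (any? λ u → st u ≟ ι′ v))

  newCycle : AltCycle G′
  newCycle = record
    { r = 3
    ; r≢0 = _
    ; fwd = mk ∘ fwdArc
    ; bwd = mk ∘ bwdArc
    ; fwd-inj = λ eq → fwdArc-injective (mk-injective eq)
    ; bwd-inj = λ eq → bwdArc-injective (mk-injective eq)
    ; fwd≢bwd = λ i j eq → fwd≢bwd′ (mk-injective eq)
    ; common-end = λ i → ι′-injective (trans (ι′-tgt-mk (fwdArc i)) (sym (ι′-tgt-mk (bwdArc i))))
    ; common-start = λ i → ι′-injective (trans (ι′-src-mk (bwdArc i)) (sym (ι′-src-mk (fwdArc (next i)))))
    }
    where
    fwdArc-injective : ∀ {i j} → _≡_ {A = Arc} (fwdArc i) (fwdArc j) → i ≡ j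
    fwdArc-injective refl = refl
    bwdArc-injective : ∀ {i j} → _≡_ {A = Arc} (bwdArc i) (bwdArc j) → i ≡ j
    bwdArc-injective refl = refl
    fwd≢bwd′ : ∀ {i j} → _≢_ {A = Arc} (fwdArc i) (bwdArc j)
    fwd≢bwd′ ()

  newCycle-∋ : ∀ s → newCycle ∋ mk (inj₂ s)
  newCycle-∋ (inj₁ i) = i , inj₁ refl
  newCycle-∋ (inj₂ i) = i , inj₂ refl

  IsNew : A G′ → Set
  IsNew a = ∃ λ s → view a ≡ inj₂ s

  isNew? : ∀ a → Dec (IsNew a)
  isNew? a with view a
  ... | inj₁ c = no λ ()
  ... | inj₂ s = yes (s , refl)

  K′ : Subset (#A G′)
  K′ = subset isNew?

  new∈ : ∀ s → mk (inj₂ s) ∈ K′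
  new∈ s = subset⁺ isNew? (s , view-mk (inj₂ s))

  old∉′ : ∀ c → mk (inj₁ c) ∉ K′
  old∉′ c c∈ with subset⁻ isNew? c∈
  ... | s , eq with trans (sym eq) (view-mk (inj₁ c))
  ...   | ()

  newCycle⊇ : ∀ {a} → a ∈ K′ → newCycle ∋ a
  newCycle⊇ {a} a∈ with subset⁻ isNew? a∈
  ... | s , eq = subst (newCycle ∋_) (trans (cong mk (sym eq)) (mk-view a)) (newCycle-∋ s)

  newCycle⊆ : ∀ {a} → newCycle ∋ a → a ∈ K′
  newCycle⊆ (i , inj₁ refl) = new∈ (inj₁ i)
  newCycle⊆ (i , inj₂ refl) = new∈ (inj₂ i)

  module G′ = TwoDD G′ dd′

  closed′ : Closed G′ (_∈ K′)
  closed′ same a∈ = newCycle⊆ (G′.altCycle-closed newCycle same (newCycle⊇ a∈))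

  six′ : AllAltCyclesHave6Arcs G′
  six′ = G′.allHexagons λ a → subst (λ a → ∃ λ (C : AltCycle G′) → C ∋ a × AC.#arcs C ≡ 6) (mk-view a) (through (view a))
    where
    through : ∀ s → ∃ λ (C : AltCycle G′) → C ∋ mk s × AC.#arcs C ≡ 6
    through (inj₂ s) = newCycle , newCycle-∋ s , refl
    -- The alternating cycle of `G` through an arc outside `K` stays outside `K`, so it survives arc
    -- by arc.
    through (inj₁ c) with altCycleThrough (old c)
    ... | C , C∋c = record
        { r = AC.r C
        ; r≢0 = AC.r≢0 C
        ; fwd = f
        ; bwd = b
        ; fwd-inj = λ {i} {j} eq → AC.fwd-inj C (trans (sym (old-index (f∉ i))) (trans (cong old (inj₁-inj (mk-injective eq))) (old-index (f∉ j))))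
        ; bwd-inj = λ {i} {j} eq → AC.bwd-inj C (trans (sym (old-index (b∉ i))) (trans (cong old (inj₁-inj (mk-injective eq))) (old-index (b∉ j))))
        ; fwd≢bwd = λ i j eq → AC.fwd≢bwd C i j (trans (sym (old-index (f∉ i))) (trans (cong old (inj₁-inj (mk-injective eq))) (old-index (b∉ j))))
        ; common-end = λ i → ι′-injective (trans (ι′-tgt-mk (inj₁ (index (f∉ i)))) (trans (cong (tgt G) (old-index (f∉ i)))
            (trans (AC.common-end C i) (sym (trans (ι′-tgt-mk (inj₁ (index (b∉ i)))) (cong (tgt G) (old-index (b∉ i))))))))
        ; common-start = λ i → ι′-injective (trans (ι′-src-mk (inj₁ (index (b∉ i)))) (trans (cong (src G) (old-index (b∉ i)))
            (trans (AC.common-start C i) (sym (trans (ι′-src-mk (inj₁ (index (f∉ (next i))))) (cong (src G) (old-index (f∉ (next i)))))))))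
        } , at C∋c , six C
      where
      C∌ : ∀ {a} → C ∋ a → a ∉ K
      C∌ C∋a = x∈∁p⇒x∉p (closed-along {G} {_∈ ∁ K} (∁-closed {G} {K} closed) C C∋c (x∉p⇒x∈∁p (old∉ c)) C∋a)
      f∉ : ∀ i → AC.fwd C i ∉ K
      f∉ i = C∌ (i , inj₁ refl)
      b∉ : ∀ i → AC.bwd C i ∉ K
      b∉ i = C∌ (i , inj₂ refl)
      f b : Fin (AC.r C) → A G′
      f i = mk (inj₁ (index (f∉ i)))
      b i = mk (inj₁ (index (b∉ i)))
      inj₁-inj : ∀ {c d : Fin n̄} {B : Set} → inj₁ {B = B} c ≡ inj₁ d → c ≡ d
      inj₁-inj refl = refl
      at : C ∋ old c → ∃ λ i → f i ≡ mk (inj₁ c) ⊎ b i ≡ mk (inj₁ c)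
      at (i , inj₁ e) = i , inj₁ (cong (mk ∘ inj₁) (old-injective (trans (old-index (f∉ i)) e)))
      at (i , inj₂ e) = i , inj₂ (cong (mk ∘ inj₁) (old-injective (trans (old-index (b∉ i)) e)))

  -- `G′` as a replacement of `F` by the hexagon `F′`

  F F̄ F′ : Digraph
  F  = induced G K
  F̄  = induced G (∁ K)
  F′ = induced G′ K′

  oneAltCycle : #AltCycles≡ F′ 1
  oneAltCycle = (λ _ → N) , (λ { {0F} {0F} _ → refl }) , λ C → 0F , λ { refl a → mk⇔ (into C) (onto C) }
    where
    open Restrict {G′} {K′} newCycle newCycle⊆ renaming (restrict to N)
    onto : ∀ C {a} → C ∋ a → N ∋ a
    onto C {a} C∋a = restrict-∋ (newCycle⊇ (Induced.ιA∈K G′ K′ a))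
    into : ∀ (C : AltCycle F′) {a} → N ∋ a → C ∋ a
    into C {a} N∋a = lift-∋⁻ {G′} {K′} C (G′.altCycle-meet newCycle (lift C) meet (lift-∋⁺ {G′} {K′} C (i , inj₁ refl)) (restrict-∋⁻ N∋a))
      where
      i : Fin (AC.r C)
      i = first (AC.r≢0 C)
      meet : newCycle ∋ ιA G′ K′ (AC.fwd C i)
      meet = newCycle⊇ (Induced.ιA∈K G′ K′ _)

  private
    module D  = Degrees G dd K closed
    module D̄  = Degrees G dd (∁ K) (∁-closed {G} {K} closed)
    module D′ = Degrees G′ dd′ K′ closed′

  κ : V F′ → V G
  κ = ι′ ∘ ιV G′ K′

  κ-injective : ∀ {u v} → κ u ≡ κ v → u ≡ v
  κ-injective {u} {v} eq = ιV-injective {G′} {K′} {u} {v} (ι′-injective {ιV G′ K′ u} {ιV G′ K′ v} eq)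

  ῑ : V F̄ → V G
  ῑ = ιV G (∁ K)

  private
    in′⇒in : ∀ {v} → D′.In v → D.In (ι′ v)
    in′⇒in {v} (a , a∈ , ta) =
      let s , eq = subset⁻ isNew? a∈
          z , ez = new-to s
      in fw z , fw∈ z , trans ez (trans (sym (trans (ι′-tgt a) (cong to→ eq))) (cong ι′ ta))
      where
      new-to : ∀ s → ∃ λ z → en z ≡ to→ (inj₂ s)
      new-to (inj₁ i) = Y i , refl
      new-to (inj₂ i) = Y i , refl

    out′⇒out : ∀ {v} → D′.Out v → D.Out (ι′ v)
    out′⇒out {v} (a , a∈ , sa) =
      let s , eq = subset⁻ isNew? a∈
          u , su = new-from s
      in fw u , fw∈ u , trans su (trans (sym (trans (ι′-src a) (cong from→ eq))) (cong ι′ sa))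
      where
      new-from : ∀ s → ∃ λ u → st u ≡ from→ (inj₂ s)
      new-from (inj₁ i) = X i , refl
      new-from (inj₂ i) = X (next i) , refl

    in⇒in′ : ∀ {v} → D.In (ι′ v) → D′.In v
    in⇒in′ {v} (a , a∈ , ta) =
      let z , ez = tgt∈ a∈
          i , Yi = Y-kept {z} (subst Kept (sym (trans ez ta)) (enum-satisfies kept? v))
      in mk (fwdArc i) , new∈ (inj₁ i) , ι′-injective (trans (ι′-tgt-mk (fwdArc i)) (trans (cong en Yi) (trans ez ta)))

    out⇒out′ : ∀ {v} → D.Out (ι′ v) → D′.Out v
    out⇒out′ {v} (a , a∈ , sa) =
      let u , su = src∈ a∈
          i , Xi = X-kept {u} (subst Kept (sym (trans su sa)) (enum-satisfies kept? v))
      in mk (fwdArc i) , new∈ (inj₁ i) , ι′-injective (trans (ι′-src-mk (fwdArc i)) (trans (cong st Xi) (trans su sa)))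

    in̄⇒¬in : ∀ {w} → D̄.In w → ¬ D.In w
    in̄⇒¬in (a , a∈ , ta) (b , b∈ , tb) = x∈∁p⇒x∉p a∈ (closed (inj₁ (trans tb (sym ta))) b∈)

    out̄⇒¬out : ∀ {w} → D̄.Out w → ¬ D.Out w
    out̄⇒¬out (a , a∈ , sa) (b , b∈ , sb) = x∈∁p⇒x∉p a∈ (closed (inj₂ (trans sb (sym sa))) b∈)

    ¬in⇒in̄ : ∀ {w} → ¬ D.In w → D̄.In w
    ¬in⇒in̄ {w} ¬i = let a , ta = Tgt.preimage w in a , x∉p⇒x∈∁p (λ a∈ → ¬i (a , a∈ , ta)) , ta

    ¬out⇒out̄ : ∀ {w} → ¬ D.Out w → D̄.Out w
    ¬out⇒out̄ {w} ¬o = let a , sa = Src.preimage w in a , x∉p⇒x∈∁p (λ a∈ → ¬o (a , a∈ , sa)) , sa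

    ¬in̄⇒in : ∀ {w} → ¬ D̄.In w → D.In w
    ¬in̄⇒in {w} ¬ī with D.in? w
    ... | yes i = i
    ... | no ¬i = ⊥-elim (¬ī (¬in⇒in̄ ¬i))

    ¬out̄⇒out : ∀ {w} → ¬ D̄.Out w → D.Out w
    ¬out̄⇒out {w} ¬ō with D.out? w
    ... | yes o = o
    ... | no ¬o = ⊥-elim (¬ō (¬out⇒out̄ ¬o))

    ¬in⇒kept : ∀ {w} → ¬ D.In w → Kept w
    ¬in⇒kept ¬i (z , e , _) = ¬i (fw z , fw∈ z , e)

    ¬out⇒kept : ∀ {w} → ¬ D.Out w → Kept w
    ¬out⇒kept ¬o (z , e , ne) with lookup h z in eqh
    ... | nothing = let i , Yi = sink-Y z eqh in ne i Yi
    ... | just u  = ¬o (fw u , fw∈ u , trans (glued-just eqh) e)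

    vertexF′ : ∀ {w} → Kept w → D.In w ⊎ D.Out w → ∃ λ v → κ v ≡ w
    vertexF′ {w} kept io =
      let v , e = D′.vertexIn {rank kept? kept}
            (Sum.map (λ i → in⇒in′ (subst D.In (sym (enum-rank kept? kept)) i))
                     (λ o → out⇒out′ (subst D.Out (sym (enum-rank kept? kept)) o)) io)
      in v , trans (cong ι′ e) (enum-rank kept? kept)

    vertexF̄ : ∀ {w} → ¬ D.In w ⊎ ¬ D.Out w → ∃ λ v → ῑ v ≡ w
    vertexF̄ = D̄.vertexIn ∘ Sum.map ¬in⇒in̄ ¬out⇒out̄

    -- The common description in terms of `G`: the first one fits entries of `F′` and exits of the
    -- complement, the second one exits of `F′` and entries of the complement.
    EntryLike ExitLike : V G → Set
    EntryLike w = ¬ D.In w × D.Out w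
    ExitLike  w = D.In w × ¬ D.Out w

    entryF′⁺ : ∀ v → EntryLike (κ v) → IsEntry F′ v
    entryF′⁺ v (¬i , o) = D′.isEntry⁺ v (¬i ∘ in′⇒in) (out⇒out′ o)

    entryF′⁻ : ∀ v → IsEntry F′ v → EntryLike (κ v)
    entryF′⁻ v p = let ¬i , o = D′.isEntry⁻ v p in ¬i ∘ in⇒in′ , out′⇒out o

    exitF′⁺ : ∀ v → ExitLike (κ v) → IsExit F′ v
    exitF′⁺ v (i , ¬o) = D′.isExit⁺ v (in⇒in′ i) (¬o ∘ out′⇒out)

    exitF′⁻ : ∀ v → IsExit F′ v → ExitLike (κ v)
    exitF′⁻ v p = let i , ¬o = D′.isExit⁻ v p in in′⇒in i , ¬o ∘ out⇒out′

    exitF̄⁺ : ∀ v → EntryLike (ῑ v) → IsExit F̄ v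
    exitF̄⁺ v (¬i , o) = D̄.isExit⁺ v (¬in⇒in̄ ¬i) λ ō → out̄⇒¬out ō o

    exitF̄⁻ : ∀ v → IsExit F̄ v → EntryLike (ῑ v)
    exitF̄⁻ v p = let i , ¬o = D̄.isExit⁻ v p in in̄⇒¬in i , ¬out̄⇒out ¬o

    entryF̄⁺ : ∀ v → ExitLike (ῑ v) → IsEntry F̄ v
    entryF̄⁺ v (i , ¬o) = D̄.isEntry⁺ v (λ ī → in̄⇒¬in ī i) (¬out⇒out̄ ¬o)

    entryF̄⁻ : ∀ v → IsEntry F̄ v → ExitLike (ῑ v)
    entryF̄⁻ v p = let ¬i , o = D̄.isEntry⁻ v p in ¬in̄⇒in ¬i , out̄⇒¬out o

    F̄-exit⇒F′-entry : ∀ v → IsExit F̄ v → ∃ λ u → IsEntry F′ u × κ u ≡ ῑ v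
    F̄-exit⇒F′-entry v p =
      let ¬i , o = exitF̄⁻ v p
          u , e = vertexF′ (¬in⇒kept ¬i) (inj₂ o)
      in u , entryF′⁺ u (subst EntryLike (sym e) (¬i , o)) , e

    F′-entry⇒F̄-exit : ∀ u → IsEntry F′ u → ∃ λ v → IsExit F̄ v × ῑ v ≡ κ u
    F′-entry⇒F̄-exit u p =
      let ¬i , o = entryF′⁻ u p
          v , e = vertexF̄ (inj₁ ¬i)
      in v , exitF̄⁺ v (subst EntryLike (sym e) (¬i , o)) , e

    F′-exit⇒F̄-entry : ∀ u → IsExit F′ u → ∃ λ v → IsEntry F̄ v × ῑ v ≡ κ u
    F′-exit⇒F̄-entry u p =
      let i , ¬o = exitF′⁻ u p
          v , e = vertexF̄ (inj₂ ¬o)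
      in v , entryF̄⁺ v (subst ExitLike (sym e) (i , ¬o)) , e

    F̄-entry⇒F′-exit : ∀ v → IsEntry F̄ v → ∃ λ u → IsExit F′ u × κ u ≡ ῑ v
    F̄-entry⇒F′-exit v p =
      let i , ¬o = entryF̄⁻ v p
          u , e = vertexF′ (¬out⇒kept ¬o) (inj₁ i)
      in u , exitF′⁺ u (subst ExitLike (sym e) (i , ¬o)) , e

    F′-exit⇒F-exit : ∀ u → IsExit F′ u → ∃ λ v → IsExit F v × ιV G K v ≡ κ u
    F′-exit⇒F-exit u p =
      let i , ¬o = exitF′⁻ u p
          v , e = D.vertexIn (inj₁ i)
      in v , D.isExit⁺ v (subst D.In (sym e) i) (¬o ∘ subst D.Out e) , e

    F-exit⇒F′-exit : ∀ v → IsExit F v → ∃ λ u → IsExit F′ u × κ u ≡ ιV G K v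
    F-exit⇒F′-exit v p =
      let i , ¬o = D.isExit⁻ v p
          u , e = vertexF′ (¬out⇒kept ¬o) (inj₁ i)
      in u , exitF′⁺ u (subst ExitLike (sym e) (i , ¬o)) , e

    module Mα = Matching {P = IsExit F̄} {Q = IsEntry F′} (isExit-irrelevant F̄) (isEntry-irrelevant F′)
      ῑ κ (ιV-injective {G} {∁ K}) κ-injective F̄-exit⇒F′-entry F′-entry⇒F̄-exit

    module Mβ = Matching {P = IsExit F′} {Q = IsEntry F̄} (isExit-irrelevant F′) (isEntry-irrelevant F̄)
      κ ῑ κ-injective (ιV-injective {G} {∁ K}) F′-exit⇒F̄-entry F̄-entry⇒F′-exit

    module Mγ = Matching {P = IsExit F′} {Q = IsExit F} (isExit-irrelevant F′) (isExit-irrelevant F)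
      κ (ιV G K) κ-injective (ιV-injective {G} {K}) F′-exit⇒F-exit F-exit⇒F′-exit

  abstract
    α : Exit F̄ ↔ Entry F′
    α = Mα.matching

    κ-α : ∀ s → κ (proj₁ (Inverse.to α s)) ≡ ῑ (proj₁ s)
    κ-α = Mα.κ-forth

    β : Exit F′ ↔ Entry F̄
    β = Mβ.matching

    ῑ-β : ∀ s → ῑ (proj₁ (Inverse.to β s)) ≡ κ (proj₁ s)
    ῑ-β = Mβ.κ-forth

    γ : Exit F′ ↔ Exit F
    γ = Mγ.matching

    ιV-γ : ∀ s → ιV G K (proj₁ (Inverse.to γ s)) ≡ κ (proj₁ s)
    ιV-γ = Mγ.κ-forth

    κ-γ : ∀ s → κ (proj₁ (Inverse.from γ s)) ≡ ιV G K (proj₁ s)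
    κ-γ = Mγ.ι-back

  sameExits : #exits F′ ≡ #exits F
  sameExits = ℕₚ.≤-antisym
    (#-mono (isExit? F′) (isExit? F) (λ {u} p → Inverse.to γ (u , p))
      λ {u} {v} p q eq → κ-injective (trans (sym (ιV-γ (u , p))) (trans (cong (ιV G K) eq) (ιV-γ (v , q)))))
    (#-mono (isExit? F) (isExit? F′) (λ {u} p → Inverse.from γ (u , p))
      λ {u} {v} p q eq → ιV-injective {G} {K} (trans (sym (κ-γ (u , p))) (trans (cong κ eq) (κ-γ (v , q)))))

  private
    n̄V : ℕ
    n̄V = #V F̄

    ῑ-kept : ∀ v → Kept (ῑ v)
    ῑ-kept v with enum-satisfies (Induced.endPoint? G (∁ K)) v
    ... | a , a∈ , inj₁ s = subst Kept s (kept-old-src (x∈∁p⇒x∉p a∈))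
    ... | a , a∈ , inj₂ t = subst Kept t (kept-old-tgt (x∈∁p⇒x∉p a∈))

    onV⊎ : V F̄ ⊎ V F′ → V G′
    onV⊎ (inj₁ v) = rank kept? (ῑ-kept v)
    onV⊎ (inj₂ u) = ιV G′ K′ u

    onA⊎ : A F̄ ⊎ A F′ → A G′
    onA⊎ (inj₁ c) = mk (oldArc c)
    onA⊎ (inj₂ a) = ιA G′ K′ a

    ω : V F̄ ⊎ V F′ → V G
    ω = [ ῑ , κ ]′

    ι′-onV : ∀ s → ι′ (onV⊎ s) ≡ ω s
    ι′-onV (inj₁ v) = enum-rank kept? (ῑ-kept v)
    ι′-onV (inj₂ u) = refl

    onV-left : ∀ v → onV⊎ (splitAt n̄V (v ↑ˡ #V F′)) ≡ onV⊎ (inj₁ v)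
    onV-left v = cong onV⊎ (splitAt-↑ˡ n̄V v (#V F′))

    onV-right : ∀ u → onV⊎ (splitAt n̄V (n̄V ↑ʳ u)) ≡ onV⊎ (inj₂ u)
    onV-right u = cong onV⊎ (splitAt-↑ʳ n̄V (#V F′) u)

    src-comm : ∀ s → src G′ (onA⊎ s) ≡ onV⊎ (splitAt n̄V ([ (λ a → src F̄ a ↑ˡ #V F′) , (λ a → n̄V ↑ʳ src F′ a) ]′ s))
    src-comm (inj₁ c) = trans (ι′-injective (trans (ι′-src-mk (oldArc c))
      (sym (trans (ι′-onV (inj₁ (src F̄ c))) (Induced.ι-src G (∁ K) c))))) (sym (onV-left (src F̄ c)))
    src-comm (inj₂ a) = trans (sym (Induced.ι-src G′ K′ a)) (sym (onV-right (src F′ a)))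

    tgt-comm : ∀ s → tgt G′ (onA⊎ s) ≡ onV⊎ (splitAt n̄V ([ (λ a → tgt F̄ a ↑ˡ #V F′) , (λ a → n̄V ↑ʳ tgt F′ a) ]′ s))
    tgt-comm (inj₁ c) = trans (ι′-injective (trans (ι′-tgt-mk (oldArc c))
      (sym (trans (ι′-onV (inj₁ (tgt F̄ c))) (Induced.ι-tgt G (∁ K) c))))) (sym (onV-left (tgt F̄ c)))
    tgt-comm (inj₂ a) = trans (sym (Induced.ι-tgt G′ K′ a)) (sym (onV-right (tgt F′ a)))

    splitAt-injective : ∀ m {n} {i j : Fin (m + n)} → splitAt m i ≡ splitAt m j → i ≡ j
    splitAt-injective m {n} {i} {j} eq = trans (sym (join-splitAt m n i)) (trans (cong (join m n) eq) (join-splitAt m n j))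

    onA-injective : ∀ s t → onA⊎ s ≡ onA⊎ t → s ≡ t
    onA-injective (inj₁ c) (inj₁ d) eq = cong inj₁ (oldArc-injective (mk-injective eq))
      where
      oldArc-injective : ∀ {c d} → _≡_ {A = Arc} (oldArc c) (oldArc d) → c ≡ d
      oldArc-injective refl = refl
    onA-injective (inj₂ a) (inj₂ b) eq = cong inj₂ (ιA-injective {G′} {K′} eq)
    onA-injective (inj₁ c) (inj₂ b) eq = ⊥-elim (old∉′ c (subst (_∈ K′) (sym eq) (Induced.ιA∈K G′ K′ b)))
    onA-injective (inj₂ a) (inj₁ d) eq = ⊥-elim (old∉′ d (subst (_∈ K′) eq (Induced.ιA∈K G′ K′ a)))

    onA-onto : ∀ s → ∃ λ t → onA⊎ t ≡ mk s
    onA-onto (inj₁ c) = inj₁ c , refl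
    onA-onto (inj₂ s) = inj₂ (arcIn {G′} {K′} (new∈ s)) , ιA-arcIn {G′} {K′} (new∈ s)

    onA-surjective : ∀ a → ∃ λ t → onA⊎ t ≡ a
    onA-surjective a = let t , e = onA-onto (view a) in t , trans e (mk-view a)

    -- Every vertex of a 2-dd is the end of an arc, and all arcs are reached.
    onV-surjective : ∀ v → ∃ λ s → onV⊎ (splitAt n̄V s) ≡ v
    onV-surjective v =
      let a , ta = G′.Tgt.preimage v
          t , e = onA-surjective a
      in _ , trans (sym (tgt-comm t)) (trans (cong (tgt G′) e) ta)

    _~_ : Rel (V (F̄ ⊕ F′)) 0ℓ
    _~_ = ReplaceRel G K F′ α β

    α-glued : ∀ s → onV⊎ (inj₁ (proj₁ s)) ≡ onV⊎ (inj₂ (proj₁ (Inverse.to α s)))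
    α-glued s = ι′-injective {onV⊎ (inj₁ (proj₁ s))} {onV⊎ (inj₂ (proj₁ (Inverse.to α s)))}
      (trans (ι′-onV (inj₁ (proj₁ s))) (sym (κ-α s)))

    β-glued : ∀ s → onV⊎ (inj₂ (proj₁ s)) ≡ onV⊎ (inj₁ (proj₁ (Inverse.to β s)))
    β-glued s = ι′-injective {onV⊎ (inj₂ (proj₁ s))} {onV⊎ (inj₁ (proj₁ (Inverse.to β s)))}
      (trans (sym (ῑ-β s)) (sym (ι′-onV (inj₁ (proj₁ (Inverse.to β s))))))

    ~⇒≡ : ∀ {u v} → u ~ v → onV⊎ (splitAt n̄V u) ≡ onV⊎ (splitAt n̄V v)
    ~⇒≡ (inj₁ (s , refl , refl)) = trans (onV-left (proj₁ s)) (trans (α-glued s) (sym (onV-right (proj₁ (Inverse.to α s)))))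
    ~⇒≡ (inj₂ (s , refl , refl)) = trans (onV-right (proj₁ s)) (trans (β-glued s) (sym (onV-left (proj₁ (Inverse.to β s)))))

    -- The in-arcs of a vertex of `G` all lie in `K` or all outside, and so do its out-arcs. A
    -- vertex common to both parts is hence an exit of one and an entry of the other, so it is
    -- identified by `α` or by `β`.
    across : ∀ v u → ῑ v ≡ κ u → EqClosure _~_ (v ↑ˡ #V F′) (n̄V ↑ʳ u)
    across v u eq = meet (D.in? (κ u)) (D.out? (κ u))
      where
      leave : EntryLike (κ u) → EqClosure _~_ (v ↑ˡ #V F′) (n̄V ↑ʳ u)
      leave p = Eq.return {R = _~_} (inj₁ (s , refl , cong (λ w → n̄V ↑ʳ w) u≡))
        where
        s : Exit F̄
        s = v , exitF̄⁺ v (subst EntryLike (sym eq) p)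
        u≡ : u ≡ proj₁ (Inverse.to α s)
        u≡ = κ-injective {u} {proj₁ (Inverse.to α s)} (trans (sym eq) (sym (κ-α s)))
      enter : ExitLike (κ u) → EqClosure _~_ (v ↑ˡ #V F′) (n̄V ↑ʳ u)
      enter p = Eq.symmetric _~_ (Eq.return {R = _~_} (inj₂ (s , refl , cong (λ w → w ↑ˡ #V F′) v≡)))
        where
        s : Exit F′
        s = u , exitF′⁺ u p
        v≡ : v ≡ proj₁ (Inverse.to β s)
        v≡ = ιV-injective {G} {∁ K} {v} {proj₁ (Inverse.to β s)} (trans eq (sym (ῑ-β s)))
      meet : Dec (D.In (κ u)) → Dec (D.Out (κ u)) → EqClosure _~_ (v ↑ˡ #V F′) (n̄V ↑ʳ u)
      meet (no ¬i) (no ¬o) = ⊥-elim ([ ¬i ∘ in′⇒in , ¬o ∘ out′⇒out ]′ (D′.inOrOut u))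
      meet (yes i) (yes o) = ⊥-elim ([ (λ ī → in̄⇒¬in ī (subst D.In (sym eq) i)) , (λ ō → out̄⇒¬out ō (subst D.Out (sym eq) o)) ]′ (D̄.inOrOut v))
      meet (no ¬i) (yes o) = leave (¬i , o)
      meet (yes i) (no ¬o) = enter (i , ¬o)

    ≡⇒~ : ∀ s t → onV⊎ s ≡ onV⊎ t → EqClosure _~_ (join n̄V (#V F′) s) (join n̄V (#V F′) t)
    ≡⇒~ s t eq = go s t (trans (sym (ι′-onV s)) (trans (cong ι′ eq) (ι′-onV t)))
      where
      go : ∀ s t → ω s ≡ ω t → EqClosure _~_ (join n̄V (#V F′) s) (join n̄V (#V F′) t)
      go (inj₁ v) (inj₁ w) e = subst (λ x → EqClosure _~_ (v ↑ˡ #V F′) (x ↑ˡ #V F′)) (ιV-injective {G} {∁ K} e) ε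
      go (inj₂ v) (inj₂ w) e = subst (λ x → EqClosure _~_ (n̄V ↑ʳ v) (n̄V ↑ʳ x)) (κ-injective e) ε
      go (inj₁ v) (inj₂ w) e = across v w e
      go (inj₂ v) (inj₁ w) e = Eq.symmetric _ (across w v (sym e))

    onV : V (F̄ ⊕ F′) → V G′
    onV s = onV⊎ (splitAt n̄V s)

    onA : A (F̄ ⊕ F′) → A G′
    onA s = onA⊎ (splitAt (#A F̄) s)

    onA-bijective : Bijective _≡_ _≡_ onA
    onA-bijective = (λ {a} {b} eq → splitAt-injective (#A F̄) (onA-injective (splitAt (#A F̄) a) (splitAt (#A F̄) b) eq)) , onto
      where
      onto : Surjective _≡_ _≡_ onA
      onto a = let t , e = onA-surjective a in
        join (#A F̄) (#A F′) t , λ { refl → trans (cong onA⊎ (splitAt-join (#A F̄) (#A F′) t)) e }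

    onV-onto : Surjective _≡_ _≡_ onV
    onV-onto v = let s , e = onV-surjective v in s , λ { refl → e }

    kernel⁺ : ∀ {u v} → onV u ≡ onV v → EqClosure _~_ u v
    kernel⁺ {u} {v} eq = subst₂ (EqClosure _~_) (join-splitAt n̄V (#V F′) u) (join-splitAt n̄V (#V F′) v)
                       (≡⇒~ (splitAt n̄V u) (splitAt n̄V v) eq)

    kernel⁻ : ∀ {u v} → EqClosure _~_ u v → onV u ≡ onV v
    kernel⁻ = Eq.gfold isEquivalence onV ~⇒≡

    identification : IsIdentification (F̄ ⊕ F′) _~_ G′
    identification = record
      { onV = onV
      ; onA = onA
      ; src-comm = λ a → src-comm (splitAt (#A F̄) a)
      ; tgt-comm = λ a → tgt-comm (splitAt (#A F̄) a)
      ; onA-bij = onA-bijective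
      ; onV-surj = onV-onto
      ; onV-ker = λ u v → mk⇔ kernel⁺ kernel⁻
      }

  isReplacement : IsReplacement G K F′ G′
  isReplacement = D′.is2Digraph , sameExits , α , β , identification

-- Comparison of orbits in `G` and `G′`

module Transfer {G : Digraph} (dd : Is2dd G) {K : Subset (#A G)} (closed : Closed G (_∈ K)) (L : Labelling G K)
                (six : AllAltCyclesHave6Arcs G)
                {h : Partial 6 6} (glued : ∀ z → Labels.Glued dd closed L z (lookup h z))
                (sol : Solution h) where

  open Solution sol
  open TwoDD G dd
  open Labels dd closed L
  open Replace dd closed L six {h} glued {x} {y} embeds
  open Gluing h using (IsSource; flow; module Candidate)
  open Candidate x y using (place; flow′)

  place-sound : ∀ u {j} → place u ≡ just j → X j ≡ u
  place-sound u eq with any? (λ i → X i ≟ u)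
  place-sound u refl | yes (_ , e) = e

  place-complete : ∀ j → place (X j) ≡ just j
  place-complete j with any? (λ i → X i ≟ X j)
  ... | yes (i , e) = cong just (X-injective e)
  ... | no  n       = ⊥-elim (n (j , refl))

  X′ Y′ : Fin 3 → V G′
  X′ i = rank kept? (kept-st i)
  Y′ i = rank kept? (kept-en i)

  ι′-X′ : ∀ i → ι′ (X′ i) ≡ st (X i)
  ι′-X′ i = enum-rank kept? (kept-st i)

  ι′-Y′ : ∀ i → ι′ (Y′ i) ≡ en (Y i)
  ι′-Y′ i = enum-rank kept? (kept-en i)

  module Follow {S : Subset (#A G)} (alt : Alternating G S) where

    open Factor alt using (_~_)

    OldStep : Rel (V G′) 0ℓ
    OldStep u v = ∃ λ c → old c ∈ S × src G′ (mk (oldArc c)) ≡ u × tgt G′ (mk (oldArc c)) ≡ v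

    NewStep : Fin 3 → Rel (V G′) 0ℓ
    NewStep k u v = ∃ λ i → X′ i ≡ u × Y′ (turn next k i) ≡ v

    -- For `k` equal to 0 or 1 this will be the step relation of a factor of `G′`. For `2F` it uses
    -- the virtual matching, so a relation is needed in place of a set of arcs.
    Step′ : Fin 3 → Rel (V G′) 0ℓ
    Step′ k u v = OldStep u v ⊎ NewStep k u v

    module Simulate {c : Choice} (follow : Follows c S) {k : Fin 3} (sim : Simulation h x y c k) where

      open Simulation sim

      infix 4 _~′_
      _~′_ : Rel (V G′) 0ℓ
      _~′_ = EqClosure (Step′ k)

      ~-sym : ∀ {u v} → u ~ v → v ~ u
      ~-sym = Eq.symmetric (Step G S)

      ~′-sym : ∀ {u v} → u ~′ v → v ~′ u
      ~′-sym = Eq.symmetric (Step′ k)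

      ~-step : ∀ {u v} → Step G S u v → u ~ v
      ~-step s = fwd s ◅ ε

      ~′-step : ∀ {u v} → Step′ k u v → u ~′ v
      ~′-step s = fwd s ◅ ε

      step-st : ∀ u → Step G S (st u) (en (head c u))
      step-st u = let a , a∈K , ch , s , t = chosenArc c u in a , proj₂ (follow a∈K) ch , s , t

      step-leads : ∀ {u v} → Leads (flow c) u v → Step G S (st u) (st v)
      step-leads {u} e = subst (Step G S (st u))
        (sym (glued-just (trans (sym (lookup∘tabulate (λ u → lookup h (head c u)) u)) e))) (step-st u)

      to-root : ∀ u → st u ~ st (R u)
      to-root u = Star.gmap st (fwd ∘ step-leads) (root-reached (flow c) u)

      same-root : ∀ {u v} → R u ≡ R v → st u ~ st v
      same-root {u} {v} e = to-root u ◅◅ subst (λ w → st w ~ st v) (sym e) (~-sym (to-root v))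

      exit-just : ∀ i j → lookup h (exit i) ≡ just (X j) → (lookup h (exit i) >>= place) ≡ just j
      exit-just i j e = trans (cong (_>>= place) e) (place-complete j)

      Y′≡X′ : ∀ i j → lookup h (Y i) ≡ just (X j) → Y′ i ≡ X′ j
      Y′≡X′ i j e = ι′-injective (trans (ι′-Y′ i) (trans (sym (glued-just e)) (sym (ι′-X′ j))))

      leads′ : ∀ {i j} → Leads (flow′ (tabulate exit)) i j → Step′ k (X′ i) (X′ j)
      leads′ {i} {j} e = inj₂ (i , refl , into (lookup h (exit i)) refl (trans (sym at) e))
        where
        at : lookup (flow′ (tabulate exit)) i ≡ (lookup h (exit i) >>= place)
        at = trans (lookup-map i (λ z → lookup h z >>= place) (tabulate exit))
                   (cong (λ z → lookup h z >>= place) (lookup∘tabulate exit i))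
        into : ∀ m → lookup h (exit i) ≡ m → (m >>= place) ≡ just j → Y′ (turn next k i) ≡ X′ j
        into (just u) eq p = Y′≡X′ (turn next k i) j (trans eq (cong just (sym (place-sound u p))))

      to-root′ : ∀ i → X′ i ~′ X′ (R′ i)
      to-root′ i = Star.gmap X′ (fwd ∘ leads′) (root-reached (flow′ (tabulate exit)) i)

      same-root′ : ∀ {i j} → R (t i) ≡ R (t j) → X′ i ~′ X′ j
      same-root′ {i} {j} e = to-root′ i ◅◅ subst (λ l → X′ l ~′ X′ j) (sym (separated i j e)) (~′-sym (to-root′ j))

      isX? : ∀ v → Dec (∃ λ i → X′ i ≡ v)
      isX? v = any? λ i → X′ i ≟ v

      isSt? : ∀ v → Dec (∃ λ u → st u ≡ v)
      isSt? v = any? λ u → st u ≟ v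

      X′-injective : ∀ {i j} → X′ i ≡ X′ j → i ≡ j
      X′-injective {i} {j} e = X-injective (st-injective (trans (sym (ι′-X′ i)) (trans (cong ι′ e) (ι′-X′ j))))

      abstract
        θ? : ∀ v → Dec (∃ λ i → X′ i ≡ v) → V G
        θ? v (yes (i , _)) = st (t i)
        θ? v (no _)        = ι′ v

        -- A start of `F′` goes to its representative in `F`, perhaps a different vertex of `G`;
        -- only its class matters.
        θ : V G′ → V G
        θ v = θ? v (isX? v)

        θ-X′ : ∀ i → θ (X′ i) ≡ st (t i)
        θ-X′ i = by (isX? (X′ i))
          where
          by : ∀ d → θ? (X′ i) d ≡ st (t i)
          by (yes (j , e)) = cong (λ j → st (t j)) (X′-injective e)
          by (no n)        = ⊥-elim (n (i , refl))

        θ-other : ∀ v → ¬ (∃ λ i → X′ i ≡ v) → θ v ≡ ι′ v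
        θ-other v ne = by (isX? v)
          where
          by : ∀ d → θ? v d ≡ ι′ v
          by (yes p) = ⊥-elim (ne p)
          by (no _)  = refl

      not-start : ∀ {v} → ¬ (∃ λ u → st u ≡ v) → Kept v
      not-start none (z , e , ne) with lookup h z in eqh
      ... | nothing = let i , Yi = sink-Y z eqh in ne i Yi
      ... | just u  = none (u , trans (glued-just eqh) e)

      abstract
        q? : ∀ v → Dec (∃ λ u → st u ≡ v) → V G′
        q? v (yes (u , _)) = X′ (r u)
        q? v (no none)     = rank kept? (not-start none)

        -- Removed vertices are starts of `F`, so they too receive an image, through `r`.
        q : V G → V G′
        q v = q? v (isSt? v)

        q-st : ∀ u → q (st u) ≡ X′ (r u)
        q-st u = by (isSt? (st u))
          where
          by : ∀ d → q? (st u) d ≡ X′ (r u)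
          by (yes (v , e)) = cong (λ v → X′ (r v)) (st-injective e)
          by (no n)        = ⊥-elim (n (u , refl))

        q-other : ∀ v → ¬ (∃ λ u → st u ≡ v) → ι′ (q v) ≡ v
        q-other v ne = by (isSt? v)
          where
          by : ∀ d → ι′ (q? v d) ≡ v
          by (yes p)   = ⊥-elim (ne p)
          by (no none) = enum-rank kept? (not-start none)

      src′ tgt′ : Fin n̄ → V G′
      src′ c = src G′ (mk (oldArc c))
      tgt′ c = tgt G′ (mk (oldArc c))

      ι′-src′ : ∀ c → ι′ (src′ c) ≡ src G (old c)
      ι′-src′ c = ι′-src-mk (oldArc c)

      ι′-tgt′ : ∀ c → ι′ (tgt′ c) ≡ tgt G (old c)
      ι′-tgt′ c = ι′-tgt-mk (oldArc c)

      θ-old-src : ∀ c → θ (src′ c) ≡ src G (old c)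
      θ-old-src c = trans (θ-other (src′ c) λ { (i , e) → src∉ (X i) (old∉ c) (trans (sym (ι′-X′ i)) (trans (cong ι′ e) (ι′-src′ c))) })
                          (ι′-src′ c)

      source-tgt : ∀ u {a} → a ∉ K → st u ≡ tgt G a → IsSource u
      source-tgt u a∉ e = ≢en⇒source λ z ez → tgt∉ z a∉ (trans ez e)

      -- The reason for pinning: if a common arc ends at a start of `F′`, this start is an entry,
      -- hence its own representative, and `θ` does not move it.
      θ-old-tgt : ∀ c → θ (tgt′ c) ≡ tgt G (old c)
      θ-old-tgt c = by (isX? (tgt′ c))
        where
        by : Dec (∃ λ i → X′ i ≡ tgt′ c) → θ (tgt′ c) ≡ tgt G (old c)
        by (no none) = trans (θ-other (tgt′ c) none) (ι′-tgt′ c)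
        by (yes (i , e)) = trans (cong θ (sym e)) (trans (θ-X′ i) (trans (cong st (pinned i (source-tgt (X i) (old∉ c) at))) at))
          where
          at : st (X i) ≡ tgt G (old c)
          at = trans (sym (ι′-X′ i)) (trans (cong ι′ e) (ι′-tgt′ c))

      θ-step : ∀ {u v} → Step′ k u v → θ u ~ θ v
      θ-step (inj₁ (c , c∈ , refl , refl)) = subst₂ _~_ (sym (θ-old-src c)) (sym (θ-old-tgt c)) (~-step (old c , c∈ , refl , refl))
      θ-step (inj₂ (i , refl , refl)) = subst (_~ θ (Y′ (turn next k i))) (sym (θ-X′ i)) (onward (lookup h (exit i)) refl)
        where
        onward : ∀ m → lookup h (exit i) ≡ m → st (t i) ~ θ (Y′ (turn next k i))
        -- The matching reaches an exit. In `F` the path runs on to the root of `t i`, whose arc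
        -- ends at that same exit by `follows-none`.
        onward nothing e = subst (st (t i) ~_) (sym at) (to-root (t i) ◅◅ ~-step (step-st (R (t i))))
          where
          at : θ (Y′ (turn next k i)) ≡ en (head c (R (t i)))
          at = trans (θ-other (Y′ (turn next k i)) λ { (j , ej) → glued-nothing e (X j) (trans (sym (ι′-X′ j)) (trans (cong ι′ ej) (ι′-Y′ (turn next k i)))) })
                 (trans (ι′-Y′ (turn next k i)) (cong en (sym (follows-none i (cong (_>>= place) e)))))
        onward (just u) e with glued-Y⇒X (turn next k i) u e
        ... | j , refl = subst (st (t i) ~_) (sym (trans (cong θ (Y′≡X′ (turn next k i) j e)) (θ-X′ j)))
                           (same-root (follows-just i j (exit-just i j e)))

      head-injective : ∀ {u v} → head c u ≡ head c v → u ≡ v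
      head-injective {u} {v} e =
        let a , a∈K , ch , sa , ta = chosenArc c u
            b , b∈K , ch′ , sb , tb = chosenArc c v
        in st-injective (trans (sym sa) (trans (cong (src G)
             (Factor.tgt-unique alt (proj₂ (follow a∈K) ch) (proj₂ (follow b∈K) ch′) (trans ta (trans (cong en e) (sym tb))))) sb))

      turn-surjective : ∀ k j → ∃ λ (i : Fin 3) → turn next k i ≡ j
      turn-surjective 0F j = j , refl
      turn-surjective 1F j = let i , e = next-surjective j ; l , e′ = next-surjective i in l , trans (cong next e′) e
      turn-surjective 2F j = next-surjective j

      q-leaves : ∀ u → q (st u) ~′ q (en (head c u))
      q-leaves u = subst (_~′ q (en (head c u))) (sym (q-st u)) (onward (lookup h (head c u)) refl)
        where
        onward : ∀ m → lookup h (head c u) ≡ m → X′ (r u) ~′ q (en (head c u))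
        onward (just v) e = subst (X′ (r u) ~′_) (trans (sym (q-st v)) (cong q (glued-just e)))
          (same-root′ (trans (covers u) (trans (rootsAgree c {u} {v} (trans (lookup∘tabulate (λ u → lookup h (head c u)) u) e)) (sym (covers v)))))
        -- The exit `head c u` is some `Y j`. The start of `F′` that the matching `k` sends there is
        -- represented in the class of `u`, because distinct chosen arcs have distinct ends.
        onward nothing e =
          let j , Yj = sink-Y (head c u) e
              i , ij = turn-surjective k j
              exit≡ : exit i ≡ head c u
              exit≡ = trans (cong Y ij) Yj
              Rti≡u : R (t i) ≡ u
              Rti≡u = head-injective (trans (follows-none i (cong (_>>= place) (trans (cong (lookup h) exit≡) e))) exit≡)
              Ru≡u : R u ≡ u
              Ru≡u = root-sink (flow c) u (trans (lookup∘tabulate (λ u → lookup h (head c u)) u) e)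
              at : Y′ (turn next k i) ≡ q (en (head c u))
              at = ι′-injective (trans (ι′-Y′ (turn next k i)) (trans (cong en exit≡) (sym (q-other (en (head c u)) λ { (v , ev) → glued-nothing e v ev }))))
          in subst (X′ (r u) ~′_) at (same-root′ (trans (covers u) (trans Ru≡u (sym Rti≡u))) ◅◅ ~′-step (inj₂ (i , refl , refl)))

      q-old-tgt : ∀ {a} (a∉ : a ∉ K) → tgt′ (index a∉) ~′ q (tgt G a)
      q-old-tgt {a} a∉ = by (isSt? (tgt G a))
        where
        v′ : V G′
        v′ = tgt′ (index a∉)
        ι′v′ : ι′ v′ ≡ tgt G a
        ι′v′ = trans (ι′-tgt′ (index a∉)) (cong (tgt G) (old-index a∉))
        by : Dec (∃ λ u → st u ≡ tgt G a) → v′ ~′ q (tgt G a)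
        by (no none) = subst (v′ ~′_) (ι′-injective (trans ι′v′ (sym (q-other (tgt G a) none)))) ε
        by (yes (u , e)) =
          let i , Xi = source-X u (source-tgt u a∉ e)
          in subst₂ _~′_ (ι′-injective (trans (ι′-X′ i) (trans (cong st Xi) (trans e (sym ι′v′)))))
               (trans (sym (q-st u)) (cong q e))
               (same-root′ (trans (cong R (trans (pinned i (subst IsSource (sym Xi) (source-tgt u a∉ e))) Xi)) (sym (covers u))))

      q-step : ∀ {u v} → Step G S u v → q u ~′ q v
      q-step (a , a∈S , refl , refl) = by (a ∈? K)
        where
        by : Dec (a ∈ K) → q (src G a) ~′ q (tgt G a)
        by (yes a∈K) = let u , s , t = chosen⁻ c (proj₁ (follow a∈K) a∈S) in
          subst₂ (λ v w → q v ~′ q w) (sym s) (sym t) (q-leaves u)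
        by (no a∉) = subst (_~′ q (tgt G a)) at
          (~′-step (inj₁ (index a∉ , subst (_∈ S) (sym (old-index a∉)) a∈S , refl , refl)) ◅◅ q-old-tgt a∉)
          where
          at : src′ (index a∉) ≡ q (src G a)
          at = ι′-injective (trans (ι′-src′ (index a∉)) (trans (cong (src G) (old-index a∉))
                 (sym (q-other (src G a) (λ { (u , e) → src∉ u a∉ e })))))

      qθ : ∀ v → q (θ v) ~′ v
      qθ v = by (isX? v)
        where
        by : Dec (∃ λ i → X′ i ≡ v) → q (θ v) ~′ v
        by (yes (i , e)) = subst₂ _~′_ (trans (sym (q-st (t i))) (cong q (trans (sym (θ-X′ i)) (cong θ e)))) e (same-root′ (covers (t i)))
        by (no none) = subst (_~′ v) (trans (sym (ι′-injective (q-other (ι′ v) not-st))) (cong q (sym (θ-other v none)))) ε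
          where
          not-st : ¬ (∃ λ u → st u ≡ ι′ v)
          not-st (u , e) = let i , Xi = X-kept {u} (subst Kept (sym e) (enum-satisfies kept? v)) in
            none (i , ι′-injective (trans (ι′-X′ i) (trans (cong st Xi) e)))

      θq : ∀ v → θ (q v) ~ v
      θq v = by (isSt? v)
        where
        by : Dec (∃ λ u → st u ≡ v) → θ (q v) ~ v
        by (yes (u , e)) = subst₂ _~_ (trans (sym (θ-X′ (r u))) (cong θ (trans (sym (q-st u)) (cong q e)))) e (same-root (covers u))
        by (no none) = subst (_~ v) (sym (trans (θ-other (q v) λ { (i , e) → none (X i , trans (sym (ι′-X′ i)) (trans (cong ι′ e) (q-other v none))) })
                                           (q-other v none))) ε

      θ-~ : ∀ {u v} → u ~′ v → θ u ~ θ v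
      θ-~ = Eq.gfold (Eq.isEquivalence (Step G S)) θ θ-step

      q-~ : ∀ {u v} → u ~ v → q u ~′ q v
      q-~ = Eq.gfold (Eq.isEquivalence (Step′ k)) q q-step

      sameOrbits : ∀ {m} → Exactly m (V G) _~_ → Exactly m (V G′) _~′_
      sameOrbits = Exactly-map {_≋_ = _~′_} q
        (λ {u} {v} e → ~-sym (θq u) ◅◅ θ-~ e ◅◅ θq v) q-~ _◅◅_ (λ v → θ v , qθ v)

      connected′ : (∀ u v → u ~ v) → ∀ u v → u ~′ v
      connected′ all u v = ~′-sym (qθ u) ◅◅ q-~ (all (θ u) (θ v)) ◅◅ qθ v

      connected : (∀ u v → u ~′ v) → ∀ u v → u ~ v
      connected all u v = ~-sym (θq u) ◅◅ θ-~ (all (q u) (q v)) ◅◅ θq v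

-- Deterministic relations, and permutations of three points

module _ {A : Set} {_⟶_ : Rel A 0ℓ} (functional : ∀ {a b c} → a ⟶ b → a ⟶ c → b ≡ c) where

  -- A backward step before a nonempty forward path cancels its first step, which was the only one
  -- possible.
  joinable : ∀ {a b} → EqClosure _⟶_ a b → ∃ λ c → Star _⟶_ a c × Star _⟶_ b c
  joinable {a} ε = a , ε , ε
  joinable (fwd s ◅ p) = let c , l , r = joinable p in c , s ◅ l , r
  joinable {a} (bwd s ◅ p) with joinable p
  ... | _ , ε , r = a , ε , r ◅◅ s ◅ ε
  ... | c , s′ ◅ l , r = c , subst (λ x → Star _⟶_ x c) (functional s′ s) l , r

  -- Applied to the common arcs and to their reversal, this shows that no two starts of `F′`, and no
  -- two ends, are joined by common arcs alone.
  terminal-unique : ∀ {a b} → (∀ {c} → ¬ (a ⟶ c)) → (∀ {c} → ¬ (b ⟶ c)) → EqClosure _⟶_ a b → a ≡ b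
  terminal-unique {a} {b} ta tb p with joinable p
  ... | _ , ε , ε = refl
  ... | _ , ε , s ◅ _ = ⊥-elim (tb s)
  ... | _ , s ◅ _ , _ = ⊥-elim (ta s)

eqClosure-flip : {A : Set} {R : Rel A 0ℓ} {a b : A} → EqClosure R a b → EqClosure (flip R) a b
eqClosure-flip = Star.map λ { (fwd s) → bwd s ; (bwd s) → fwd s }

-- If the common arcs lead from the end `j` of `F′` to the start `σ j`, this is the first-return map
-- on the starts when `F′` uses the matching `k`.
loop : Fin 3 → Vec (Fin 3) 3 → Partial 3 3
loop k σ = tabulate λ i → just (lookup σ (turn next k i))

Constant : Partial 3 3 → Set
Constant f = ∀ i j → root f i ≡ root f j

constant? : ∀ f → Dec (Constant f)
constant? f = all? λ i → all? λ j → root f i ≟ root f j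

-- `Constant` expresses that a permutation is a single 3-cycle. If `loop 2F σ` is one, then `σ` is
-- even and the three loops are the three even permutations, of which only the identity is not a
-- 3-cycle. The first component says that roots do not change along the virtual loop.
ThreeCycle : Vec (Fin 3) 3 → Set
ThreeCycle σ = (∀ i j → lookup σ i ≡ lookup σ j → i ≡ j) →
    (∀ i → root (loop 2F σ) i ≡ root (loop 2F σ) (lookup σ (turn next 2F i)))
  × (Constant (loop 2F σ) → ∃ λ (k : Fin 2) → Constant (loop (k ↑ˡ 1) σ))

threeCycle? : ∀ σ → Dec (ThreeCycle σ)
threeCycle? σ = (all? λ i → all? λ j → (lookup σ i ≟ lookup σ j) →-dec (i ≟ j)) →-dec
  ((all? λ i → root (loop 2F σ) i ≟ root (loop 2F σ) (lookup σ (turn next 2F i)))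
   ×-dec (constant? (loop 2F σ) →-dec any? λ (k : Fin 2) → constant? (loop (k ↑ˡ 1) σ)))

threeCycle : ∀ σ → ThreeCycle σ
threeCycle (a ∷ b ∷ c ∷ []) = holds check refl a b c
  where
  check : Dec (∀ a b c → ThreeCycle (a ∷ b ∷ c ∷ []))
  check = all? λ a → all? λ b → all? λ c → threeCycle? (a ∷ b ∷ c ∷ [])

next³ : (i : Fin 3) → next (next (next i)) ≡ i
next³ 0F = refl
next³ 1F = refl
next³ 2F = refl

-- Oddness and H-equivalence of `G′`

module Final {G : Digraph} (dd : Is2dd G) {K : Subset (#A G)} (closed : Closed G (_∈ K)) (L : Labelling G K)
             (six : AllAltCyclesHave6Arcs G)
             {h : Partial 6 6} (glued : ∀ z → Labels.Glued dd closed L z (lookup h z))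
             (sol : Solution h) where

  open Solution sol
  open TwoDD G dd
  open Labels dd closed L
  open Replace dd closed L six {h} glued {x} {y} embeds
  open Transfer dd closed L six {h} glued sol
  open Gluing h using (flow)

  chosen⊆K : ∀ c {a} → Chosen c a → a ∈ K
  chosen⊆K c (z , inj₁ (refl , _)) = fw∈ z
  chosen⊆K c (z , inj₂ (refl , _)) = bw∈ z

  private
    Opposite : Choice → A G → A G → Set
    Opposite c a b = (Chosen c a → ¬ Chosen c b) × (¬ Chosen c a → Chosen c b)

    opposite : ∀ c z w → arm c z ≡ arm c w → Opposite c (fw z) (bw w) × Opposite c (bw w) (fw z)
    opposite c z w eq = by (arm c z) refl
      where
      0≢1 : 0F ≢ Fin.suc {1} 0F
      0≢1 ()
      by : ∀ i → arm c z ≡ i → Opposite c (fw z) (bw w) × Opposite c (bw w) (fw z)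
      by 0F e = ((λ _ q → 0≢1 (trans (sym (trans (sym eq) e)) (chosen-bw⁻ c w q))) , λ n → ⊥-elim (n (z , inj₁ (refl , e))))
              , ((λ q → ⊥-elim (0≢1 (trans (sym (trans (sym eq) e)) (chosen-bw⁻ c w q)))) , λ _ → z , inj₁ (refl , e))
      by 1F e = ((λ p → ⊥-elim (0≢1 (trans (sym (chosen-fw⁻ c z p)) e))) , λ _ → w , inj₂ (refl , trans (sym eq) e))
              , ((λ _ p → 0≢1 (trans (sym (chosen-fw⁻ c z p)) e)) , λ n → ⊥-elim (n (w , inj₂ (refl , trans (sym eq) e))))

    chosen-alternating : ∀ c {a b} → a ∈ K → a ≢ b → tgt G a ≡ tgt G b ⊎ src G a ≡ src G b → Opposite c a b
    chosen-alternating c a∈ = by (cover a∈)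
      where
      Same : A G → A G → Set
      Same a b = tgt G a ≡ tgt G b ⊎ src G a ≡ src G b
      by : ∀ {a b} → (∃ λ z → fw z ≡ a ⊎ bw z ≡ a) → a ≢ b → Same a b → Opposite c a b
      by (z , inj₁ refl) a≢b (inj₁ e) with tgt-en⁻ z (sym e)
      ... | inj₁ b≡ = ⊥-elim (a≢b (sym b≡))
      ... | inj₂ refl = proj₁ (opposite c z z refl)
      by (z , inj₂ refl) a≢b (inj₁ e) with tgt-en⁻ z (trans (sym e) (sym (ends z)))
      ... | inj₁ refl = proj₂ (opposite c z z refl)
      ... | inj₂ b≡ = ⊥-elim (a≢b (sym b≡))
      by (z , inj₁ refl) a≢b (inj₂ e) with src-st⁻ z (sym e)
      ... | inj₁ b≡ = ⊥-elim (a≢b (sym b≡))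
      ... | inj₂ refl = proj₁ (opposite c z (rot (rot z)) (sym (trans (arm-rot c (rot z)) (arm-rot c z))))
      by (z , inj₂ refl) a≢b (inj₂ e) with src-st⁻ (rot z) (trans (sym e) (starts z))
      ... | inj₁ refl = proj₂ (opposite c (rot z) z (arm-rot c z))
      ... | inj₂ b≡ = ⊥-elim (a≢b (sym (trans b≡ (cong bw (rot³ z)))))

  -- A factor of G′ restricted to the common arcs, completed by the factor c of F.
  module Extend {S′ : Subset (#A G′)} (alt′ : Alternating G′ S′) (c : Choice) where

    InS : A G → Set
    InS a = Chosen c a ⊎ ∃ λ i → old i ≡ a × mk (oldArc i) ∈ S′

    inS? : ∀ a → Dec (InS a)
    inS? a = chosen? c a ⊎-dec any? λ i → (old i ≟ a) ×-dec (mk (oldArc i) ∈? S′)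

    S : Subset (#A G)
    S = subset inS?

    in⁻ : ∀ {a} → a ∈ K → a ∈ S → Chosen c a
    in⁻ {a} a∈K a∈S = by (subset⁻ inS? a∈S)
      where
      by : InS a → Chosen c a
      by (inj₁ ch) = ch
      by (inj₂ (i , e , _)) = ⊥-elim (old∉ i (subst (_∈ K) (sym e) a∈K))

    old⁺ : ∀ {i} → mk (oldArc i) ∈ S′ → old i ∈ S
    old⁺ {i} i∈ = subset⁺ inS? (inj₂ (i , refl , i∈))

    old⁻ : ∀ {i} → old i ∈ S → mk (oldArc i) ∈ S′
    old⁻ {i} i∈ = by (subset⁻ inS? i∈)
      where
      by : InS (old i) → mk (oldArc i) ∈ S′
      by (inj₁ ch) = ⊥-elim (old∉ i (chosen⊆K c ch))
      by (inj₂ (j , e , j∈)) = subst (λ i → mk (oldArc i) ∈ S′) (old-injective e) j∈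

    follow : Follows c S
    follow a∈K = in⁻ a∈K , λ ch → subset⁺ inS? (inj₁ ch)

    alternating : Alternating G S
    alternating {a} {b} a≢b same = by (a ∈? K)
      where
      by : Dec (a ∈ K) → (a ∈ S → b ∉ S) × (a ∉ S → b ∈ S)
      by (yes a∈K) = (λ a∈S b∈S → proj₁ opp (in⁻ a∈K a∈S) (in⁻ b∈K b∈S))
                   , λ a∉S → proj₂ (follow b∈K) (proj₂ opp (a∉S ∘ proj₂ (follow a∈K)))
        where
        b∈K : b ∈ K
        b∈K = closed same a∈K
        opp : Opposite c a b
        opp = chosen-alternating c a∈K a≢b same
      by (no a∉) = (λ a∈S b∈S → proj₁ flips (old⁻ (subst (_∈ S) (sym (old-index a∉)) a∈S)) (old⁻ (subst (_∈ S) (sym (old-index b∉)) b∈S)))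
                 , λ a∉S → subst (_∈ S) (old-index b∉) (old⁺ (proj₂ flips λ a∈ → a∉S (subst (_∈ S) (old-index a∉) (old⁺ a∈))))
        where
        b∉ : b ∉ K
        b∉ b∈ = a∉ (closed (Sum.map sym sym same) b∈)
        flips : (mk (oldArc (index a∉)) ∈ S′ → mk (oldArc (index b∉)) ∉ S′) × (mk (oldArc (index a∉)) ∉ S′ → mk (oldArc (index b∉)) ∈ S′)
        flips = alt′ (λ e → a≢b (trans (sym (old-index a∉)) (trans (cong old (oldArc-inj (mk-injective e))) (old-index b∉))))
          (Sum.map (λ e → ι′-injective (trans (ι′-tgt-mk (oldArc (index a∉))) (trans (cong (tgt G) (old-index a∉)) (trans e
                      (sym (trans (ι′-tgt-mk (oldArc (index b∉))) (cong (tgt G) (old-index b∉))))))))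
                   (λ e → ι′-injective (trans (ι′-src-mk (oldArc (index a∉))) (trans (cong (src G) (old-index a∉)) (trans e
                      (sym (trans (ι′-src-mk (oldArc (index b∉))) (cong (src G) (old-index b∉)))))))) same)
          where
          oldArc-inj : ∀ {c d} → _≡_ {A = Arc} (oldArc c) (oldArc d) → c ≡ d
          oldArc-inj refl = refl

  NewArcs : Fin 2 → Subset (#A G′) → Set
  NewArcs 0F S′ = (∀ i → mk (fwdArc i) ∈ S′) × (∀ i → mk (bwdArc i) ∉ S′)
  NewArcs 1F S′ = (∀ i → mk (fwdArc i) ∉ S′) × (∀ i → mk (bwdArc i) ∈ S′)

  module Compare {S : Subset (#A G)} (alt : Alternating G S) {S′ : Subset (#A G′)} {j : Fin 2} (new : NewArcs j S′)
                 (old⁺ : ∀ {i} → mk (oldArc i) ∈ S′ → old i ∈ S) (old⁻ : ∀ {i} → old i ∈ S → mk (oldArc i) ∈ S′) where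

    open Follow alt

    private
      X′≡ : ∀ i → X′ i ≡ src G′ (mk (fwdArc i))
      X′≡ i = ι′-injective (trans (ι′-X′ i) (sym (ι′-src-mk (fwdArc i))))
      X′≡b : ∀ i → X′ (next i) ≡ src G′ (mk (bwdArc i))
      X′≡b i = ι′-injective (trans (ι′-X′ (next i)) (sym (ι′-src-mk (bwdArc i))))
      Y′≡ : ∀ i → Y′ i ≡ tgt G′ (mk (fwdArc i))
      Y′≡ i = ι′-injective (trans (ι′-Y′ i) (sym (ι′-tgt-mk (fwdArc i))))
      Y′≡b : ∀ i → Y′ i ≡ tgt G′ (mk (bwdArc i))
      Y′≡b i = ι′-injective (trans (ι′-Y′ i) (sym (ι′-tgt-mk (bwdArc i))))

    to-step : ∀ {u v} → Step′ (j ↑ˡ 1) u v → Step G′ S′ u v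
    to-step (inj₁ (c , c∈ , s , t)) = mk (oldArc c) , old⁻ c∈ , s , t
    to-step (inj₂ (i , refl , refl)) = by j new
      where
      by : ∀ j → NewArcs j S′ → Step G′ S′ (X′ i) (Y′ (turn next (j ↑ˡ 1) i))
      by 0F (f∈ , _) = mk (fwdArc i) , f∈ i , sym (X′≡ i) , sym (Y′≡ i)
      -- The backward arc `l` leaves the start `next l`, so the one leaving `i` has the index
      -- `next (next i)`.
      by 1F (_ , b∈) = mk (bwdArc (next (next i))) , b∈ _ , trans (sym (X′≡b (next (next i)))) (cong X′ (next³ i)) , sym (Y′≡b (next (next i)))

    from-step : ∀ {u v} → Step G′ S′ u v → Step′ (j ↑ˡ 1) u v
    from-step (a , a∈ , refl , refl) = subst (λ a → Step′ (j ↑ˡ 1) (src G′ a) (tgt G′ a)) (mk-view a)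
      (by (view a) j new (subst (_∈ S′) (sym (mk-view a)) a∈))
      where
      by : ∀ s j → NewArcs j S′ → mk s ∈ S′ → Step′ (j ↑ˡ 1) (src G′ (mk s)) (tgt G′ (mk s))
      by (oldArc c) j _ s∈ = inj₁ (c , old⁺ s∈ , refl , refl)
      by (fwdArc i) 0F _ _ = inj₂ (i , X′≡ i , Y′≡ i)
      by (fwdArc i) 1F (f∉ , _) s∈ = ⊥-elim (f∉ i s∈)
      by (bwdArc i) 0F (_ , b∉) s∈ = ⊥-elim (b∉ i s∈)
      by (bwdArc i) 1F _ _ = inj₂ (next i , X′≡b i , trans (cong Y′ (next³ i)) (Y′≡b i))

    to-~ : ∀ {u v} → EqClosure (Step′ (j ↑ˡ 1)) u v → EqClosure (Step G′ S′) u v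
    to-~ = Eq.map to-step

    from-~ : ∀ {u v} → EqClosure (Step G′ S′) u v → EqClosure (Step′ (j ↑ˡ 1)) u v
    from-~ = Eq.map from-step

  newArcs : ∀ {S′} → IsFactor G′ S′ → ∃ λ j → NewArcs j S′
  newArcs factor = by (factor newCycle)
    where
    by : _ → _
    by (inj₁ p) = 0F , p
    by (inj₂ p) = 1F , p

  odd : Odd G → Odd G′
  odd G-odd S′ factor =
    let j , new = newArcs factor
        c , sim = realised j
        open Extend (G′.factor⇒alternating factor) c
        open Follow alternating
        open Simulate follow sim
        m , cycles , m-odd = G-odd S (alternating⇒factor alternating)
        open Compare alternating {S′} {j} new old⁺ old⁻
    in m , G′.Factor.Exactly⇒#Cycles (G′.factor⇒alternating factor)
             (Exactly-map (λ v → v) from-~ to-~ _◅◅_ (λ v → v , ε)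
               (sameOrbits (Factor.#Cycles⇒Exactly alternating cycles))) , m-odd

  hamiltonian⁻ : V G → Hamiltonian G′ → Hamiltonian G
  hamiltonian⁻ v ham =
    let S′ , alt′ , all = G′.hamiltonian⇒factor ham
        j , new = newArcs (alternating⇒factor alt′)
        c , sim = realised j
        open Extend alt′ c
        open Follow alternating
        open Simulate follow sim
        open Compare alternating {S′} {j} new old⁺ old⁻
    in factor⇒hamiltonian v (S , alternating , connected λ u v → from-~ (all u v))

  -- A factor of G restricted to the common arcs, completed by the forward or the backward new arcs.
  module Restricted {S : Subset (#A G)} (alt : Alternating G S) (j : Fin 2) where

    In′ : Arc → Set
    In′ (oldArc c) = old c ∈ S
    In′ (fwdArc i) = j ≡ 0F
    In′ (bwdArc i) = j ≡ 1F

    in′? : ∀ s → Dec (In′ s)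
    in′? (oldArc c) = old c ∈? S
    in′? (fwdArc i) = j ≟ 0F
    in′? (bwdArc i) = j ≟ 1F

    S′ : Subset (#A G′)
    S′ = subset (λ a → in′? (view a))

    in⁺ : ∀ {s} → In′ s → mk s ∈ S′
    in⁺ {s} p = subset⁺ (λ a → in′? (view a)) (subst In′ (sym (view-mk s)) p)

    in⁻ : ∀ {s} → mk s ∈ S′ → In′ s
    in⁻ {s} p = subst In′ (view-mk s) (subset⁻ (λ a → in′? (view a)) p)

    new : NewArcs j S′
    new = by j refl
      where
      by : ∀ i → j ≡ i → NewArcs i S′
      by 0F e = (λ i → in⁺ {fwdArc i} e) , λ i p → contra (trans (sym e) (in⁻ {bwdArc i} p))
        where
        contra : 0F ≢ Fin.suc {1} 0F
        contra ()
      by 1F e = (λ i p → contra (trans (sym (in⁻ {fwdArc i} p)) e)) , λ i → in⁺ {bwdArc i} e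
        where
        contra : 0F ≢ Fin.suc {1} 0F
        contra ()

    private
      Same : Arc → Arc → Set
      Same s t = to→ s ≡ to→ t ⊎ from→ s ≡ from→ t

      Flips : Arc → Arc → Set
      Flips s t = (In′ s → ¬ In′ t) × (¬ In′ s → In′ t)

      j-either : j ≡ 0F ⊎ j ≡ 1F
      j-either = by j
        where
        by : ∀ j → j ≡ 0F ⊎ j ≡ Fin.suc {1} 0F
        by 0F = inj₁ refl
        by 1F = inj₂ refl

      0≢1 : j ≡ 0F → j ≡ 1F → ∀ {Z : Set} → Z
      0≢1 refl ()

      flips : ∀ s t → s ≢ t → Same s t → Flips s t
      flips (oldArc c) (oldArc d) ne same = alt (λ e → ne (cong (λ c → oldArc c) (old-injective e))) same
      flips (fwdArc i) (bwdArc k) _ _ = (λ p q → 0≢1 p q) , λ n → [ (λ p → ⊥-elim (n p)) , (λ q → q) ]′ j-either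
      flips (bwdArc i) (fwdArc k) _ _ = (λ q p → 0≢1 p q) , λ n → [ (λ p → p) , (λ q → ⊥-elim (n q)) ]′ j-either
      flips (fwdArc i) (fwdArc k) ne (inj₁ e) = ⊥-elim (ne (cong (λ i → fwdArc i) (Y-injective (en-injective e))))
      flips (fwdArc i) (fwdArc k) ne (inj₂ e) = ⊥-elim (ne (cong (λ i → fwdArc i) (X-injective (st-injective e))))
      flips (bwdArc i) (bwdArc k) ne (inj₁ e) = ⊥-elim (ne (cong (λ i → bwdArc i) (Y-injective (en-injective e))))
      flips (bwdArc i) (bwdArc k) ne (inj₂ e) = ⊥-elim (ne (cong (λ i → bwdArc i) (next-injective (X-injective (st-injective e)))))
      flips (oldArc c) (fwdArc i) _ (inj₁ e) = ⊥-elim (tgt∉ (Y i) (old∉ c) (sym e))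
      flips (oldArc c) (fwdArc i) _ (inj₂ e) = ⊥-elim (src∉ (X i) (old∉ c) (sym e))
      flips (oldArc c) (bwdArc i) _ (inj₁ e) = ⊥-elim (tgt∉ (Y i) (old∉ c) (sym e))
      flips (oldArc c) (bwdArc i) _ (inj₂ e) = ⊥-elim (src∉ (X (next i)) (old∉ c) (sym e))
      flips (fwdArc i) (oldArc c) _ (inj₁ e) = ⊥-elim (tgt∉ (Y i) (old∉ c) e)
      flips (fwdArc i) (oldArc c) _ (inj₂ e) = ⊥-elim (src∉ (X i) (old∉ c) e)
      flips (bwdArc i) (oldArc c) _ (inj₁ e) = ⊥-elim (tgt∉ (Y i) (old∉ c) e)
      flips (bwdArc i) (oldArc c) _ (inj₂ e) = ⊥-elim (src∉ (X (next i)) (old∉ c) e)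

    alternating′ : Alternating G′ S′
    alternating′ {a} {b} a≢b same =
      let p , q = flips (view a) (view b) (λ e → a≢b (trans (sym (mk-view a)) (trans (cong mk e) (mk-view b))))
            (Sum.map (λ e → trans (sym (ι′-tgt a)) (trans (cong ι′ e) (ι′-tgt b)))
                     (λ e → trans (sym (ι′-src a)) (trans (cong ι′ e) (ι′-src b))) same)
      in (λ a∈ b∈ → p (out∈ a∈) (out∈ b∈)) , λ a∉ → into (q λ i → a∉ (into i))
      where
      out∈ : ∀ {a} → a ∈ S′ → In′ (view a)
      out∈ = subset⁻ (λ a → in′? (view a))
      into : ∀ {a} → In′ (view a) → a ∈ S′
      into = subset⁺ (λ a → in′? (view a))

    open Compare alt {S′} {j} new (λ {i} → in⁻ {oldArc i}) (λ {i} → in⁺ {oldArc i}) public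

  module HamiltonianFactor {S : Subset (#A G)} (alt : Alternating G S) (all : ∀ u v → EqClosure (Step G S) u v) where

    open Follow alt

    -- Starting from `st z`, the factor never leaves the starts with the same root as `z`; but a
    -- Hamiltonian cycle also has to reach `st w`.
    not-stuck : ∀ {c} → Follows c S → ¬ (∃ λ z → (∀ u → root (flow c) u ≡ root (flow c) z → lookup (flow c) u ≢ nothing)
                                                × ∃ λ w → root (flow c) w ≢ root (flow c) z)
    not-stuck {c} follow (z , inside , w , w≢z) =
      let u , su , ru = stay (Factor.~⇒Star alt (all (st z) (st w))) (z , refl , refl)
      in w≢z (trans (cong (root (flow c)) (st-injective (sym su))) ru)
      where
      Inside : V G → Set
      Inside v = ∃ λ u → st u ≡ v × root (flow c) u ≡ root (flow c) z
      advance : ∀ {v w} → Step G S v w → Inside v → Inside w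
      advance (a , a∈S , sa , ta) (u , su , ru) =
        let a∈K = closed (inj₂ (trans su (sym sa))) (fw∈ u)
            u′ , s , t = chosen⁻ c (proj₁ (follow a∈K) a∈S)
            u≡u′ = st-injective (trans su (trans (sym sa) s))
        in by u u≡u′ ru (trans (sym t) ta) (lookup h (head c u)) refl
        where
        by : ∀ {w u′} u → u ≡ u′ → root (flow c) u ≡ root (flow c) z → en (head c u′) ≡ w →
             ∀ m → lookup h (head c u) ≡ m → Inside w
        by u refl ru t nothing e = ⊥-elim (inside u ru (trans (lookup∘tabulate (λ u → lookup h (head c u)) u) e))
        by u refl ru t (just v) e = v , trans (glued-just e) t
          , trans (sym (rootsAgree c {u} {v} (trans (lookup∘tabulate (λ u → lookup h (head c u)) u) e))) ru
      stay : ∀ {v w} → Star (Step G S) v w → Inside v → Inside w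
      stay ε i = i
      stay (s ◅ p) i = stay p (advance s i)

    private module R₀ = Restricted alt 0F

    infix 4 _≈_
    _≈_ : Rel (V G′) 0ℓ
    _≈_ = EqClosure OldStep

    private
      ≈-sym : ∀ {u v} → u ≈ v → v ≈ u
      ≈-sym = Eq.symmetric OldStep

      src-old : ∀ c → ι′ (src G′ (mk (oldArc c))) ≡ src G (old c)
      src-old c = ι′-src-mk (oldArc c)

      tgt-old : ∀ c → ι′ (tgt G′ (mk (oldArc c))) ≡ tgt G (old c)
      tgt-old c = ι′-tgt-mk (oldArc c)

      old-functional : ∀ {u v w} → OldStep u v → OldStep u w → v ≡ w
      old-functional (c , c∈ , refl , refl) (d , d∈ , e , refl) =
        cong (λ c → tgt G′ (mk (oldArc c))) (old-injective (Factor.src-unique alt c∈ d∈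
          (trans (sym (src-old c)) (trans (cong ι′ (sym e)) (src-old d)))))

      old-cofunctional : ∀ {u v w} → OldStep v u → OldStep w u → v ≡ w
      old-cofunctional (c , c∈ , refl , refl) (d , d∈ , refl , e) =
        cong (λ c → src G′ (mk (oldArc c))) (old-injective (Factor.tgt-unique alt c∈ d∈
          (trans (sym (tgt-old c)) (trans (cong ι′ (sym e)) (tgt-old d)))))

      X′-terminal : ∀ i {v} → ¬ OldStep (X′ i) v
      X′-terminal i (c , _ , s , _) = src∉ (X i) (old∉ c) (trans (sym (ι′-X′ i)) (trans (cong ι′ (sym s)) (src-old c)))

      Y′-initial : ∀ i {v} → ¬ OldStep v (Y′ i)
      Y′-initial i (c , _ , _ , t) = tgt∉ (Y i) (old∉ c) (trans (sym (ι′-Y′ i)) (trans (cong ι′ (sym t)) (tgt-old c)))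

      X′-apart : ∀ {i j} → X′ i ≈ X′ j → i ≡ j
      X′-apart {i} {j} p = X-injective (st-injective (trans (sym (ι′-X′ i))
        (trans (cong ι′ (terminal-unique {_⟶_ = OldStep} old-functional (X′-terminal i) (X′-terminal j) p)) (ι′-X′ j))))

      Y′-apart : ∀ {i j} → Y′ i ≈ Y′ j → i ≡ j
      Y′-apart {i} {j} p = Y-injective (en-injective (trans (sym (ι′-Y′ i))
        (trans (cong ι′ (terminal-unique {_⟶_ = flip OldStep} old-cofunctional (Y′-initial i) (Y′-initial j) (eqClosure-flip p))) (ι′-Y′ j))))

      -- Following the factor with forward new arcs from Y′ j, which lies on a common cycle
      -- with X′ j, the first of the vertices X′ i to be met is reached along common arcs.
      first-hit : ∀ {v j} → Star (Step G′ R₀.S′) v (X′ j) → ∃ λ i → v ≈ X′ i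
      first-hit {j = j} ε = j , ε
      first-hit (s ◅ p) = by (R₀.from-step s) (first-hit p)
        where
        by : ∀ {u v} → Step′ 0F u v → (∃ λ i → v ≈ X′ i) → ∃ λ i → u ≈ X′ i
        by (inj₁ o) (i , p) = i , fwd o ◅ p
        by (inj₂ (i , refl , _)) _ = i , ε

      hit : ∀ j → ∃ λ i → Y′ j ≈ X′ i
      hit j = first-hit (G′.Factor.~⇒Star R₀.alternating′
        (Eq.symmetric (Step G′ R₀.S′) (R₀.to-~ (fwd (inj₂ (j , refl , refl)) ◅ ε))))

      abstract
        σ : Vec (Fin 3) 3
        σ = tabulate (λ j → proj₁ (hit j))

        σ-hit : ∀ j → Y′ j ≈ X′ (lookup σ j)
        σ-hit j = subst (λ i → Y′ j ≈ X′ i) (sym (lookup∘tabulate (λ j → proj₁ (hit j)) j)) (proj₂ (hit j))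

      σ-injective : ∀ i j → lookup σ i ≡ lookup σ j → i ≡ j
      σ-injective i j e = Y′-apart (σ-hit i ◅◅ subst (λ l → X′ l ≈ Y′ j) (sym e) (≈-sym (σ-hit j)))

      ρ : Fin 3 → Fin 3
      ρ = root (loop 2F σ)

      σ-facts : (∀ i → ρ i ≡ ρ (lookup σ (turn next 2F i))) × (Constant (loop 2F σ) → ∃ λ (k : Fin 2) → Constant (loop (k ↑ˡ 1) σ))
      σ-facts = threeCycle σ σ-injective

    module _ (all₂ : ∀ u v → EqClosure (Step′ 2F) u v) where

      private
        -- An invariant of the steps of the virtual factor: common arcs attach the vertex to a start
        -- that the loop puts into the class of `0F`. If the virtual factor connects everything, all
        -- starts get this label, so the loop is a 3-cycle.
        Labelled : V G′ → Set
        Labelled v = ∃ λ i → v ≈ X′ i × ρ i ≡ ρ 0F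

        relabel : ∀ {u v} → SymClosure (Step′ 2F) u v → Labelled u → Labelled v
        relabel (fwd (inj₁ o)) (i , p , e) = i , bwd o ◅ p , e
        relabel (bwd (inj₁ o)) (i , p , e) = i , fwd o ◅ p , e
        relabel (fwd (inj₂ (i′ , refl , refl))) (i , p , e) =
          lookup σ (turn next 2F i′) , σ-hit (turn next 2F i′)
          , trans (sym (proj₁ σ-facts i′)) (trans (cong ρ (X′-apart p)) e)
        relabel (bwd (inj₂ (i′ , refl , refl))) (i , p , e) =
          i′ , ε , trans (proj₁ σ-facts i′) (trans (cong ρ (X′-apart (≈-sym (σ-hit (turn next 2F i′)) ◅◅ p))) e)

        labelled : ∀ {u v} → EqClosure (Step′ 2F) u v → Labelled u → Labelled v
        labelled ε l = l
        labelled (s ◅ p) l = labelled p (relabel s l)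

        label : ∀ v → Labelled v
        label v = labelled (all₂ (X′ 0F) v) (0F , ε , refl)

        constant : Constant (loop 2F σ)
        constant i j = trans (at i) (sym (at j))
          where
          at : ∀ i → ρ i ≡ ρ 0F
          at i = let i′ , p , e = label (X′ i) in trans (cong ρ (X′-apart p)) e

      rerouted : ∃ λ (k : Fin 2) → ∀ u v → EqClosure (Step′ (k ↑ˡ 1)) u v
      rerouted =
        let k , const = proj₂ σ-facts constant
        in k , joined k const
        where
        joined : ∀ k → Constant (loop (k ↑ˡ 1) σ) → ∀ u v → EqClosure (Step′ (k ↑ˡ 1)) u v
        joined k const u v =
          let i , p , _ = label u
              i′ , p′ , _ = label v
          -- Both vertices are attached by common arcs to starts of `F′`, and these starts have the
          -- same root under the genuine loop `k`.
          in include p ◅◅ to-root i ◅◅ subst (λ l → X′ l ~k v) (sym (const i i′)) (~k-sym (to-root i′) ◅◅ ~k-sym (include p′))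
          where
          infix 4 _~k_
          _~k_ : Rel (V G′) 0ℓ
          _~k_ = EqClosure (Step′ (k ↑ˡ 1))
          ~k-sym : ∀ {u v} → u ~k v → v ~k u
          ~k-sym = Eq.symmetric (Step′ (k ↑ˡ 1))
          include : ∀ {u v} → u ≈ v → u ~k v
          include = Eq.map inj₁
          leads : ∀ {i j} → Leads (loop (k ↑ˡ 1) σ) i j → X′ i ~k X′ j
          leads {i} {j} e = subst (λ l → X′ i ~k X′ l)
            (just-injective (trans (sym (lookup∘tabulate (λ i → just (lookup σ (turn next (k ↑ˡ 1) i))) i)) e))
            (fwd (inj₂ (i , refl , refl)) ◅ include (σ-hit (turn next (k ↑ˡ 1) i)))
          to-root : ∀ i → X′ i ~k X′ (root (loop (k ↑ˡ 1) σ) i)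
          to-root i = Star.kleisliStar X′ leads (root-reached (loop (k ↑ˡ 1) σ) i)

    connects : ∀ k → (∀ u v → EqClosure (Step′ k) u v) → ∃ λ (j : Fin 2) → ∀ u v → EqClosure (Step′ (j ↑ˡ 1)) u v
    connects 0F p = 0F , p
    connects 1F p = 1F , p
    connects 2F p = rerouted p

    hamiltonian′ : V G′ → Hamiltonian G′
    hamiltonian′ v =
      let c , follow = follows alt
      in by follow (classified c)
      where
      by : ∀ {c} → Follows c S → _ ⊎ (∃ λ k → Simulation h x y c k) → Hamiltonian G′
      by follow (inj₁ stuck) = ⊥-elim (not-stuck follow stuck)
      by follow (inj₂ (k , sim)) =
        let j , connected = connects k (Simulate.connected′ follow sim all)
            open Restricted alt j
        in G′.factor⇒hamiltonian v (S′ , alternating′ , λ u v → to-~ (connected u v))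

  hamiltonian⁺ : Hamiltonian G → Hamiltonian G′
  hamiltonian⁺ ham = let S , alt , all = hamiltonian⇒factor ham in HamiltonianFactor.hamiltonian′ alt all (X′ 0F)

  hEquivalent : HEquivalent G G′
  hEquivalent = by (hamiltonian? (st 0F))
    where
    by : Dec (Hamiltonian G) → HEquivalent G G′
    by (yes ham) = inj₁ (ham , hamiltonian⁺ ham)
    by (no ¬ham) = inj₂ (¬ham , λ ham′ → ¬ham (hamiltonian⁻ (st 0F) ham′))

  conclusion : Odd G → ∃ λ (H : Digraph) → Is2dd H × Odd H × AllAltCyclesHave6Arcs H × HEquivalent G H ×
               (∃ λ (F′ : Digraph) → #AltCycles≡ F′ 1 × IsReplacement G K F′ H)
  conclusion G-odd = G′ , dd′ , odd G-odd , six′ , hEquivalent , F′ , oneAltCycle , isReplacement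

replaceable : ∀ {G} (dd : Is2dd G) {K} (closed : Closed G (_∈ K)) → Labelling G K → AllAltCyclesHave6Arcs G →
              #saturated (induced G K) > 2 → Odd G →
              ∃ λ (H : Digraph) → Is2dd H × Odd H × AllAltCyclesHave6Arcs H × HEquivalent G H ×
              (∃ λ (F′ : Digraph) → #AltCycles≡ F′ 1 × IsReplacement G K F′ H)
replaceable dd closed L six enough odd =
  let a , b , c , d , e , f , glued = Labels.glueing dd closed L
      h = glue a b c d e f
      sol = solutionOf a b c d e f (Labels.admissible dd closed L {h} glued enough)
  in Final.conclusion dd closed L six {h} glued sol odd

proposition13 : (G : Digraph) →
    Is2dd G → Clean G → AllAltCyclesHave6Arcs G →
    Odd G → Connected G → ¬ Is2Splittable G →
    (K : Subset (Digraph.#A G)) → IsUnionOfAltCycles G K →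
    #AltCycles≡ (induced G K) 2 →
    (s : ℕ) → Digraph.#saturated (induced G K) ≡ s → s > 2 →
    ∃ λ (G′ : Digraph) →
    Is2dd G′ × Odd G′ × AllAltCyclesHave6Arcs G′ × HEquivalent G G′ ×
    (IsCollapse G K G′ ⊎
    (∃ λ (F′ : Digraph) → #AltCycles≡ F′ 1 × IsReplacement G K F′ G′))
proposition13 G dd clean six odd _ _ K K-union two s refl s>2 =
  let H , ddH , oddH , sixH , hEq , replacement =
        replaceable dd (union-closed dd clean six K-union) (labelling dd clean six K-union two) six s>2 odd
  in H , ddH , oddH , sixH , hEq , inj₂ replacement
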